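{- Let $q$ be a prime power and $n,k,\delta$ positive integers with $n\geq2k+\delta$ and $k\geq 2\delta$. Then $$\bar A_q(n,2\delta,k)\geq q^{(n-k)(k-\delta+1)}\frac{1-q^{ -\lfloor k/\delta\rfloor\delta^2}}{1-q^{ -\delta^2}}+q^{(n-k-\delta)(k-\delta+1)}+A^R_q(k\times (n-k), \delta, [0,k-\delta]).$$
   Context: $\mathcal G_q(n,k)$ is the set of $k$-dimensional subspaces of $\mathbb F_q^n$, with subspace distance $d_S(\mathcal U,\mathcal V)=\dim\mathcal U+\dim\mathcal V-2\dim(\mathcal U\cap\mathcal V)$; an $(n,d,k)_q$-CDC is a subset of $\mathcal G_q(n,k)$ with pairwise subspace distance at least $d$. An MRD$[k\times(n-k),\delta]_q$ code is an $\mathbb F_q$-linear subspace of $\mathbb F_q^{k\times(n-k)}$ of dimension $\max\{k,n-k\}(\min\{k,n-k\}-\delta+1)$ whose nonzero elements have rank at least $\delta$; a lifted MRD code is $\{\mathrm{rowspace}(\boldsymbol I_k\mid\boldsymbol A):\boldsymbol A\in\mathcal D\}$ for such $\mathcal D$. $\bar A_q(n,2\delta,k)$ is the maximum size of an $(n,2\delta,k)_q$-CDC containing a lifted MRD code as a subset. $A^R_q(k\times(n-k),\delta,K)$ is the maximum size of a set of matrices in $\mathbb F_q^{k\times(n-k)}$, each of rank in $K$, with pairwise rank distance $\mathrm{rank}(\boldsymbol D_1-\boldsymbol D_2)\ge\delta$; $[a,b]$ is the set of integers $x$ with $a\le x\le b$. -}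

module Defs where

open import Data.Nat using (ℕ; zero; suc; _+_; _*_; _∸_; _≤_; _<_; _⊔_; _⊓_; _<?_)
open import Data.Nat.Properties using (∸-monoˡ-<; ≮⇒≥)
open import Data.Fin using (Fin; zero; suc; toℕ; fromℕ<)
open import Data.Fin.Properties using (toℕ<n)
open import Data.Product using (Σ; ∃; _×_; _,_)
open import Data.List using (List; length; lookup)
open import Relation.Binary.PropositionalEquality using (_≡_; _≢_)
open import Relation.Nullary using (¬_; yes; no)
open import Algebra.Core using (Op₁; Op₂)
open import Algebra.Structures using (IsCommutativeRing)
open import Function.Bundles using (_↔_)

-- A finite field with exactly q elements (such a field exists iff q is a
-- prime power, so quantifying over it fixes "q a prime power, F = F_q").
record FiniteField (q : ℕ) : Set₁ where
  field
    Carrier : Set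
    _+F_ _*F_ : Op₂ Carrier
    -F_ : Op₁ Carrier
    0# 1# : Carrier
    isCommutativeRing : IsCommutativeRing _≡_ _+F_ _*F_ -F_ 0# 1#
    0≢1 : 0# ≢ 1#
    inverse : ∀ x → x ≢ 0# → ∃ λ y → x *F y ≡ 1#
    enumeration : Fin q ↔ Carrier

module _ {q : ℕ} (F : FiniteField q) where
  open FiniteField F

  V : Set → Set
  V I = I → Carrier

  _≐_ : {I : Set} → V I → V I → Set
  v ≐ w = ∀ i → v i ≡ w i

  𝟘 : {I : Set} → V I
  𝟘 _ = 0#

  _⊕_ : {I : Set} → V I → V I → V I
  (v ⊕ w) i = v i +F w i

  _⊖_ : {I : Set} → V I → V I → V I
  (v ⊖ w) i = v i +F (-F (w i))

  _⊙_ : {I : Set} → Carrier → V I → V I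
  (a ⊙ v) i = a *F v i

  ΣF : (d : ℕ) → (Fin d → Carrier) → Carrier
  ΣF zero    f = 0#
  ΣF (suc d) f = f zero +F ΣF d (λ j → f (suc j))

  lincomb : {I : Set} {d : ℕ} → (Fin d → Carrier) → (Fin d → V I) → V I
  lincomb {d = d} c b i = ΣF d (λ j → c j *F b j i)

  InSpan : {I : Set} {d : ℕ} → (Fin d → V I) → V I → Set
  InSpan {d = d} b v = Σ (Fin d → Carrier) λ c → v ≐ lincomb c b

  LinIndep : {I : Set} {d : ℕ} → (Fin d → V I) → Set
  LinIndep {d = d} b = ∀ (c : Fin d → Carrier) → lincomb c b ≐ 𝟘 → ∀ j → c j ≡ 0#

  HasDim : {I : Set} → (V I → Set) → ℕ → Set
  HasDim {I} P d = Σ (Fin d → V I) λ b →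
    LinIndep b × (∀ v → (P v → InSpan b v) × (InSpan b v → P v))

  record Subspace (I : Set) : Set₁ where
    field
      mem   : V I → Set
      resp  : ∀ {v w} → v ≐ w → mem v → mem w
      zero∈ : mem 𝟘
      +∈    : ∀ {v w} → mem v → mem w → mem (v ⊕ w)
      ·∈    : ∀ a {v} → mem v → mem (a ⊙ v)
  open Subspace public

  _∩_ : {I : Set} → Subspace I → Subspace I → V I → Set
  (U ∩ W) v = mem U v × mem W v

  SubDistIs : {I : Set} → Subspace I → Subspace I → ℕ → Set
  SubDistIs U W e = Σ ℕ λ a → Σ ℕ λ b → Σ ℕ λ c →
    HasDim (mem U) a × HasDim (mem W) b × HasDim (U ∩ W) c × e ≡ (a + b) ∸ (c + c)

  -- (n,d,k)_q constant dimension code, given as a list of codewords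
  -- (pairwise distance ≥ d ≥ 1 forces the codewords to be distinct)
  IsCDC : (n d k : ℕ) → List (Subspace (Fin n)) → Set
  IsCDC n d k C =
    (∀ i → HasDim (mem (lookup C i)) k) ×
    (∀ i j → i ≢ j → Σ ℕ λ e → SubDistIs (lookup C i) (lookup C j) e × d ≤ e)

  Mat : ℕ → ℕ → Set
  Mat k l = V (Fin k × Fin l)

  row : {k l : ℕ} → Mat k l → Fin k → V (Fin l)
  row A i j = A (i , j)

  RankIs : {k l : ℕ} → Mat k l → ℕ → Set
  RankIs A r = HasDim (InSpan (row A)) r

  IsMRD : (k l δ : ℕ) → Subspace (Fin k × Fin l) → Set
  IsMRD k l δ D =
    HasDim (mem D) ((k ⊔ l) * (((k ⊓ l) ∸ δ) + 1)) ×
    (∀ A → mem D A → ¬ (A ≐ 𝟘) → Σ ℕ λ r → RankIs A r × δ ≤ r)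

  -- rows of the k × n matrix (I_k | A) for A a k × (n-k) matrix
  liftRow : {n k : ℕ} → Mat k (n ∸ k) → Fin k → V (Fin n)
  liftRow {n} {k} A i j with toℕ j <? k
  ... | yes _ with toℕ i Data.Nat.≟ toℕ j
  ...   | yes _ = 1#
  ...   | no  _ = 0#
  liftRow {n} {k} A i j | no j≮k =
    A (i , fromℕ< (∸-monoˡ-< (toℕ<n j) (≮⇒≥ j≮k)))

  LiftedIn : (n k : ℕ) → Subspace (Fin k × Fin (n ∸ k)) → List (Subspace (Fin n)) → Set
  LiftedIn n k D C = ∀ A → mem D A → Σ (Fin (length C)) λ i →
    ∀ v → (mem (lookup C i) v → InSpan (liftRow {n} {k} A) v) ×
          (InSpan (liftRow {n} {k} A) v → mem (lookup C i) v)

  IsRankCode : (k l δ rmax : ℕ) → List (Mat k l) → Set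
  IsRankCode k l δ rmax M =
    (∀ i → Σ ℕ λ r → RankIs (lookup M i) r × r ≤ rmax) ×
    (∀ i j → i ≢ j → Σ ℕ λ r → RankIs (lookup M i ⊖ lookup M j) r × δ ≤ r)

{-# OPTIONS --safe #-}

-- The code is assembled from several families of k-dimensional row spaces, with N = n − k and m = ⌊k/δ⌋.
-- For 0 ≤ i ≤ m the i-th family has its pivots in the first k + δ columns, except for the δ columns starting at k − iδ;
-- its free part is a k × N matrix A with pairwise rank distance δ that vanishes in the first δ columns of its last iδ
-- rows.  For i < m these A are the matrices of one linear MRD code (Gabidulin's, of dimension N(k − δ + 1)) satisfying
-- these iδ² linear conditions, so there are at least q^(N(k−δ+1) − iδ²) of them, and for i = 0 one gets the whole lifted
-- code.  For i = m they are the matrices of a k × (N − δ) MRD code, padded with δ zero columns.  The last family consists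
-- of the row spaces of (B | I) for the given matrices B of rank at most k − δ.
-- Two words of one family meet in the left kernel of a difference of matrices.  Two words of different families meet in a
-- space on which some k − δ coordinates are jointly injective, or which embeds into the row space of some B.
module Submission where

open import Defs
open import Algebra.Bundles using (CommutativeRing; CommutativeMonoid)
import Algebra.Properties.CommutativeMonoid.Sum as Sums
import Algebra.Properties.CommutativeSemiring.Binomial as Binomial
import Algebra.Properties.CommutativeSemiring.Exp as Exp
import Algebra.Properties.Ring as RingProperties
import Algebra.Properties.Semiring.Mult as Mult
import Algebra.Properties.Semiring.Sum as SemiringSums
import Algebra.Solver.Ring.NaturalCoefficients.Default as Solver
open import Data.Fin as Fin using (Fin; zero; suc; toℕ; fromℕ<)
import Data.Fin.Permutation as Perm
import Data.Fin.Properties as Fin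
open import Data.List using (List; []; _∷_; _++_; length; lookup; map; tabulate)
open import Data.List.Membership.Propositional.Properties using (∈-lookup)
open import Data.List.Properties using (length-++; length-map; length-tabulate)
open import Data.List.Relation.Unary.All as All using (All; []; _∷_)
import Data.List.Relation.Unary.All.Properties as All
open import Data.List.Relation.Unary.AllPairs as AllPairs using (AllPairs; []; _∷_)
import Data.List.Relation.Unary.AllPairs.Properties as AllPairs
open import Data.List.Relation.Unary.Any as Any using (Any)
import Data.List.Relation.Unary.Any.Properties as Any
open import Data.Nat as ℕ using (ℕ; zero; suc; z≤n; s≤s; NonZero)
open import Data.Nat.Combinatorics using (_C_; nCn≡1)
open import Data.Nat.DivMod using (_mod_; _%_; m%n<n; %-distribˡ-+; [m+kn]%n≡m%n; m<n⇒m%n≡m; m/n*n≤m; m≥n⇒m/n>0)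
import Data.Nat.Properties as ℕ
open import Data.Product using (Σ; ∃; _×_; _,_; proj₁; proj₂)
open import Data.Sum using (_⊎_; inj₁; inj₂; [_,_]′)
open import Function using (_∘_; id)
open import Function.Bundles using (Inverse)
open import Level using (0ℓ)
open import Relation.Binary.PropositionalEquality as ≡ using (_≡_; _≢_; refl; cong; cong₂; subst; subst₂; module ≡-Reasoning)
import Relation.Binary.Reasoning.Setoid as SetoidReasoning
open import Relation.Nullary using (¬_; Dec; yes; no; contradiction)
open import Relation.Nullary.Decidable using (_×-dec_; ¬?)

-- Finite fields and roots of polynomials

-- Gabidulin's code needs a field with q^N elements, but F is only known to have q elements: neither
-- the prime below q nor an irreducible polynomial is at hand. Additivity of u ↦ u^q is therefore
-- read off from polynomial identities over F itself, and the extension field is cut out of a group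
-- algebra. Dimensions are compared by counting vectors, and bases are found by exhaustive search.
-- The levels are spaced δ apart so that the gap of a later level lies among pivot columns of every
-- earlier one. The loss of at most iδ² dimensions makes the lower bounds for the level sizes a
-- geometric sequence with ratio q^(-δ²), whose sum is the fraction in the bound. The condition n ≥
-- 2k + δ enters twice: it puts all pivots of these levels into the first N columns, those of B in
-- (B | I), and it leaves N - δ ≥ k, so that the narrow MRD code has dimension (N - δ)(k - δ + 1).

module SumSingle (M : CommutativeMonoid 0ℓ 0ℓ) where
  open CommutativeMonoid M
  open Sums M public
  open SetoidReasoning setoid

  sum-ε : ∀ {n} {f : Fin n → Carrier} → (∀ i → f i ≈ ε) → sum f ≈ ε
  sum-ε {n} f≈ε = trans (sum-cong-≋ f≈ε) (sum-replicate-zero n)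

  sum-single : ∀ {n} (f : Fin n → Carrier) i → (∀ j → j ≢ i → f j ≈ ε) → sum f ≈ f i
  sum-single f zero    f≈ε =
    trans (∙-congˡ (sum-ε (λ j → f≈ε (suc j) (λ ())))) (identityʳ (f zero))
  sum-single f (suc i) f≈ε =
    trans (∙-cong (f≈ε zero (λ ())) (sum-single (f ∘ suc) i (λ j j≢i → f≈ε (suc j) (j≢i ∘ Fin.suc-injective))))
          (identityˡ (f (suc i)))

record IsFiniteField (R : CommutativeRing 0ℓ 0ℓ) (n : ℕ) : Set where
  open CommutativeRing R
  infix 4 _≈?_
  field
    _≈?_      : ∀ x y → Dec (x ≈ y)
    1≉0       : ¬ (1# ≈ 0#)
    inv       : ∀ x → ¬ (x ≈ 0#) → ∃ λ y → x * y ≈ 1#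
    element   : Fin n → Carrier
    index     : Carrier → Fin n
    index-cong    : ∀ {x y} → x ≈ y → index x ≡ index y
    element-index : ∀ x → element (index x) ≈ x
    index-element : ∀ i → index (element i) ≡ i

module FiniteFieldProperties (R : CommutativeRing 0ℓ 0ℓ) {n : ℕ} (isFiniteField : IsFiniteField R n) where
  open CommutativeRing R renaming (refl to ≈-refl; zero to *-zero)
  open IsFiniteField isFiniteField
  open Exp commutativeSemiring
  module Product = SumSingle *-commutativeMonoid
  open SetoidReasoning setoid

  *-cancelˡ-≉0 : ∀ x {y z} → ¬ (x ≈ 0#) → x * y ≈ x * z → y ≈ z
  *-cancelˡ-≉0 x {y} {z} x≉0 eq with inv x x≉0
  ... | x⁻¹ , xx⁻¹≈1 = trans (sym (lemma y)) (trans (*-congˡ eq) (lemma z))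
    where
    lemma : ∀ u → x⁻¹ * (x * u) ≈ u
    lemma u = begin
      x⁻¹ * (x * u)  ≈⟨ *-assoc x⁻¹ x u ⟨
      x⁻¹ * x * u    ≈⟨ *-congʳ (trans (*-comm x⁻¹ x) xx⁻¹≈1) ⟩
      1# * u         ≈⟨ *-identityˡ u ⟩
      u              ∎

  domain : ∀ x y → x * y ≈ 0# → x ≈ 0# ⊎ y ≈ 0#
  domain x y xy≈0 with x ≈? 0#
  ... | yes x≈0 = inj₁ x≈0
  ... | no  x≉0 = inj₂ (*-cancelˡ-≉0 x x≉0 (trans xy≈0 (sym (zeroʳ x))))

  product≉0 : ∀ {m} {f : Fin m → Carrier} → (∀ i → ¬ (f i ≈ 0#)) → ¬ (Product.sum f ≈ 0#)
  product≉0 {zero}  f≉0 = 1≉0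
  product≉0 {suc m} f≉0 eq with domain _ _ eq
  ... | inj₁ f₀≈0 = f≉0 zero f₀≈0
  ... | inj₂ ∏≈0  = product≉0 (f≉0 ∘ suc) ∏≈0

  private
    ifZero : Carrier → Carrier → Carrier → Carrier
    ifZero x u v with x ≈? 0#
    ... | yes _ = u
    ... | no  _ = v

    ifZero-yes : ∀ x u v → x ≈ 0# → ifZero x u v ≡ u
    ifZero-yes x u v x≈0 with x ≈? 0#
    ... | yes _   = refl
    ... | no  x≉0 = contradiction x≈0 x≉0

    ifZero-no : ∀ x u v → ¬ (x ≈ 0#) → ifZero x u v ≡ v
    ifZero-no x u v x≉0 with x ≈? 0#
    ... | yes x≈0 = contradiction x≈0 x≉0
    ... | no  _   = refl

    -- Replacing 0 by 1 keeps the product over all field elements nonzero, hence cancellable.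
    unit : Carrier → Carrier
    unit x = ifZero x 1# x

    unit-cong : ∀ {x y} → x ≈ y → unit x ≈ unit y
    unit-cong {x} {y} x≈y with x ≈? 0# | y ≈? 0#
    ... | yes _   | yes _   = ≈-refl
    ... | yes x≈0 | no  y≉0 = contradiction (trans (sym x≈y) x≈0) y≉0
    ... | no  x≉0 | yes y≈0 = contradiction (trans x≈y y≈0) x≉0
    ... | no  _   | no  _   = x≈y

    unit≉0 : ∀ x → ¬ (unit x ≈ 0#)
    unit≉0 x with x ≈? 0#
    ... | yes _   = 1≉0
    ... | no  x≉0 = x≉0

  -- Multiplication by `x` permutes the elements, so the product of all `units` is unchanged when
  -- each nonzero one is multiplied by `x`; cancelling it gives x^(n-1) = 1. The remaining copy of
  -- `x`, the one in `cofactor`, belongs to the element 0.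
  fermat-≉0 : ∀ x → ¬ (x ≈ 0#) → x ^ n ≈ x
  fermat-≉0 x x≉0 with inv x x≉0
  ... | x⁻¹ , xx⁻¹≈1 = begin
    x ^ n                                             ≈⟨ Product.sum-replicate n ⟨
    Product.sum {n} (λ _ → x)                         ≈⟨ Product.sum-cong-≋ split ⟩
    Product.sum (λ i → factor i * cofactor i)         ≈⟨ Product.∑-distrib-+ factor cofactor ⟩
    Product.sum factor * Product.sum cofactor         ≈⟨ *-cong factors≈1 cofactors≈x ⟩
    1# * x                                            ≈⟨ *-identityˡ x ⟩
    x                                                 ∎
    where
    factor cofactor : Fin n → Carrier
    factor   i = ifZero (element i) 1# x
    cofactor i = ifZero (element i) x 1#

    split : ∀ i → x ≈ factor i * cofactor i
    split i with element i ≈? 0#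
    ... | yes _ = sym (*-identityˡ x)
    ... | no  _ = sym (*-identityʳ x)

    cancel : ∀ u v → u * v ≈ 1# → ∀ i → index (u * element (index (v * element i))) ≡ i
    cancel u v uv≈1 i = ≡.trans (index-cong (begin
      u * element (index (v * element i))  ≈⟨ *-congˡ (element-index (v * element i)) ⟩
      u * (v * element i)                  ≈⟨ *-assoc u v (element i) ⟨
      u * v * element i                    ≈⟨ *-congʳ uv≈1 ⟩
      1# * element i                       ≈⟨ *-identityˡ (element i) ⟩
      element i                            ∎)) (index-element i)

    π : Perm.Permutation n n
    π = Perm.permutation (λ i → index (x * element i)) (λ i → index (x⁻¹ * element i))
          (cancel x x⁻¹ xx⁻¹≈1) (cancel x⁻¹ x (trans (*-comm x⁻¹ x) xx⁻¹≈1))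

    units : Fin n → Carrier
    units i = unit (element i)

    permuted : ∀ i → units (index (x * element i)) ≈ units i * factor i
    permuted i = trans (unit-cong (element-index (x * element i))) helper
      where
      helper : unit (x * element i) ≈ units i * factor i
      helper with element i ≈? 0#
      ... | yes e≈0 = trans (reflexive (ifZero-yes _ _ _ (trans (*-congˡ e≈0) (zeroʳ x)))) (sym (*-identityˡ 1#))
      ... | no  e≉0 = trans (reflexive (ifZero-no _ _ _ ([ x≉0 , e≉0 ]′ ∘ domain x (element i)))) (*-comm x (element i))

    factors≈1 : Product.sum factor ≈ 1#
    factors≈1 = *-cancelˡ-≉0 (Product.sum units) (product≉0 (λ i → unit≉0 (element i))) (begin
      Product.sum units * Product.sum factor             ≈⟨ Product.∑-distrib-+ units factor ⟨
      Product.sum (λ i → units i * factor i)             ≈⟨ Product.sum-cong-≋ permuted ⟨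
      Product.sum (λ i → units (index (x * element i)))  ≈⟨ Product.sum-permute units π ⟨
      Product.sum units                                  ≈⟨ *-identityʳ _ ⟨
      Product.sum units * 1#                             ∎)

    cofactors≈x : Product.sum cofactor ≈ x
    cofactors≈x = trans
      (Product.sum-single cofactor (index 0#) (λ j j≢ → reflexive (ifZero-no _ _ _
        (λ e≈0 → j≢ (≡.trans (≡.sym (index-element j)) (index-cong e≈0))))))
      (reflexive (ifZero-yes _ _ _ (element-index 0#)))

  n≢0 : n ≢ 0
  n≢0 refl with index 0#
  ... | ()

  0^[1+n]≈0 : ∀ m → 0# ^ suc m ≈ 0#
  0^[1+n]≈0 m = zeroˡ (0# ^ m)

  fermat : ∀ x → x ^ n ≈ x
  fermat x with x ≈? 0#
  ... | no  x≉0 = fermat-≉0 x x≉0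
  ... | yes x≈0 = trans (^-congˡ n x≈0) (trans (0^n≈0 n n≢0) (sym x≈0))
    where
    0^n≈0 : ∀ m → m ≢ 0 → 0# ^ m ≈ 0#
    0^n≈0 zero    m≢0 = contradiction refl m≢0
    0^n≈0 (suc m) m≢0 = 0^[1+n]≈0 m

module PolynomialRoots (R : CommutativeRing 0ℓ 0ℓ)
  (domain : ∀ x y → CommutativeRing._≈_ R (CommutativeRing._*_ R x y) (CommutativeRing.0# R) →
            CommutativeRing._≈_ R x (CommutativeRing.0# R) ⊎ CommutativeRing._≈_ R y (CommutativeRing.0# R)) where
  open CommutativeRing R renaming (refl to ≈-refl; zero to *-zero)
  open Exp commutativeSemiring
  open RingProperties ring
  open SemiringSums semiring using (sum; sum-cong-≋; *-distribˡ-sum)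
  open SetoidReasoning setoid
  open Solver commutativeSemiring using (solve; _:+_; _:*_; _:=_; con)

  eval : ∀ d → (Fin d → Carrier) → Carrier → Carrier
  eval zero    c y = 0#
  eval (suc d) c y = c zero + y * eval d (c ∘ suc) y

  -- The coefficients of (p(y) − p(r)) / (y − r).
  quotient : ∀ d → (Fin (suc d) → Carrier) → Carrier → Fin d → Carrier
  quotient (suc d) c r zero    = eval (suc d) (c ∘ suc) r
  quotient (suc d) c r (suc i) = quotient d (c ∘ suc) r i

  -- This is p(y) - p(r) = (y - r) · quotient(y), rearranged without subtraction so that the
  -- semiring solver applies.
  eval-quotient : ∀ d c r y →
    eval (suc d) c y + r * eval d (quotient d c r) y ≈ eval (suc d) c r + y * eval d (quotient d c r) y
  eval-quotient zero c r y =
    solve 3 (λ c r y → (c :+ y :* con 0) :+ r :* con 0 := (c :+ r :* con 0) :+ y :* con 0) ≈-refl (c zero) r y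
  eval-quotient (suc d) c r y = begin
    (c zero + y * Ey) + r * (Er + y * q)  ≈⟨ solve 6 (λ c y a r b q → (c :+ y :* a) :+ r :* (b :+ y :* q)
                                                   := (c :+ r :* b) :+ y :* (a :+ r :* q)) ≈-refl (c zero) y Ey r Er q ⟩
    (c zero + r * Er) + y * (Ey + r * q)  ≈⟨ +-congˡ (*-congˡ (eval-quotient d (c ∘ suc) r y)) ⟩
    (c zero + r * Er) + y * (Er + y * q)  ∎
    where
    Ey = eval (suc d) (c ∘ suc) y
    Er = eval (suc d) (c ∘ suc) r
    q  = eval d (quotient d (c ∘ suc) r) y

  eval-sum : ∀ d c y → eval d c y ≈ sum (λ i → c i * y ^ toℕ i)
  eval-sum zero    c y = ≈-refl
  eval-sum (suc d) c y = +-cong (sym (*-identityʳ (c zero))) (begin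
    y * eval d (c ∘ suc) y                         ≈⟨ *-congˡ (eval-sum d (c ∘ suc) y) ⟩
    y * sum (λ i → c (suc i) * y ^ toℕ i)          ≈⟨ *-distribˡ-sum y (λ i → c (suc i) * y ^ toℕ i) ⟩
    sum (λ i → y * (c (suc i) * y ^ toℕ i))        ≈⟨ sum-cong-≋ {d} (λ i →
      solve 3 (λ y c z → y :* (c :* z) := c :* (y :* z)) ≈-refl y (c (suc i)) (y ^ toℕ i)) ⟩
    sum (λ i → c (suc i) * (y * y ^ toℕ i))        ∎)

  eval-0 : ∀ d {c} y → (∀ i → c i ≈ 0#) → eval d c y ≈ 0#
  eval-0 zero    y c≈0 = ≈-refl
  eval-0 (suc d) y c≈0 = trans (+-cong (c≈0 zero) (trans (*-congˡ (eval-0 d y (c≈0 ∘ suc))) (zeroʳ y))) (+-identityˡ 0#)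

  -- The first coefficient of the quotient is the value at `r` of the tail of `c`, and the others
  -- form the quotient of that tail. So the hypotheses pass to the tail, and once it vanishes,
  -- `c zero` is the value at `r`.
  quotient≈0⇒≈0 : ∀ d c r → (∀ i → quotient d c r i ≈ 0#) → eval (suc d) c r ≈ 0# → ∀ i → c i ≈ 0#
  quotient≈0⇒≈0 d c r q≈0 e≈0 = go d c q≈0 e≈0
    where
    constant : ∀ d c → (∀ i → c (suc i) ≈ 0#) → eval (suc d) c r ≈ 0# → c zero ≈ 0#
    constant d c c≈0 e≈0 = trans (sym (trans (+-congˡ (trans (*-congˡ (eval-0 d r c≈0)) (zeroʳ r))) (+-identityʳ _))) e≈0
    go : ∀ d c → (∀ i → quotient d c r i ≈ 0#) → eval (suc d) c r ≈ 0# → ∀ i → c i ≈ 0#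
    go zero    c q≈0 e≈0 zero    = constant zero c (λ ()) e≈0
    go (suc d) c q≈0 e≈0 zero    = constant (suc d) c (go d (c ∘ suc) (q≈0 ∘ suc) (q≈0 zero)) e≈0
    go (suc d) c q≈0 e≈0 (suc i) = go d (c ∘ suc) (q≈0 ∘ suc) (q≈0 zero) i

  -- Dividing by the linear factor of the first root leaves a quotient that vanishes at all the
  -- others, because there are no zero divisors.
  roots⇒≈0 : ∀ d c (r : Fin d → Carrier) → (∀ {i j} → r i ≈ r j → i ≡ j) →
             (∀ i → eval d c (r i) ≈ 0#) → ∀ i → c i ≈ 0#
  roots⇒≈0 (suc d) c r r-inj e≈0 = quotient≈0⇒≈0 d c (r zero) q≈0 (e≈0 zero)
    where
    q : Fin d → Carrier
    q = quotient d c (r zero)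
    same : ∀ i → r zero * eval d q (r (suc i)) ≈ r (suc i) * eval d q (r (suc i))
    same i = begin
      r zero * Q                               ≈⟨ +-identityˡ _ ⟨
      0# + r zero * Q                          ≈⟨ +-congʳ (e≈0 (suc i)) ⟨
      eval (suc d) c (r (suc i)) + r zero * Q  ≈⟨ eval-quotient d c (r zero) (r (suc i)) ⟩
      eval (suc d) c (r zero) + r (suc i) * Q  ≈⟨ +-congʳ (e≈0 zero) ⟩
      0# + r (suc i) * Q                       ≈⟨ +-identityˡ _ ⟩
      r (suc i) * Q                            ∎
      where Q = eval d q (r (suc i))
    vanish : ∀ i → eval d q (r (suc i)) ≈ 0#
    vanish i with domain (r zero - r (suc i)) (eval d q (r (suc i)))
                    (trans ([y-z]x≈yx-zx _ _ _) (trans (+-congʳ (same i)) (-‿inverseʳ _)))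
    ... | inj₁ eq = contradiction (r-inj (x∙y⁻¹≈ε⇒x≈y _ _ eq)) λ ()
    ... | inj₂ eq = eq
    q≈0 : ∀ i → q i ≈ 0#
    q≈0 = roots⇒≈0 d q (r ∘ suc) (Fin.suc-injective ∘ r-inj) vanish

  -- A property of functions, so that sums and shifts of polynomials can be formed without an
  -- arithmetic of coefficient lists.
  PolyBelow : ℕ → (Carrier → Carrier) → Set
  PolyBelow d f = ∃ λ c → ∀ y → f y ≈ eval d c y

  zero-poly : ∀ d → PolyBelow d (λ _ → 0#)
  zero-poly d = (λ _ → 0#) , λ y → sym (eval-0 d y (λ _ → ≈-refl))

  shift-poly : ∀ {d f} a → PolyBelow d f → PolyBelow (suc d) (λ y → a + y * f y)
  shift-poly {d} {f} a (c , eq) = c′ , λ y → +-congˡ (*-congˡ (eq y))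
    where
    c′ : Fin (suc d) → Carrier
    c′ zero    = a
    c′ (suc i) = c i

  cong-poly : ∀ {d f g} → (∀ y → g y ≈ f y) → PolyBelow d f → PolyBelow d g
  cong-poly g≈f (c , eq) = c , λ y → trans (g≈f y) (eq y)

  weaken-poly : ∀ {d e f} → d ℕ.≤ e → PolyBelow d f → PolyBelow e f
  weaken-poly {e = e} z≤n (c , eq) = cong-poly eq (zero-poly e)
  weaken-poly {suc d} (s≤s d≤e) (c , eq) =
    cong-poly eq (shift-poly (c zero) (weaken-poly d≤e (c ∘ suc , λ y → ≈-refl)))

  monomial-below : ∀ a {k d} → k ℕ.< d → PolyBelow d (λ y → a * y ^ k)
  monomial-below a {zero}  {suc d} (s≤s _) =
    cong-poly (λ y → trans (*-identityʳ a) (sym (trans (+-congˡ (zeroʳ y)) (+-identityʳ a)))) (shift-poly a (zero-poly d))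
  monomial-below a {suc k} {suc d} (s≤s k<d) =
    cong-poly (λ y → solve 3 (λ a y p → a :* (y :* p) := con 0 :+ y :* (a :* p)) ≈-refl a y (y ^ k))
              (shift-poly 0# (monomial-below a k<d))

  add-poly : ∀ {d f g} → PolyBelow d f → PolyBelow d g → PolyBelow d (λ y → f y + g y)
  add-poly {d} (a , eqf) (b , eqg) = (λ i → a i + b i) , λ y → trans (+-cong (eqf y) (eqg y)) (sym (eval-+ d a b y))
    where
    eval-+ : ∀ d a b y → eval d (λ i → a i + b i) y ≈ eval d a y + eval d b y
    eval-+ zero    a b y = sym (+-identityˡ 0#)
    eval-+ (suc d) a b y = trans (+-congˡ (*-congˡ (eval-+ d (a ∘ suc) (b ∘ suc) y)))
      (solve 5 (λ a b y p q → (a :+ b) :+ y :* (p :+ q) := (a :+ y :* p) :+ (b :+ y :* q)) ≈-refl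
         (a zero) (b zero) y (eval d (a ∘ suc) y) (eval d (b ∘ suc) y))

  -- The top coefficient is recorded as well: over a finite field a function does not determine its
  -- coefficients, and `roots-bound` derives its contradiction from this one.
  leading-poly : ∀ {d f} a → PolyBelow d f → Σ (PolyBelow (suc d) (λ y → a * y ^ d + f y)) λ p → proj₁ p (Fin.fromℕ d) ≈ a
  leading-poly {zero} a (c , eq) =
    ((λ _ → a) , λ y → solve-constant y (eq y)) , ≈-refl
    where
    solve-constant : ∀ y {z} → z ≈ 0# → a * 1# + z ≈ a + y * 0#
    solve-constant y z≈0 = trans (+-cong (*-identityʳ a) z≈0) (+-congˡ (sym (zeroʳ y)))
  leading-poly {suc d} {f} a (c , eq) with leading-poly a (c ∘ suc , λ y → ≈-refl)
  ... | p , top = cong-poly (λ y → trans (+-congˡ (eq y))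
          (solve 5 (λ a y t c e → a :* (y :* t) :+ (c :+ y :* e) := c :+ y :* (a :* t :+ e)) ≈-refl a y (y ^ d) (c zero) _))
          (shift-poly (c zero) p) , top

  roots-bound : ∀ {d f a m} → PolyBelow d f → ¬ (a ≈ 0#) →
                (r : Fin m → Carrier) → (∀ {i j} → r i ≈ r j → i ≡ j) →
                (∀ i → a * r i ^ d + f (r i) ≈ 0#) → m ℕ.≤ d
  roots-bound {d} {f} {a} {m} below a≉0 r r-inj vanish with m ℕ.≤? d
  ... | yes m≤d = m≤d
  ... | no  m≰d with leading-poly {d} {f} a below
  ...   | (c , eq) , top = contradiction (trans (sym top) (roots⇒≈0 (suc d) c r′
            (λ e → Fin.inject≤-injective d<m d<m _ _ (r-inj e)) (λ i → trans (sym (eq (r′ i))) (vanish _)) (Fin.fromℕ d))) a≉0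
    where
    d<m = ℕ.≰⇒> m≰d
    r′ : Fin (suc d) → Carrier
    r′ i = r (Fin.inject≤ i d<m)

-- Linear algebra over a finite field

module LinearAlgebra {q : ℕ} (F : FiniteField q) where
  open FiniteField F public renaming
    (Carrier to 𝔽; _+F_ to infixl 6 _+_; _*F_ to infixl 7 _*_; -F_ to infix 8 -_)

  fieldRing : CommutativeRing 0ℓ 0ℓ
  fieldRing = record { isCommutativeRing = isCommutativeRing }

  open CommutativeRing fieldRing public using
    ( +-assoc; +-comm; +-identityˡ; +-identityʳ; *-assoc; *-comm; *-identityˡ; *-identityʳ
    ; zeroˡ; zeroʳ; distribˡ; distribʳ; -‿inverseʳ; -‿inverseˡ; ring; semiring; commutativeSemiring
    ; +-commutativeMonoid )
  open RingProperties ring public using (-‿distribˡ-*; -‿distribʳ-*; x∙y⁻¹≈ε⇒x≈y; -‿involutive)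
  open Inverse enumeration using (to; from; strictlyInverseˡ; strictlyInverseʳ)
  open ≡-Reasoning
  private module S = SemiringSums semiring
  open SumSingle +-commutativeMonoid using (sum-single)

  infix 4 _≟_
  _≟_ : (x y : 𝔽) → Dec (x ≡ y)
  x ≟ y with from x Fin.≟ from y
  ... | yes eq = yes (≡.trans (≡.sym (strictlyInverseˡ x)) (≡.trans (cong to eq) (strictlyInverseˡ y)))
  ... | no neq = no (neq ∘ cong from)

  isFiniteField : IsFiniteField fieldRing q
  isFiniteField = record
    { _≈?_ = _≟_ ; 1≉0 = 0≢1 ∘ ≡.sym ; inv = inverse ; element = to ; index = from ; index-cong = cong from
    ; element-index = strictlyInverseˡ ; index-element = strictlyInverseʳ }

  2≤q : 2 ℕ.≤ q
  2≤q = Fin.injective⇒≤ {f = from ∘ bit} bit-injective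
    where
    bit : Fin 2 → 𝔽
    bit zero    = 0#
    bit (suc _) = 1#
    from-injective : ∀ {x y} → from x ≡ from y → x ≡ y
    from-injective {x} {y} eq = ≡.trans (≡.sym (strictlyInverseˡ x)) (≡.trans (cong to eq) (strictlyInverseˡ y))
    bit-injective : ∀ {i j} → from (bit i) ≡ from (bit j) → i ≡ j
    bit-injective {zero}     {zero}     eq = refl
    bit-injective {zero}     {suc zero} eq = contradiction (from-injective eq) 0≢1
    bit-injective {suc zero} {zero}     eq = contradiction (≡.sym (from-injective eq)) 0≢1
    bit-injective {suc zero} {suc zero} eq = refl

  2≤q^[1+d] : ∀ d → 2 ℕ.≤ q ℕ.^ suc d
  2≤q^[1+d] d = ℕ.≤-trans 2≤q (ℕ.m≤m*n q (q ℕ.^ d) {{ℕ.m^n≢0 q d {{ℕ.>-nonZero (ℕ.≤-trans (s≤s z≤n) 2≤q)}}}})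

  infix 4 _≋_
  _≋_ : {I : Set} → (I → 𝔽) → (I → 𝔽) → Set
  _≋_ = _≐_ F

  ≋-sym : ∀ {I : Set} {u v : I → 𝔽} → u ≋ v → v ≋ u
  ≋-sym u≋v i = ≡.sym (u≋v i)

  ≋-trans : ∀ {I : Set} {u v w : I → 𝔽} → u ≋ v → v ≋ w → u ≋ w
  ≋-trans u≋v v≋w i = ≡.trans (u≋v i) (v≋w i)

  ∑ : ∀ d → (Fin d → 𝔽) → 𝔽
  ∑ = ΣF F

  ∑≡sum : ∀ d f → ∑ d f ≡ S.sum f
  ∑≡sum zero    f = refl
  ∑≡sum (suc d) f = cong (f zero +_) (∑≡sum d (f ∘ suc))

  ∑-cong : ∀ d {f g : Fin d → 𝔽} → f ≋ g → ∑ d f ≡ ∑ d g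
  ∑-cong zero    f≋g = refl
  ∑-cong (suc d) f≋g = cong₂ _+_ (f≋g zero) (∑-cong d (f≋g ∘ suc))

  ∑-+ : ∀ d f g → ∑ d (λ i → f i + g i) ≡ ∑ d f + ∑ d g
  ∑-+ d f g = ≡.trans (∑≡sum d _) (≡.trans (S.∑-distrib-+ f g) (≡.sym (cong₂ _+_ (∑≡sum d f) (∑≡sum d g))))

  ∑-*ˡ : ∀ d a f → ∑ d (λ i → a * f i) ≡ a * ∑ d f
  ∑-*ˡ d a f = ≡.trans (∑≡sum d _) (≡.sym (≡.trans (cong (a *_) (∑≡sum d f)) (S.*-distribˡ-sum a f)))

  ∑-*ʳ : ∀ d a f → ∑ d (λ i → f i * a) ≡ ∑ d f * a
  ∑-*ʳ d a f = ≡.trans (∑≡sum d _) (≡.sym (≡.trans (cong (_* a) (∑≡sum d f)) (S.*-distribʳ-sum a f)))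

  ∑-swap : ∀ d e (f : Fin d → Fin e → 𝔽) → ∑ d (λ i → ∑ e (f i)) ≡ ∑ e (λ j → ∑ d (λ i → f i j))
  ∑-swap d e f = begin
    ∑ d (λ i → ∑ e (f i))                ≡⟨ ∑-cong d (λ i → ∑≡sum e (f i)) ⟩
    ∑ d (λ i → S.sum (f i))              ≡⟨ ∑≡sum d _ ⟩
    S.sum (λ i → S.sum (f i))            ≡⟨ S.∑-comm f ⟩
    S.sum (λ j → S.sum (λ i → f i j))    ≡⟨ ∑≡sum e _ ⟨
    ∑ e (λ j → S.sum (λ i → f i j))      ≡⟨ ∑-cong e (λ j → ∑≡sum d (λ i → f i j)) ⟨
    ∑ e (λ j → ∑ d (λ i → f i j))        ∎

  ∑-single : ∀ {d} (f : Fin d → 𝔽) i → (∀ j → j ≢ i → f j ≡ 0#) → ∑ d f ≡ f i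
  ∑-single {d} f i f≡0 = ≡.trans (∑≡sum d f) (sum-single f i f≡0)

  ∑-0 : ∀ d {f} → f ≋ 𝟘 F → ∑ d f ≡ 0#
  ∑-0 zero    f≋0 = refl
  ∑-0 (suc d) f≋0 = ≡.trans (cong₂ _+_ (f≋0 zero) (∑-0 d (f≋0 ∘ suc))) (+-identityˡ 0#)

  lc : {I : Set} {d : ℕ} → (Fin d → 𝔽) → (Fin d → I → 𝔽) → I → 𝔽
  lc = lincomb F

  module _ {I : Set} where

    lc-congˡ : ∀ {d} (b : Fin d → I → 𝔽) {c c′ : Fin d → 𝔽} → c ≋ c′ → lc c b ≋ lc c′ b
    lc-congˡ b c≋c′ i = ∑-cong _ (λ j → cong (_* b j i) (c≋c′ j))

    lc-congʳ : ∀ {d} (c : Fin d → 𝔽) {b b′ : Fin d → I → 𝔽} → (∀ j → b j ≋ b′ j) → lc c b ≋ lc c b′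
    lc-congʳ c b≋b′ i = ∑-cong _ (λ j → cong (c j *_) (b≋b′ j i))

    lc-⊕ : ∀ {d} (c c′ : Fin d → 𝔽) (b : Fin d → I → 𝔽) → lc (_⊕_ F c c′) b ≋ _⊕_ F (lc c b) (lc c′ b)
    lc-⊕ c c′ b i = ≡.trans (∑-cong _ (λ j → distribʳ (b j i) (c j) (c′ j))) (∑-+ _ (λ j → c j * b j i) (λ j → c′ j * b j i))

    lc-⊙ : ∀ {d} a (c : Fin d → 𝔽) (b : Fin d → I → 𝔽) → lc (_⊙_ F a c) b ≋ _⊙_ F a (lc c b)
    lc-⊙ a c b i = ≡.trans (∑-cong _ (λ j → *-assoc a (c j) (b j i))) (∑-*ˡ _ a (λ j → c j * b j i))

    lc-𝟘 : ∀ {d} (b : Fin d → I → 𝔽) {c : Fin d → 𝔽} → c ≋ 𝟘 F → lc c b ≋ 𝟘 F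
    lc-𝟘 b c≋0 i = ∑-0 _ (λ j → ≡.trans (cong (_* b j i) (c≋0 j)) (zeroˡ (b j i)))

    lc-𝟘ʳ : ∀ {d} (c : Fin d → 𝔽) {b : Fin d → I → 𝔽} → (∀ j → b j ≋ 𝟘 F) → lc c b ≋ 𝟘 F
    lc-𝟘ʳ c b≋0 i = ∑-0 _ (λ j → ≡.trans (cong (c j *_) (b≋0 j i)) (zeroʳ (c j)))

    lc-lc : ∀ {d e} (c : Fin d → 𝔽) (M : Fin d → Fin e → 𝔽) (b : Fin e → I → 𝔽) →
            lc c (λ j → lc (M j) b) ≋ lc (lc c M) b
    lc-lc {d} {e} c M b i = begin
      ∑ d (λ j → c j * ∑ e (λ l → M j l * b l i))    ≡⟨ ∑-cong d (λ j → ∑-*ˡ e (c j) _) ⟨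
      ∑ d (λ j → ∑ e (λ l → c j * (M j l * b l i)))  ≡⟨ ∑-swap d e _ ⟩
      ∑ e (λ l → ∑ d (λ j → c j * (M j l * b l i)))  ≡⟨ ∑-cong e (λ l → ∑-cong d (λ j → *-assoc (c j) (M j l) (b l i))) ⟨
      ∑ e (λ l → ∑ d (λ j → c j * M j l * b l i))    ≡⟨ ∑-cong e (λ l → ∑-*ʳ d (b l i) _) ⟩
      ∑ e (λ l → ∑ d (λ j → c j * M j l) * b l i)    ∎

  -- The Kronecker symbol: `δ i` is a unit vector and `δ` the standard basis. The distance parameter
  -- δ of the theorem is called `d` in the modules on codes.
  δ : ∀ {d} → Fin d → Fin d → 𝔽
  δ i j with i Fin.≟ j
  ... | yes _ = 1#
  ... | no  _ = 0#

  δ-diag : ∀ {d} (i : Fin d) → δ i i ≡ 1#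
  δ-diag i with i Fin.≟ i
  ... | yes _   = refl
  ... | no  i≢i = contradiction refl i≢i

  δ-off : ∀ {d} {i j : Fin d} → i ≢ j → δ i j ≡ 0#
  δ-off {i = i} {j} i≢j with i Fin.≟ j
  ... | yes i≡j = contradiction i≡j i≢j
  ... | no  _   = refl

  ∑-δˡ : ∀ {d} (i : Fin d) (f : Fin d → 𝔽) → ∑ d (λ j → δ i j * f j) ≡ f i
  ∑-δˡ i f = ≡.trans
    (∑-single _ i (λ j j≢i → ≡.trans (cong (_* f j) (δ-off (j≢i ∘ ≡.sym))) (zeroˡ (f j))))
    (≡.trans (cong (_* f i) (δ-diag i)) (*-identityˡ (f i)))

  lc-δˡ : ∀ {d} {I : Set} (i : Fin d) (b : Fin d → I → 𝔽) → lc (δ i) b ≋ b i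
  lc-δˡ i b x = ∑-δˡ i (λ j → b j x)

  lc-δʳ : ∀ {d} (c : Fin d → 𝔽) → lc c δ ≋ c
  lc-δʳ c i = ≡.trans
    (∑-single _ i (λ j j≢i → ≡.trans (cong (c j *_) (δ-off j≢i)) (zeroʳ (c j))))
    (≡.trans (cong (c i *_) (δ-diag i)) (*-identityʳ (c i)))

  -- Vectors are functions compared pointwise, hence compatibility with `≋` is part of linearity.
  record IsLinear {I J : Set} (T : (I → 𝔽) → (J → 𝔽)) : Set where
    field
      T-cong : ∀ {u v} → u ≋ v → T u ≋ T v
      T-⊕    : ∀ u v → T (_⊕_ F u v) ≋ _⊕_ F (T u) (T v)
      T-⊙    : ∀ a u → T (_⊙_ F a u) ≋ _⊙_ F a (T u)

    T-𝟘 : ∀ {u} → u ≋ 𝟘 F → T u ≋ 𝟘 F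
    T-𝟘 {u} u≋0 j = ≡.trans (T-cong (λ i → ≡.trans (u≋0 i) (≡.sym (zeroˡ 0#))) j)
                            (≡.trans (T-⊙ 0# (𝟘 F) j) (zeroˡ _))

    T-lc : ∀ {d} (c : Fin d → 𝔽) b → T (lc c b) ≋ lc c (T ∘ b)
    T-lc {zero}  c b j = T-𝟘 (λ i → refl) j
    T-lc {suc d} c b j = ≡.trans (T-⊕ _ _ j) (cong₂ _+_ (T-⊙ (c zero) (b zero) j) (T-lc (c ∘ suc) (b ∘ suc) j))

    T-⊖ : ∀ u v → T (_⊖_ F u v) ≋ _⊖_ F (T u) (T v)
    T-⊖ u v j = begin
      T (_⊖_ F u v) j                  ≡⟨ T-cong (λ i → cong (u i +_) (≡.sym (-1* (v i)))) j ⟩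
      T (λ i → u i + (- 1#) * v i) j   ≡⟨ T-⊕ u _ j ⟩
      T u j + T (_⊙_ F (- 1#) v) j     ≡⟨ cong (T u j +_) (≡.trans (T-⊙ (- 1#) v j) (-1* (T v j))) ⟩
      T u j + - T v j                  ∎
      where
      -1* : ∀ x → (- 1#) * x ≡ - x
      -1* x = ≡.trans (≡.sym (-‿distribˡ-* 1# x)) (cong -_ (*-identityˡ x))

  open IsLinear public

  lc-linear : ∀ {d} {I : Set} (b : Fin d → I → 𝔽) → IsLinear (λ c → lc c b)
  lc-linear b = record { T-cong = lc-congˡ b ; T-⊕ = λ c c′ → lc-⊕ c c′ b ; T-⊙ = λ a c → lc-⊙ a c b }

  ∘-linear : ∀ {I J L : Set} {S : (I → 𝔽) → (J → 𝔽)} {T : (J → 𝔽) → (L → 𝔽)} → IsLinear T → IsLinear S → IsLinear (T ∘ S)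
  ∘-linear T-lin S-lin = record
    { T-cong = λ u≋v → T-cong T-lin (T-cong S-lin u≋v)
    ; T-⊕ = λ u v → ≋-trans (T-cong T-lin (T-⊕ S-lin u v)) (T-⊕ T-lin _ _)
    ; T-⊙ = λ a u → ≋-trans (T-cong T-lin (T-⊙ S-lin a u)) (T-⊙ T-lin a _) }

  reindex-linear : ∀ {I J L : Set} {T : (I → 𝔽) → (J → 𝔽)} (f : L → J) → IsLinear T → IsLinear (λ u → T u ∘ f)
  reindex-linear f lin = record
    { T-cong = λ u≋v l → T-cong lin u≋v (f l) ; T-⊕ = λ u v l → T-⊕ lin u v (f l) ; T-⊙ = λ a u l → T-⊙ lin a u (f l) }

  linear-on-δ : ∀ {d} {J : Set} {T : (Fin d → 𝔽) → (J → 𝔽)} → IsLinear T → ∀ c → T c ≋ lc c (T ∘ δ)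
  linear-on-δ lin c j = ≡.trans (T-cong lin (λ i → ≡.sym (lc-δʳ c i)) j) (T-lc lin c δ j)

  ⊖≋𝟘⇒≋ : ∀ {I : Set} {u v : I → 𝔽} → _⊖_ F u v ≋ 𝟘 F → u ≋ v
  ⊖≋𝟘⇒≋ {u = u} {v} eq i = x∙y⁻¹≈ε⇒x≈y (u i) (v i) (eq i)

  ≋⇒⊖≋𝟘 : ∀ {I : Set} {u v : I → 𝔽} → u ≋ v → _⊖_ F u v ≋ 𝟘 F
  ≋⇒⊖≋𝟘 {v = v} eq i = ≡.trans (cong (_+ - v i) (eq i)) (-‿inverseʳ (v i))

  linear-injective : ∀ {I J : Set} {T : (I → 𝔽) → (J → 𝔽)} → IsLinear T →
                     (∀ u → T u ≋ 𝟘 F → u ≋ 𝟘 F) → ∀ {u v} → T u ≋ T v → u ≋ v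
  linear-injective lin ker {u} {v} eq =
    ⊖≋𝟘⇒≋ (ker _ (λ j → ≡.trans (T-⊖ lin u v j) (≋⇒⊖≋𝟘 eq j)))

  indep-injective : ∀ {I : Set} {d} {b : Fin d → I → 𝔽} → LinIndep F b → ∀ {c c′} → lc c b ≋ lc c′ b → c ≋ c′
  indep-injective {b = b} ind = linear-injective (lc-linear b) ind

  vec : ∀ {d} → Fin (q ℕ.^ d) → Fin d → 𝔽
  vec t i = to (Fin.finToFun t i)

  vecIndex : ∀ {d} → (Fin d → 𝔽) → Fin (q ℕ.^ d)
  vecIndex v = Fin.funToFin (from ∘ v)

  vec-vecIndex : ∀ {d} (v : Fin d → 𝔽) → vec (vecIndex v) ≋ v
  vec-vecIndex v i = ≡.trans (cong to (Fin.finToFun-funToFin (from ∘ v) i)) (strictlyInverseˡ (v i))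

  vecIndex-cong : ∀ {d} {u v : Fin d → 𝔽} → u ≋ v → vecIndex u ≡ vecIndex v
  vecIndex-cong {zero}  u≋v = refl
  vecIndex-cong {suc d} u≋v = cong₂ Fin.combine (cong from (u≋v zero)) (vecIndex-cong (u≋v ∘ suc))

  vecIndex-vec : ∀ {d} (t : Fin (q ℕ.^ d)) → vecIndex (vec {d} t) ≡ t
  vecIndex-vec {d} t = ≡.trans (funToFin-cong {d} {q} {from ∘ vec {d} t} {Fin.finToFun {q} {d} t} (λ i → strictlyInverseʳ (Fin.finToFun {q} {d} t i))) (Fin.funToFin-finToFin {d} t)
    where
    funToFin-cong : ∀ {m n} {f g : Fin m → Fin n} → (∀ i → f i ≡ g i) → Fin.funToFin f ≡ Fin.funToFin g
    funToFin-cong {zero}  f≡g = refl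
    funToFin-cong {suc m} f≡g = cong₂ Fin.combine (f≡g zero) (funToFin-cong (f≡g ∘ suc))

  vec-injective : ∀ {d} {s t : Fin (q ℕ.^ d)} → vec {d} s ≋ vec {d} t → s ≡ t
  vec-injective {d} {s} {t} eq =
    ≡.trans (≡.sym (vecIndex-vec {d} s)) (≡.trans (vecIndex-cong eq) (vecIndex-vec {d} t))

  vecIndex-injective : ∀ {d} {u v : Fin d → 𝔽} → vecIndex u ≡ vecIndex v → u ≋ v
  vecIndex-injective {d} {u} {v} eq i =
    ≡.trans (≡.sym (vec-vecIndex u i)) (≡.trans (cong (λ t → vec {d} t i) eq) (vec-vecIndex v i))

  q^-cancel-≤ : ∀ {a b} → q ℕ.^ a ℕ.≤ q ℕ.^ b → a ℕ.≤ b
  q^-cancel-≤ {a} {b} le with a ℕ.≤? b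
  ... | yes a≤b = a≤b
  ... | no  a≰b = contradiction le (ℕ.<⇒≱ (ℕ.^-monoʳ-< q 2≤q (ℕ.≰⇒> a≰b)))

  -- By the pigeonhole principle q^a ≤ q^b. This counting argument takes the place of an exchange
  -- argument in `steinitz`.
  injection-≤ : ∀ {a b} (f : (Fin a → 𝔽) → (Fin b → 𝔽)) → (∀ {u v} → f u ≋ f v → u ≋ v) → a ℕ.≤ b
  injection-≤ {a} f inj = q^-cancel-≤ (Fin.injective⇒≤ {f = vecIndex ∘ f ∘ vec {a}}
    (λ eq → vec-injective {a} (inj (vecIndex-injective eq))))

  steinitz : ∀ {I : Set} {a d} {b : Fin a → I → 𝔽} {c : Fin d → I → 𝔽} →
             LinIndep F b → (∀ j → InSpan F c (b j)) → a ℕ.≤ d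
  steinitz {b = b} {c} ind b∈c = injection-≤ (λ u → lc u M)
    (λ {u} {v} eq → indep-injective ind (λ i → ≡.trans (expand u i) (≡.trans (lc-congˡ c eq i) (≡.sym (expand v i)))))
    where
    M = λ j → proj₁ (b∈c j)
    expand : ∀ u → lc u b ≋ lc (lc u M) c
    expand u i = ≡.trans (lc-congʳ u (λ j → proj₂ (b∈c j)) i) (lc-lc u M c i)

  δ-indep : ∀ {d} → LinIndep F (δ {d})
  δ-indep c eq j = ≡.trans (≡.sym (lc-δʳ c j)) (eq j)

  ∈span-δ : ∀ {d} (v : Fin d → 𝔽) → InSpan F δ v
  ∈span-δ v = v , λ i → ≡.sym (lc-δʳ v i)

  indep⇒≤ : ∀ {a d} {b : Fin a → Fin d → 𝔽} → LinIndep F b → a ℕ.≤ d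
  indep⇒≤ {b = b} ind = steinitz ind (∈span-δ ∘ b)

  ≋? : ∀ {d} (u v : Fin d → 𝔽) → Dec (u ≋ v)
  ≋? u v = Fin.all? (λ i → u i ≟ v i)

  search : ∀ {d} {P : (Fin d → 𝔽) → Set} → (∀ {u v} → u ≋ v → P u → P v) → (∀ v → Dec (P v)) → Dec (∃ P)
  search {d} {P} resp P? with Fin.any? {n = q ℕ.^ d} (λ t → P? (vec t))
  ... | yes (t , p) = yes (vec t , p)
  ... | no  ¬p      = no λ (v , p) → ¬p (vecIndex v , resp (λ i → ≡.sym (vec-vecIndex v i)) p)

  InSpan? : ∀ {d n} (b : Fin d → Fin n → 𝔽) v → Dec (InSpan F b v)
  InSpan? b v = search (λ c≋c′ eq i → ≡.trans (eq i) (lc-congˡ b c≋c′ i)) (λ c → ≋? v (lc c b))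

  cons : ∀ {d} {A : Set} → A → (Fin d → A) → Fin (suc d) → A
  cons x f zero    = x
  cons x f (suc i) = f i

  cons-indep : ∀ {I : Set} {d} {b : Fin d → I → 𝔽} {v} → LinIndep F b → ¬ InSpan F b v → LinIndep F (cons v b)
  cons-indep {b = b} {v} ind v∉b c eq with c zero ≟ 0#
  ... | yes c₀≡0 = λ { zero → c₀≡0 ; (suc j) → ind (c ∘ suc) tail≋0 j }
    where
    tail≋0 : lc (c ∘ suc) b ≋ 𝟘 F
    tail≋0 i = ≡.trans (≡.sym (≡.trans (cong (_+ lc (c ∘ suc) b i) (≡.trans (cong (_* v i) c₀≡0) (zeroˡ (v i)))) (+-identityˡ _))) (eq i)
  ... | no c₀≢0 with inverse (c zero) c₀≢0
  ...   | y , cy≡1 = contradiction (_⊙_ F (- y) (c ∘ suc) , v≋) v∉b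
    where
    v≋ : v ≋ lc (_⊙_ F (- y) (c ∘ suc)) b
    v≋ i = begin
      v i                                 ≡⟨ *-identityˡ (v i) ⟨
      1# * v i                            ≡⟨ cong (_* v i) (≡.trans (*-comm y (c zero)) cy≡1) ⟨
      y * c zero * v i                    ≡⟨ *-assoc y (c zero) (v i) ⟩
      y * (c zero * v i)                  ≡⟨ cong (y *_) (neg (eq i)) ⟩
      y * (- lc (c ∘ suc) b i)            ≡⟨ ≡.trans (≡.sym (-‿distribʳ-* y _)) (-‿distribˡ-* y _) ⟩
      (- y) * lc (c ∘ suc) b i            ≡⟨ lc-⊙ (- y) (c ∘ suc) b i ⟨
      lc (_⊙_ F (- y) (c ∘ suc)) b i      ∎
      where
      neg : ∀ {x z} → x + z ≡ 0# → x ≡ - z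
      neg {x} {z} x+z≡0 = x∙y⁻¹≈ε⇒x≈y x (- z) (≡.trans (cong (x +_) (-‿involutive z)) x+z≡0)

  span : ∀ {I : Set} {d} → (Fin d → I → 𝔽) → Subspace F I
  span b = record
    { mem   = InSpan F b
    ; resp  = λ v≋w (c , eq) → c , λ i → ≡.trans (≡.sym (v≋w i)) (eq i)
    ; zero∈ = 𝟘 F , λ i → ≡.sym (lc-𝟘 b (λ _ → refl) i)
    ; +∈    = λ (c , eq) (c′ , eq′) → _⊕_ F c c′ , λ i → ≡.trans (cong₂ _+_ (eq i) (eq′ i)) (≡.sym (lc-⊕ c c′ b i))
    ; ·∈    = λ a (c , eq) → _⊙_ F a c , λ i → ≡.trans (cong (a *_) (eq i)) (≡.sym (lc-⊙ a c b i))
    }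

  lc∈ : ∀ {I : Set} (U : Subspace F I) {d} (c : Fin d → 𝔽) (b : Fin d → I → 𝔽) → (∀ j → mem U (b j)) → mem U (lc c b)
  lc∈ U {zero}  c b b∈U = zero∈ U
  lc∈ U {suc d} c b b∈U = +∈ U (·∈ U (c zero) (b∈U zero)) (lc∈ U (c ∘ suc) (b ∘ suc) (b∈U ∘ suc))

  indep⇒dim : ∀ {I : Set} {d} {b : Fin d → I → 𝔽} → LinIndep F b → HasDim F (InSpan F b) d
  indep⇒dim {b = b} ind = b , ind , λ v → id , id

  HasDim-resp : ∀ {I : Set} {P Q : (I → 𝔽) → Set} {d} → (∀ v → P v → Q v) → (∀ v → Q v → P v) →
                HasDim F P d → HasDim F Q d
  HasDim-resp P⇒Q Q⇒P (b , ind , spans) = b , ind , λ v → proj₁ (spans v) ∘ Q⇒P v , P⇒Q v ∘ proj₂ (spans v)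

  basis∈ : ∀ {I : Set} {P : (I → 𝔽) → Set} {d} (h : HasDim F P d) → ∀ j → P (proj₁ h j)
  basis∈ (b , ind , spans) j = proj₂ (spans (b j)) (δ j , λ i → ≡.sym (lc-δˡ j b i))

  opaque
    -- An independent family is enlarged by any vector of `U` outside its span, found by exhaustive
    -- search. The invariant `fuel + d ≡ n` ends this, as more than `n` vectors are dependent.
    -- Opacity keeps the searched basis from being unfolded.
    dim-exists : ∀ {n} (U : Subspace F (Fin n)) → (∀ v → Dec (mem U v)) → ∃ λ d → HasDim F (mem U) d
    dim-exists {n} U U? = grow n {0} (ℕ.+-identityʳ n) (λ ()) (λ _ _ ()) (λ ())
      where
      grow : ∀ fuel {d} → fuel ℕ.+ d ≡ n → (b : Fin d → Fin n → 𝔽) → LinIndep F b → (∀ j → mem U (b j)) →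
             ∃ λ d → HasDim F (mem U) d
      grow fuel {d} eq b ind b∈U with search {P = λ v → mem U v × ¬ InSpan F b v}
           (λ u≋v (u∈U , u∉b) → resp U u≋v u∈U , u∉b ∘ resp (span b) (λ i → ≡.sym (u≋v i)))
           (λ v → U? v ×-dec ¬? (InSpan? b v))
      ... | no none = d , b , ind , λ v → in-span v , λ (c , eq) → resp U (λ i → ≡.sym (eq i)) (lc∈ U c b b∈U)
        where
        in-span : ∀ v → mem U v → InSpan F b v
        in-span v v∈U with InSpan? b v
        ... | yes v∈b = v∈b
        ... | no  v∉b = contradiction (v , v∈U , v∉b) none
      grow zero refl b ind b∈U | yes (v , v∈U , v∉b) =
        contradiction (indep⇒≤ {b = cons v b} (cons-indep {b = b} {v} ind v∉b)) (ℕ.<⇒≱ (ℕ.n<1+n n))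
      grow (suc fuel) {d} eq b ind b∈U | yes (v , v∈U , v∉b) =
        grow fuel (≡.trans (ℕ.+-suc fuel d) eq) (cons v b) (cons-indep ind v∉b) λ { zero → v∈U ; (suc j) → b∈U j }

  rank-exists : ∀ {d n} (b : Fin d → Fin n → 𝔽) → ∃ λ r → HasDim F (InSpan F b) r
  rank-exists b = dim-exists (span b) (InSpan? b)

  kernel : ∀ {I J : Set} {T : (I → 𝔽) → (J → 𝔽)} → IsLinear T → Subspace F I
  kernel {T = T} lin = record
    { mem   = λ u → T u ≋ 𝟘 F
    ; resp  = λ v≋w eq j → ≡.trans (≡.sym (T-cong lin v≋w j)) (eq j)
    ; zero∈ = T-𝟘 lin (λ _ → refl)
    ; +∈    = λ eq eq′ j → ≡.trans (T-⊕ lin _ _ j) (≡.trans (cong₂ _+_ (eq j) (eq′ j)) (+-identityˡ 0#))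
    ; ·∈    = λ a eq j → ≡.trans (T-⊙ lin a _ j) (≡.trans (cong (a *_) (eq j)) (zeroʳ a))
    }

  append : ∀ {a d} {A : Set} → (Fin a → A) → (Fin d → A) → Fin (a ℕ.+ d) → A
  append {a} f g i = [ f , g ]′ (Fin.splitAt a i)

  lc-append : ∀ {I : Set} {a d} (c : Fin (a ℕ.+ d) → 𝔽) (b : Fin a → I → 𝔽) (b′ : Fin d → I → 𝔽) →
              lc c (append b b′) ≋ _⊕_ F (lc (λ i → c (i Fin.↑ˡ d)) b) (lc (λ i → c (a Fin.↑ʳ i)) b′)
  lc-append {a = zero}  c b b′ i = ≡.sym (+-identityˡ _)
  lc-append {a = suc a} c b b′ i = ≡.trans
    (cong (c zero * b zero i +_) (≡.trans (lc-congʳ (c ∘ suc) {append b b′ ∘ suc} {append (b ∘ suc) b′} same i) (lc-append (c ∘ suc) (b ∘ suc) b′ i)))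
    (≡.sym (+-assoc _ _ _))
    where
    same : ∀ j → append b b′ (suc j) ≋ append (b ∘ suc) b′ j
    same j x with Fin.splitAt a j
    ... | inj₁ _ = refl
    ... | inj₂ _ = refl

  -- Preimages `y` of a basis of the row space are independent of the kernel vectors `z`: applying
  -- `b` to a relation kills the part from `z` and leaves a relation of the basis.
  rank+nullity-≤ : ∀ {I : Set} {k c r} (b : Fin k → I → 𝔽) {z : Fin c → Fin k → 𝔽} → LinIndep F z →
                   (∀ j → lc (z j) b ≋ 𝟘 F) → HasDim F (InSpan F b) r → c ℕ.+ r ℕ.≤ k
  rank+nullity-≤ {k = k} {c} {r} b {z} z-ind z∈ker h@(w , w-ind , spans) = indep⇒≤ {b = append z y} ind
    where
    y : Fin r → Fin k → 𝔽
    y j = proj₁ (basis∈ {P = InSpan F b} h j)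
    ind : LinIndep F (append z y)
    ind u eq j = ≡.trans (cong u (≡.sym (Fin.join-splitAt c r j))) (both (Fin.splitAt c j))
      where
      uˡ = λ i → u (i Fin.↑ˡ r)
      uʳ = λ i → u (c Fin.↑ʳ i)
      image : lc uʳ w ≋ 𝟘 F
      image i = begin
        lc uʳ w i                                            ≡⟨ lc-congʳ uʳ {w} {λ j → lc (y j) b} (λ j → proj₂ (basis∈ {P = InSpan F b} h j)) i ⟩
        lc uʳ (λ j → lc (y j) b) i                           ≡⟨ +-identityˡ _ ⟨
        0# + lc uʳ (λ j → lc (y j) b) i                      ≡⟨ cong (_+ lc uʳ (λ j → lc (y j) b) i) (lc-𝟘ʳ uˡ z∈ker i) ⟨
        lc uˡ (λ j → lc (z j) b) i + lc uʳ (λ j → lc (y j) b) i ≡⟨ cong₂ _+_ (lc-lc uˡ z b i) (lc-lc uʳ y b i) ⟩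
        lc (lc uˡ z) b i + lc (lc uʳ y) b i                  ≡⟨ lc-⊕ (lc uˡ z) (lc uʳ y) b i ⟨
        lc (_⊕_ F (lc uˡ z) (lc uʳ y)) b i                   ≡⟨ lc-congˡ b (lc-append u z y) i ⟨
        lc (lc u (append z y)) b i                           ≡⟨ lc-𝟘 b eq i ⟩
        0#                                                   ∎
      uʳ≋0 : uʳ ≋ 𝟘 F
      uʳ≋0 = w-ind uʳ image
      uˡ≋0 : uˡ ≋ 𝟘 F
      uˡ≋0 = z-ind uˡ (λ i → ≡.trans (≡.sym (≡.trans (cong (lc uˡ z i +_) (lc-𝟘 y uʳ≋0 i)) (+-identityʳ _)))
                                     (≡.trans (≡.sym (lc-append u z y i)) (eq i)))
      both : ∀ s → u (Fin.join c r s) ≡ 0#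
      both (inj₁ i) = uˡ≋0 i
      both (inj₂ i) = uʳ≋0 i

  -- Subtracting from `v` the combination of preimages `y` with the same image leaves a kernel
  -- vector, so `z` and `y` together span.
  rank+nullity-≥ : ∀ {I : Set} {k c r} (b : Fin k → I → 𝔽) → HasDim F (λ y → lc y b ≋ 𝟘 F) c →
                   HasDim F (InSpan F b) r → k ℕ.≤ c ℕ.+ r
  rank+nullity-≥ {k = k} {c} {r} b (z , _ , z-spans) h@(w , _ , w-spans) =
    steinitz {b = δ} {append z y} δ-indep (λ j → decompose (δ j))
    where
    y : Fin r → Fin k → 𝔽
    y j = proj₁ (basis∈ {P = InSpan F b} h j)
    decompose : ∀ v → InSpan F (append z y) v
    decompose v = append β α , λ i → begin
      v i                                        ≡⟨ cancel (v i) (lc α y i) ⟨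
      (v i + - lc α y i) + lc α y i              ≡⟨ cong (_+ lc α y i) (β-eq i) ⟩
      lc β z i + lc α y i                        ≡⟨ cong₂ _+_ (lc-congˡ z (λ j → cong [ β , α ]′ (≡.sym (Fin.splitAt-↑ˡ c j r))) i)
                                                              (lc-congˡ y (λ j → cong [ β , α ]′ (≡.sym (Fin.splitAt-↑ʳ c r j))) i) ⟩
      lc (λ j → append β α (j Fin.↑ˡ r)) z i + lc (λ j → append β α (c Fin.↑ʳ j)) y i ≡⟨ lc-append (append β α) z y i ⟨
      lc (append β α) (append z y) i             ∎
      where
      cancel : ∀ x y → (x + - y) + y ≡ x
      cancel x y = ≡.trans (+-assoc x (- y) y) (≡.trans (cong (x +_) (-‿inverseˡ y)) (+-identityʳ x))
      v∈ = proj₁ (w-spans (lc v b)) (v , λ _ → refl)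
      α = proj₁ v∈
      residue : lc (_⊖_ F v (lc α y)) b ≋ 𝟘 F
      residue i = ≡.trans (T-⊖ (lc-linear b) v (lc α y) i) (≋⇒⊖≋𝟘 {u = lc v b} {lc (lc α y) b} (λ i → begin
        lc v b i                   ≡⟨ proj₂ v∈ i ⟩
        lc α w i                   ≡⟨ lc-congʳ α {w} {λ j → lc (y j) b} (λ j → proj₂ (basis∈ {P = InSpan F b} h j)) i ⟩
        lc α (λ j → lc (y j) b) i  ≡⟨ lc-lc α y b i ⟩
        lc (lc α y) b i            ∎) i)
      residue∈ = proj₁ (z-spans (_⊖_ F v (lc α y))) residue
      β = proj₁ residue∈
      β-eq = proj₂ residue∈

-- Frobenius maps

module Freshman (R : CommutativeRing 0ℓ 0ℓ) where
  open CommutativeRing R renaming (refl to ≈-refl; zero to *-zero)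
  open Exp commutativeSemiring
  open Mult semiring renaming (_×_ to _·_)
  open Sums +-commutativeMonoid
  open SetoidReasoning setoid

  -- The terms strictly between the two ends of the binomial expansion with exponent `suc p`,
  -- indexed through `inject₁` because `sum-init-last` presents them in this way.
  middle : ℕ → Carrier → Carrier → Carrier
  middle p x y = sum {p} (λ j → (suc p C suc (toℕ (Fin.inject₁ j))) · (x ^ suc (toℕ (Fin.inject₁ j)) * y ^ (p ℕ.∸ toℕ (Fin.inject₁ j))))

  binomial-ends : ∀ p x y → (x + y) ^ suc p ≈ y ^ suc p + (middle p x y + x ^ suc p)
  binomial-ends p x y = begin
    (x + y) ^ suc p                     ≈⟨ Binomial.theorem commutativeSemiring (suc p) x y ⟩
    term zero + sum (term ∘ suc)        ≈⟨ +-congˡ (sum-init-last (term ∘ suc)) ⟩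
    term zero + (middle p x y + term (suc (Fin.fromℕ p))) ≈⟨ +-cong first (+-congˡ last) ⟩
    y ^ suc p + (middle p x y + x ^ suc p) ∎
    where
    term = Binomial.binomialTerm commutativeSemiring x y (suc p)
    first : term zero ≈ y ^ suc p
    first = trans (×-homo-1 _) (*-identityˡ _)
    top : ∀ k → k ≡ p → (suc p C suc k) · (x ^ suc k * y ^ (p ℕ.∸ k)) ≈ x ^ suc p
    top k refl = begin
      (suc k C suc k) · (x ^ suc k * y ^ (k ℕ.∸ k))  ≡⟨ cong₂ (λ a b → a · (x ^ suc k * y ^ b)) (nCn≡1 (suc k)) (ℕ.n∸n≡0 k) ⟩
      1 · (x ^ suc k * 1#)                           ≈⟨ ×-homo-1 _ ⟩
      x ^ suc k * 1#                                 ≈⟨ *-identityʳ _ ⟩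
      x ^ suc k                                      ∎
    last : term (suc (Fin.fromℕ p)) ≈ x ^ suc p
    last = top (toℕ (Fin.fromℕ p)) (Fin.toℕ-fromℕ p)

  freshman : ∀ p → (∀ i → i ℕ.< p → (suc p C suc i) · 1# ≈ 0#) → ∀ x y → (x + y) ^ suc p ≈ x ^ suc p + y ^ suc p
  freshman p C≈0 x y = begin
    (x + y) ^ suc p                          ≈⟨ binomial-ends p x y ⟩
    y ^ suc p + (middle p x y + x ^ suc p)   ≈⟨ +-congˡ (+-congʳ (trans (sum-cong-≋ (λ j → vanish _ (subst (ℕ._< p) (≡.sym (Fin.toℕ-inject₁ j)) (Fin.toℕ<n j)) _)) (sum-replicate-zero p))) ⟩
    y ^ suc p + (0# + x ^ suc p)             ≈⟨ +-congˡ (+-identityˡ _) ⟩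
    y ^ suc p + x ^ suc p                    ≈⟨ +-comm _ _ ⟩
    x ^ suc p + y ^ suc p                    ∎
    where
    vanish : ∀ i → i ℕ.< p → ∀ z → (suc p C suc i) · z ≈ 0#
    vanish i i<p z = begin
      (suc p C suc i) · z         ≈⟨ ×-congʳ (suc p C suc i) (*-identityˡ z) ⟨
      (suc p C suc i) · (1# * z)  ≈⟨ ×-assoc-* (suc p C suc i) 1# z ⟨
      (suc p C suc i) · 1# * z    ≈⟨ *-congʳ (C≈0 i i<p) ⟩
      0# * z                      ≈⟨ zeroˡ z ⟩
      0#                          ∎

  freshman-iterated : ∀ q → (∀ x y → (x + y) ^ q ≈ x ^ q + y ^ q) → ∀ d x y → (x + y) ^ (q ℕ.^ d) ≈ x ^ (q ℕ.^ d) + y ^ (q ℕ.^ d)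
  freshman-iterated q add zero    x y = trans (*-identityʳ _) (sym (+-cong (*-identityʳ x) (*-identityʳ y)))
  freshman-iterated q add (suc d) x y = begin
    (x + y) ^ (q ℕ.* q ℕ.^ d)                       ≈⟨ ^-assocʳ (x + y) q (q ℕ.^ d) ⟨
    ((x + y) ^ q) ^ (q ℕ.^ d)                       ≈⟨ ^-congˡ (q ℕ.^ d) (add x y) ⟩
    (x ^ q + y ^ q) ^ (q ℕ.^ d)                     ≈⟨ freshman-iterated q add d (x ^ q) (y ^ q) ⟩
    (x ^ q) ^ (q ℕ.^ d) + (y ^ q) ^ (q ℕ.^ d)       ≈⟨ +-cong (^-assocʳ x q (q ℕ.^ d)) (^-assocʳ y q (q ℕ.^ d)) ⟩
    x ^ (q ℕ.* q ℕ.^ d) + y ^ (q ℕ.* q ℕ.^ d)       ∎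

-- (X + 1)^q − X^q − 1 has degree below q and vanishes at the q elements of the field.
binomial-vanishes : ∀ {p} (F : FiniteField (suc p)) → let open LinearAlgebra F in
  ∀ i → i ℕ.< p → Mult._×_ semiring (suc p C suc i) 1# ≡ 0#
binomial-vanishes {p} F i i<p = ≡.trans (cong (λ k → (suc p C suc k) · 1#) (≡.sym inject-fromℕ))
                                        (roots⇒≈0 (suc p) coeff element element-injective vanish (suc (fromℕ< i<p)))
  where
  open LinearAlgebra F
  open IsFiniteField isFiniteField using (element; index; index-element)
  open FiniteFieldProperties fieldRing isFiniteField using (domain; fermat)
  open PolynomialRoots fieldRing domain
  open Freshman fieldRing
  open Exp commutativeSemiring
  open Mult semiring using (×-assoc-*) renaming (_×_ to _·_)
  open SemiringSums semiring
  open RingProperties ring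
  open Solver commutativeSemiring using (solve; _:*_; _:=_)
  open ≡-Reasoning
  -- The constant term 0 brings the number of coefficients to `suc p`, exactly the number of
  -- available roots.
  coeff : Fin (suc p) → 𝔽
  coeff zero    = 0#
  coeff (suc j) = (suc p C suc (toℕ (Fin.inject₁ j))) · 1#
  inject-fromℕ : toℕ (Fin.inject₁ (fromℕ< i<p)) ≡ i
  inject-fromℕ = ≡.trans (Fin.toℕ-inject₁ _) (Fin.toℕ-fromℕ< i<p)
  element-injective : ∀ {i j} → element i ≡ element j → i ≡ j
  element-injective {i} {j} eq = ≡.trans (≡.sym (index-element i)) (≡.trans (cong index eq) (index-element j))
  one^ : ∀ n → 1# ^ n ≡ 1#
  one^ zero    = refl
  one^ (suc n) = ≡.trans (*-identityˡ (1# ^ n)) (one^ n)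
  mid : ∀ y → middle p y 1# ≡ 0#
  mid y = +-identityˡ-unique (middle p y 1#) y (+-cancelʳ 1# _ _ (begin
    middle p y 1# + y + 1#                   ≡⟨ +-comm _ 1# ⟩
    1# + (middle p y 1# + y)                 ≡⟨ cong₂ (λ a b → a + (middle p y 1# + b)) (≡.sym (one^ (suc p))) (≡.sym (fermat y)) ⟩
    1# ^ suc p + (middle p y 1# + y ^ suc p) ≡⟨ binomial-ends p y 1# ⟨
    (y + 1#) ^ suc p                         ≡⟨ fermat (y + 1#) ⟩
    y + 1#                                   ∎))
  vanish : ∀ i → eval (suc p) coeff (element i) ≡ 0#
  vanish i = begin
    0# + y * eval p (coeff ∘ suc) y            ≡⟨ +-identityˡ _ ⟩
    y * eval p (coeff ∘ suc) y                 ≡⟨ cong (y *_) (eval-sum p (coeff ∘ suc) y) ⟩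
    y * sum (λ j → coeff (suc j) * y ^ toℕ j)  ≡⟨ *-distribˡ-sum y (λ j → coeff (suc j) * y ^ toℕ j) ⟩
    sum (λ j → y * (coeff (suc j) * y ^ toℕ j)) ≡⟨ sum-cong-≋ term ⟩
    middle p y 1#                              ≡⟨ mid y ⟩
    0#                                         ∎
    where
    y = element i
    term : ∀ j → y * (coeff (suc j) * y ^ toℕ j) ≡ _
    term j = begin
      y * (coeff (suc j) * y ^ toℕ j)     ≡⟨ solve 3 (λ y c z → y :* (c :* z) := c :* (y :* z)) refl y (coeff (suc j)) (y ^ toℕ j) ⟩
      coeff (suc j) * (y * y ^ toℕ j)     ≡⟨ ×-assoc-* (suc p C suc k) 1# _ ⟩
      (suc p C suc k) · (1# * (y * y ^ toℕ j))   ≡⟨ cong ((suc p C suc k) ·_) (begin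
          1# * y ^ suc (toℕ j)             ≡⟨ *-comm 1# _ ⟩
          y ^ suc (toℕ j) * 1#             ≡⟨ cong₂ (λ a b → y ^ suc a * b) (≡.sym (Fin.toℕ-inject₁ j)) (≡.sym (one^ (p ℕ.∸ k))) ⟩
          y ^ suc k * 1# ^ (p ℕ.∸ k)       ∎) ⟩
      (suc p C suc k) · (y ^ suc k * 1# ^ (p ℕ.∸ k)) ∎
      where k = toℕ (Fin.inject₁ j)

-- Group algebras of cyclic groups

-- The inner binomial coefficients vanish in F, hence in every ring where the multiples of 1 that
-- vanish in F vanish too; no prime characteristic has to be named.
freshman-over : ∀ {q} (F : FiniteField q) (R : CommutativeRing 0ℓ 0ℓ) →
  let module F = LinearAlgebra F; open CommutativeRing R; open Exp commutativeSemiring in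
  (∀ n → Mult._×_ F.semiring n F.1# ≡ F.0# → Mult._×_ semiring n 1# ≈ 0#) →
  ∀ x y → (x + y) ^ q ≈ x ^ q + y ^ q
freshman-over {zero}  F R char = contradiction (LinearAlgebra.2≤q F) λ ()
freshman-over {suc p} F R char = Freshman.freshman R p (λ i i<p → char (suc p C suc i) (binomial-vanishes F i i<p))

module AnnihilatorQuotient (R : CommutativeRing 0ℓ 0ℓ) (w : CommutativeRing.Carrier R) where
  open CommutativeRing R renaming (refl to ≈-refl)
  open SetoidReasoning setoid
  open RingProperties ring using (-‿distribʳ-*)

  infix 4 _∼_
  -- Equality in R/Ann(w), on the unchanged carrier. Multiplication by `w` identifies the quotient
  -- with the ideal wR, which later supplies its coordinates.
  _∼_ : Carrier → Carrier → Set
  x ∼ y = w * x ≈ w * y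

  ≈⇒∼ : ∀ {x y} → x ≈ y → x ∼ y
  ≈⇒∼ = *-congˡ

  +-cong-∼ : ∀ {x y u v} → x ∼ y → u ∼ v → x + u ∼ y + v
  +-cong-∼ p r = trans (distribˡ w _ _) (trans (+-cong p r) (sym (distribˡ w _ _)))

  -‿cong-∼ : ∀ {x y} → x ∼ y → - x ∼ - y
  -‿cong-∼ {x} {y} p = trans (sym (-‿distribʳ-* w x)) (trans (-‿cong p) (-‿distribʳ-* w y))

  *-cong-∼ : ∀ {x y u v} → x ∼ y → u ∼ v → x * u ∼ y * v
  *-cong-∼ {x} {y} {u} {v} p r = begin
    w * (x * u)  ≈⟨ *-assoc w x u ⟨
    w * x * u    ≈⟨ *-congʳ p ⟩
    w * y * u    ≈⟨ swap ⟩
    w * u * y    ≈⟨ *-congʳ r ⟩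
    w * v * y    ≈⟨ *-assoc w v y ⟩
    w * (v * y)  ≈⟨ *-congˡ (*-comm v y) ⟩
    w * (y * v)  ∎
    where
    swap : w * y * u ≈ w * u * y
    swap = trans (*-assoc w y u) (trans (*-congˡ (*-comm y u)) (sym (*-assoc w u y)))

  quotientRing : CommutativeRing 0ℓ 0ℓ
  quotientRing = record
    { _≈_ = _∼_ ; _+_ = _+_ ; _*_ = _*_ ; -_ = -_ ; 0# = 0# ; 1# = 1#
    ; isCommutativeRing = record
      { isRing = record
        { +-isAbelianGroup = record
          { isGroup = record
            { isMonoid = record
              { isSemigroup = record
                { isMagma = record
                  { isEquivalence = record { refl = ≈-refl ; sym = sym ; trans = trans }
                  ; ∙-cong = +-cong-∼ }
                ; assoc = λ x y z → ≈⇒∼ (+-assoc x y z) }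
              ; identity = (λ x → ≈⇒∼ (+-identityˡ x)) , (λ x → ≈⇒∼ (+-identityʳ x)) }
            ; inverse = (λ x → ≈⇒∼ (-‿inverseˡ x)) , (λ x → ≈⇒∼ (-‿inverseʳ x))
            ; ⁻¹-cong = -‿cong-∼ }
          ; comm = λ x y → ≈⇒∼ (+-comm x y) }
        ; *-cong = *-cong-∼
        ; *-assoc = λ x y z → ≈⇒∼ (*-assoc x y z)
        ; *-identity = (λ x → ≈⇒∼ (*-identityˡ x)) , (λ x → ≈⇒∼ (*-identityʳ x))
        ; distrib = (λ x y z → ≈⇒∼ (distribˡ x y z)) , (λ x y z → ≈⇒∼ (distribʳ x y z)) }
      ; *-comm = λ x y → ≈⇒∼ (*-comm x y) } }

  ^-same : ∀ x n → Exp._^_ (CommutativeRing.commutativeSemiring quotientRing) x n ≡ Exp._^_ commutativeSemiring x n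
  ^-same x zero    = refl
  ^-same x (suc n) = cong (x *_) (^-same x n)

module CyclicGroupAlgebra {q : ℕ} (F : FiniteField q) (p : ℕ) where
  open LinearAlgebra F

  m : ℕ
  m = suc p

  [_] : ℕ → Fin m
  [ a ] = a mod m

  toℕ-[] : ∀ a → toℕ [ a ] ≡ a % m
  toℕ-[] a = Fin.toℕ-fromℕ< (m%n<n a m)

  []-cong : ∀ {a b} → a % m ≡ b % m → [ a ] ≡ [ b ]
  []-cong {a} {b} eq = Fin.toℕ-injective (≡.trans (toℕ-[] a) (≡.trans eq (≡.sym (toℕ-[] b))))

  [toℕ] : ∀ i → [ toℕ i ] ≡ i
  [toℕ] i = Fin.toℕ-injective (≡.trans (toℕ-[] (toℕ i)) (m<n⇒m%n≡m (Fin.toℕ<n i)))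

  infixl 6 _∙_
  _∙_ : Fin m → Fin m → Fin m
  i ∙ j = [ toℕ i ℕ.+ toℕ j ]

  []-∙ : ∀ a b → [ a ] ∙ [ b ] ≡ [ a ℕ.+ b ]
  []-∙ a b = []-cong {toℕ [ a ] ℕ.+ toℕ [ b ]} {a ℕ.+ b} (≡.trans (cong₂ (λ x y → (x ℕ.+ y) % m) (toℕ-[] a) (toℕ-[] b)) (≡.sym (%-distribˡ-+ a b m)))

  ∙-assoc : ∀ i j k → i ∙ j ∙ k ≡ i ∙ (j ∙ k)
  ∙-assoc i j k = begin
    i ∙ j ∙ k                              ≡⟨ cong (i ∙ j ∙_) ([toℕ] k) ⟨
    [ toℕ i ℕ.+ toℕ j ] ∙ [ toℕ k ]        ≡⟨ []-∙ (toℕ i ℕ.+ toℕ j) (toℕ k) ⟩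
    [ toℕ i ℕ.+ toℕ j ℕ.+ toℕ k ]          ≡⟨ cong [_] (ℕ.+-assoc (toℕ i) (toℕ j) (toℕ k)) ⟩
    [ toℕ i ℕ.+ (toℕ j ℕ.+ toℕ k) ]        ≡⟨ []-∙ (toℕ i) (toℕ j ℕ.+ toℕ k) ⟨
    [ toℕ i ] ∙ (j ∙ k)                    ≡⟨ cong (_∙ (j ∙ k)) ([toℕ] i) ⟩
    i ∙ (j ∙ k)                            ∎
    where open ≡-Reasoning

  ∙-comm : ∀ i j → i ∙ j ≡ j ∙ i
  ∙-comm i j = cong [_] (ℕ.+-comm (toℕ i) (toℕ j))

  ∙-identityˡ : ∀ j → [ 0 ] ∙ j ≡ j
  ∙-identityˡ j = [toℕ] j

  Vec : Set
  Vec = Fin m → 𝔽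

  opaque
    -- The bilinear extension of `∙`, that is, multiplication in F[x]/(x^m - 1), where `δ [ a ]` is
    -- the class of x^a.
    mul : Vec → Vec → Vec
    mul u v = lc u (λ i → lc v (λ j → δ (i ∙ j)))

    -- Allowing any family in place of `δ` reduces associativity of `mul` to that of `∙`.
    mul-lc : ∀ {I : Set} u v (X : Fin m → I → 𝔽) → lc (mul u v) X ≋ lc u (λ i → lc v (λ j → X (i ∙ j)))
    mul-lc u v X x = begin
      lc (mul u v) X x                                   ≡⟨ lc-lc u (λ i → lc v (λ j → δ (i ∙ j))) X x ⟨
      lc u (λ i → lc (lc v (λ j → δ (i ∙ j))) X) x       ≡⟨ lc-congʳ u (λ i y → ≡.sym (lc-lc v (λ j → δ (i ∙ j)) X y)) x ⟩
      lc u (λ i → lc v (λ j → lc (δ (i ∙ j)) X)) x       ≡⟨ lc-congʳ u (λ i → lc-congʳ v (λ j → lc-δˡ (i ∙ j) X)) x ⟩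
      lc u (λ i → lc v (λ j → X (i ∙ j))) x              ∎
      where open ≡-Reasoning

    mul-cong : ∀ {u u′ v v′} → u ≋ u′ → v ≋ v′ → mul u v ≋ mul u′ v′
    mul-cong {u} {u′} {v} {v′} u≋u′ v≋v′ x = ≡.trans (lc-congˡ (λ i → lc v (λ j → δ (i ∙ j))) u≋u′ x) (lc-congʳ u′ (λ i → lc-congˡ (λ j → δ (i ∙ j)) v≋v′) x)

    mul-assoc : ∀ u v w → mul (mul u v) w ≋ mul u (mul v w)
    mul-assoc u v w x = begin
      lc (mul u v) (λ l → lc w (λ k → δ (l ∙ k))) x                  ≡⟨ mul-lc u v (λ l → lc w (λ k → δ (l ∙ k))) x ⟩
      lc u (λ i → lc v (λ j → lc w (λ k → δ (i ∙ j ∙ k)))) x         ≡⟨ lc-congʳ u (λ i → lc-congʳ v (λ j → lc-congʳ w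
                                                                         (λ k y → cong (λ l → δ l y) (∙-assoc i j k)))) x ⟩
      lc u (λ i → lc v (λ j → lc w (λ k → δ (i ∙ (j ∙ k))))) x       ≡⟨ lc-congʳ u (λ i y → ≡.sym (mul-lc v w (λ l → δ (i ∙ l)) y)) x ⟩
      lc u (λ i → lc (mul v w) (λ l → δ (i ∙ l))) x                  ∎
      where open ≡-Reasoning

    mul-comm : ∀ u v → mul u v ≋ mul v u
    mul-comm u v x = begin
      ∑ m (λ i → u i * ∑ m (λ j → v j * δ (i ∙ j) x))      ≡⟨ ∑-cong m (λ i → ∑-*ˡ m (u i) (λ j → v j * δ (i ∙ j) x)) ⟨
      ∑ m (λ i → ∑ m (λ j → u i * (v j * δ (i ∙ j) x)))    ≡⟨ ∑-swap m m (λ i j → u i * (v j * δ (i ∙ j) x)) ⟩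
      ∑ m (λ j → ∑ m (λ i → u i * (v j * δ (i ∙ j) x)))    ≡⟨ ∑-cong m (λ j → ∑-cong m (λ i → reorder i j)) ⟩
      ∑ m (λ j → ∑ m (λ i → v j * (u i * δ (j ∙ i) x)))    ≡⟨ ∑-cong m (λ j → ∑-*ˡ m (v j) (λ i → u i * δ (j ∙ i) x)) ⟩
      ∑ m (λ j → v j * ∑ m (λ i → u i * δ (j ∙ i) x))      ∎
      where
      open ≡-Reasoning
      reorder : ∀ i j → u i * (v j * δ (i ∙ j) x) ≡ v j * (u i * δ (j ∙ i) x)
      reorder i j = ≡.trans (≡.sym (*-assoc (u i) (v j) _)) (≡.trans (cong₂ _*_ (*-comm (u i) (v j)) (cong (λ l → δ l x) (∙-comm i j)))
                            (*-assoc (v j) (u i) _))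

    mul-δ : ∀ i v → mul (δ i) v ≋ lc v (λ j → δ (i ∙ j))
    mul-δ i v = lc-δˡ i (λ i → lc v (λ j → δ (i ∙ j)))

    mul-linearˡ : ∀ v → IsLinear (λ u → mul u v)
    mul-linearˡ v = lc-linear (λ i → lc v (λ j → δ (i ∙ j)))

  mul-linearʳ : ∀ u → IsLinear (mul u)
  mul-linearʳ u = record
    { T-cong = mul-cong (λ _ → refl)
    ; T-⊕ = λ v w i → ≡.trans (mul-comm u _ i) (≡.trans (T-⊕ (mul-linearˡ u) v w i) (cong₂ _+_ (mul-comm v u i) (mul-comm w u i)))
    ; T-⊙ = λ a v i → ≡.trans (mul-comm u _ i) (≡.trans (T-⊙ (mul-linearˡ u) a v i) (cong (a *_) (mul-comm v u i))) }

  δ-∙ : ∀ i j → mul (δ i) (δ j) ≋ δ (i ∙ j)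
  δ-∙ i j x = ≡.trans (mul-δ i (δ j) x) (lc-δˡ j (λ j → δ (i ∙ j)) x)

  mul-identityˡ : ∀ u → mul (δ [ 0 ]) u ≋ u
  mul-identityˡ u x = ≡.trans (mul-δ [ 0 ] u x)
    (≡.trans (lc-congʳ u (λ j y → cong (λ l → δ l y) (∙-identityˡ j)) x) (lc-δʳ u x))

  algebra : CommutativeRing 0ℓ 0ℓ
  algebra = record
    { Carrier = Vec ; _≈_ = _≋_ ; _+_ = _⊕_ F ; _*_ = mul ; -_ = λ u i → - u i ; 0# = 𝟘 F ; 1# = δ [ 0 ]
    ; isCommutativeRing = record
      { isRing = record
        { +-isAbelianGroup = record
          { isGroup = record
            { isMonoid = record
              { isSemigroup = record
                { isMagma = record
                  { isEquivalence = record
                    { refl = λ _ → refl ; sym = λ eq i → ≡.sym (eq i) ; trans = λ eq eq′ i → ≡.trans (eq i) (eq′ i) }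
                  ; ∙-cong = λ eq eq′ i → cong₂ _+_ (eq i) (eq′ i) }
                ; assoc = λ u v w i → +-assoc (u i) (v i) (w i) }
              ; identity = (λ u i → +-identityˡ (u i)) , (λ u i → +-identityʳ (u i)) }
            ; inverse = (λ u i → -‿inverseˡ (u i)) , (λ u i → -‿inverseʳ (u i))
            ; ⁻¹-cong = λ eq i → cong -_ (eq i) }
          ; comm = λ u v i → +-comm (u i) (v i) }
        ; *-cong = mul-cong
        ; *-assoc = mul-assoc
        ; *-identity = mul-identityˡ , (λ u i → ≡.trans (mul-comm u (δ [ 0 ]) i) (mul-identityˡ u i))
        ; distrib = (λ u v w → T-⊕ (mul-linearʳ u) v w) , (λ u v w → T-⊕ (mul-linearˡ u) v w) }
      ; *-comm = mul-comm } }

  module E = CommutativeRing algebra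
  open Exp E.commutativeSemiring public using () renaming (_^_ to infixr 8 _^ᴱ_; ^-congˡ to ^ᴱ-cong)
  open Exp commutativeSemiring using (_^_; ^-assocʳ)
  open FiniteFieldProperties fieldRing isFiniteField using (fermat)

  δ-^ : ∀ a n → (δ [ a ]) ^ᴱ n ≋ δ [ n ℕ.* a ]
  δ-^ a zero    = λ _ → refl
  δ-^ a (suc n) = E.trans (E.*-congˡ {δ [ a ]} (δ-^ a n)) (E.trans (δ-∙ [ a ] [ n ℕ.* a ]) (λ i → cong (λ l → δ l i) ([]-∙ a (n ℕ.* a))))

  ×1-⊙ : ∀ n → Mult._×_ E.semiring n E.1# ≋ _⊙_ F (Mult._×_ semiring n 1#) E.1#
  ×1-⊙ zero    i = ≡.sym (zeroˡ _)
  ×1-⊙ (suc n) i = ≡.trans (cong₂ _+_ (≡.sym (*-identityˡ _)) (×1-⊙ n i)) (≡.sym (distribʳ _ _ _))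

  freshman : ∀ u v → (u E.+ v) ^ᴱ q ≋ (u ^ᴱ q) E.+ (v ^ᴱ q)
  freshman = freshman-over F algebra
    (λ n n≡0 i → ≡.trans (×1-⊙ n i) (≡.trans (cong (_* E.1# i) n≡0) (zeroˡ _)))

  ⊙-^ : ∀ a u n → (_⊙_ F a u) ^ᴱ n ≋ _⊙_ F (a ^ n) (u ^ᴱ n)
  ⊙-^ a u zero    i = ≡.sym (*-identityˡ _)
  ⊙-^ a u (suc n) i = begin
    mul (_⊙_ F a u) (_⊙_ F a u ^ᴱ n) i            ≡⟨ T-⊙ (mul-linearˡ _) a u i ⟩
    a * mul u (_⊙_ F a u ^ᴱ n) i                  ≡⟨ cong (a *_) (T-cong (mul-linearʳ u) (⊙-^ a u n) i) ⟩
    a * mul u (_⊙_ F (a ^ n) (u ^ᴱ n)) i          ≡⟨ cong (a *_) (T-⊙ (mul-linearʳ u) (a ^ n) (u ^ᴱ n) i) ⟩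
    a * (a ^ n * (u ^ᴱ suc n) i)                  ≡⟨ *-assoc a (a ^ n) _ ⟨
    a * a ^ n * (u ^ᴱ suc n) i                    ∎
    where open ≡-Reasoning

  fermat-iterated : ∀ d a → a ^ (q ℕ.^ d) ≡ a
  fermat-iterated zero    a = *-identityʳ a
  fermat-iterated (suc d) a = ≡.trans (≡.sym (^-assocʳ a q (q ℕ.^ d))) (≡.trans (cong (_^ (q ℕ.^ d)) (fermat a)) (fermat-iterated d a))

  -- Scalars pass through because a^q = a in F. Linearity makes it enough to compute these powers on
  -- monomials.
  frobenius-linear : ∀ d → IsLinear (_^ᴱ (q ℕ.^ d))
  frobenius-linear d = record
    { T-cong = ^ᴱ-cong (q ℕ.^ d)
    ; T-⊕ = Freshman.freshman-iterated algebra q freshman d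
    ; T-⊙ = λ a u i → ≡.trans (⊙-^ a u (q ℕ.^ d) i) (cong (_* (u ^ᴱ (q ℕ.^ d)) i) (fermat-iterated d a)) }

  -- Both sides are linear in `u`; on x^i the exponent q^N · i is congruent to i, since q^N = m + 1.
  ^q^N≋ : ∀ N → q ℕ.^ N ≡ suc m → ∀ u → u ^ᴱ (q ℕ.^ N) ≋ u
  ^q^N≋ N q^N≡ u = E.trans (linear-on-δ (frobenius-linear N) u) (E.trans (lc-congʳ u fixed) (lc-δʳ u))
    where
    fixed : ∀ i → δ i ^ᴱ (q ℕ.^ N) ≋ δ i
    fixed i x = begin
      (δ i ^ᴱ (q ℕ.^ N)) x             ≡⟨ cong (λ l → (δ l ^ᴱ (q ℕ.^ N)) x) ([toℕ] i) ⟨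
      (δ [ toℕ i ] ^ᴱ (q ℕ.^ N)) x     ≡⟨ δ-^ (toℕ i) (q ℕ.^ N) x ⟩
      δ [ q ℕ.^ N ℕ.* toℕ i ] x        ≡⟨ cong (λ l → δ l x) ([]-cong {q ℕ.^ N ℕ.* toℕ i} {toℕ i} same) ⟩
      δ [ toℕ i ] x                    ≡⟨ cong (λ l → δ l x) ([toℕ] i) ⟩
      δ i x                            ∎
      where
      open ≡-Reasoning
      same : (q ℕ.^ N ℕ.* toℕ i) % m ≡ toℕ i % m
      same = begin
        (q ℕ.^ N ℕ.* toℕ i) % m         ≡⟨ cong (λ Q → (Q ℕ.* toℕ i) % m) q^N≡ ⟩
        (toℕ i ℕ.+ m ℕ.* toℕ i) % m     ≡⟨ cong (λ t → (toℕ i ℕ.+ t) % m) (ℕ.*-comm m (toℕ i)) ⟩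
        (toℕ i ℕ.+ toℕ i ℕ.* m) % m     ≡⟨ [m+kn]%n≡m%n (toℕ i) (toℕ i) m ⟩
        toℕ i % m                       ∎

  -- Degree below `D`, certified by a list of monomials in any order and with repetitions. Exponents
  -- are read modulo `m`, so coefficients are constrained only when `D < m`.
  data Below (D : ℕ) : Vec → Set where
    nil  : ∀ {u} → u ≋ 𝟘 F → Below D u
    step : ∀ {u v} a {i} → i ℕ.< D → Below D u → v ≋ _⊕_ F (_⊙_ F a (δ [ i ])) u → Below D v

  below-resp : ∀ {D u v} → u ≋ v → Below D u → Below D v
  below-resp u≋v (nil u≋0)            = nil (E.trans (E.sym u≋v) u≋0)
  below-resp u≋v (step a i<D below eq) = step a i<D below (E.trans (E.sym u≋v) eq)

  below-weaken : ∀ {D D′ u} → D ℕ.≤ D′ → Below D u → Below D′ u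
  below-weaken D≤ (nil u≋0)             = nil u≋0
  below-weaken D≤ (step a i<D below eq) = step a (ℕ.<-≤-trans i<D D≤) (below-weaken D≤ below) eq

  below-⊕ : ∀ {D u v} → Below D u → Below D v → Below D (_⊕_ F u v)
  below-⊕ {v = v} (nil u≋0) bv = below-resp (λ i → ≡.sym (≡.trans (cong (_+ v i) (u≋0 i)) (+-identityˡ (v i)))) bv
  below-⊕ {v = v} (step a i<D bu eq) bv =
    step a i<D (below-⊕ bu bv) (λ i → ≡.trans (cong (_+ v i) (eq i)) (+-assoc _ _ _))

  below-⊙ : ∀ {D u} c → Below D u → Below D (_⊙_ F c u)
  below-⊙ c (nil u≋0) = nil (λ i → ≡.trans (cong (c *_) (u≋0 i)) (zeroʳ c))
  below-⊙ c (step {u} a i<D bu eq) = step (c * a) i<D (below-⊙ c bu)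
    (λ l → ≡.trans (cong (c *_) (eq l)) (≡.trans (distribˡ c _ _) (cong (_+ c * u l) (≡.sym (*-assoc c a _)))))

  below-δ : ∀ {D} a {i} → i ℕ.< D → Below D (_⊙_ F a (δ [ i ]))
  below-δ a i<D = step a i<D (nil (λ _ → refl)) (λ i → ≡.sym (+-identityʳ _))

  below-mul : ∀ {D u} e → Below D u → Below (D ℕ.+ e) (mul (δ [ e ]) u)
  below-mul e (nil u≋0) = nil (T-𝟘 (mul-linearʳ _) u≋0)
  below-mul {D} e (step {u} a {i} i<D bu eq) = step a (ℕ.+-monoˡ-< e i<D) (below-mul e bu)
    (E.trans (T-cong (mul-linearʳ (δ [ e ])) eq) (λ l → ≡.trans (T-⊕ (mul-linearʳ (δ [ e ])) (_⊙_ F a (δ [ i ])) u l)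
      (cong (_+ mul (δ [ e ]) u l) (≡.trans (T-⊙ (mul-linearʳ (δ [ e ])) a (δ [ i ]) l)
        (cong (a *_) (≡.trans (δ-∙ [ e ] [ i ] l) (cong (λ k → δ k l) (≡.trans ([]-∙ e i) (cong [_] (ℕ.+-comm e i))))))))))

  below-coefficient : ∀ {D u} → D ℕ.< m → Below D u → u [ D ] ≡ 0#
  below-coefficient D<m (nil u≋0) = u≋0 _
  below-coefficient {D} D<m (step {u} a {i} i<D bu eq) = begin
    _                           ≡⟨ eq [ D ] ⟩
    a * δ [ i ] [ D ] + u [ D ] ≡⟨ cong₂ (λ x y → a * x + y) (δ-off distinct) (below-coefficient D<m bu) ⟩
    a * 0# + 0#                 ≡⟨ ≡.trans (+-identityʳ _) (zeroʳ a) ⟩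
    0#                          ∎
    where
    open ≡-Reasoning
    distinct : [ i ] ≢ [ D ]
    distinct eq = ℕ.<⇒≢ i<D (≡.trans (≡.sym (m<n⇒m%n≡m (ℕ.<-trans i<D D<m)))
      (≡.trans (≡.sym (toℕ-[] i)) (≡.trans (cong toℕ eq) (≡.trans (toℕ-[] D) (m<n⇒m%n≡m D<m)))))

  Monic : ℕ → Vec → Set
  Monic D u = ∃ λ r → Below D r × u ≋ _⊕_ F (δ [ D ]) r

  -- As `D < m`, no monomial of the remainder wraps around onto x^D, so the coefficient there is 1.
  monic≉0 : ∀ {D u} → D ℕ.< m → Monic D u → ¬ (u ≋ 𝟘 F)
  monic≉0 {D} {u} D<m (r , br , eq) u≋0 = 0≢1 (begin
    0#                       ≡⟨ u≋0 [ D ] ⟨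
    u [ D ]                  ≡⟨ eq [ D ] ⟩
    δ [ D ] [ D ] + r [ D ]  ≡⟨ cong₂ _+_ (δ-diag [ D ]) (below-coefficient D<m br) ⟩
    1# + 0#                  ≡⟨ +-identityʳ 1# ⟩
    1#                       ∎)
    where open ≡-Reasoning

  -- (x^D + r)(x^e - x) = x^(D+e) + x^e r - (x^(D+1) + x r), and `2 ≤ e` keeps x^(D+1) below degree
  -- D + e.
  monic-mul : ∀ {D u} e → 2 ℕ.≤ e → Monic D u → Monic (D ℕ.+ e) (mul u (_⊖_ F (δ [ e ]) (δ [ 1 ])))
  monic-mul {D} {u} e 2≤e (r , br , eq) = r′ , below , equation
    where
    t s : Vec
    t = δ [ e ]
    s = δ [ 1 ]
    r′ : Vec
    r′ = _⊕_ F (mul t r) (_⊙_ F (- 1#) (_⊕_ F (_⊙_ F 1# (δ [ suc D ])) (mul s r)))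
    below : Below (D ℕ.+ e) r′
    below = below-⊕ (below-mul e br) (below-⊙ (- 1#) (below-⊕
      (below-δ 1# (ℕ.≤-trans (ℕ.≤-reflexive (ℕ.+-comm 2 D)) (ℕ.+-monoʳ-≤ D 2≤e)))
      (below-weaken (ℕ.+-monoʳ-≤ D (ℕ.≤-trans (ℕ.n≤1+n 1) 2≤e)) (below-mul 1 br))))
    times : ∀ a → mul u (δ [ a ]) ≋ _⊕_ F (δ [ D ℕ.+ a ]) (mul (δ [ a ]) r)
    times a = E.trans (E.*-congʳ {δ [ a ]} eq) (λ i → ≡.trans (T-⊕ (mul-linearˡ (δ [ a ])) (δ [ D ]) r i)
      (cong₂ _+_ (≡.trans (δ-∙ [ D ] [ a ] i) (cong (λ l → δ l i) ([]-∙ D a))) (mul-comm r (δ [ a ]) i)))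
    equation : mul u (_⊖_ F t s) ≋ _⊕_ F (δ [ D ℕ.+ e ]) r′
    equation i = begin
      mul u (_⊖_ F t s) i                                       ≡⟨ T-⊖ (mul-linearʳ u) t s i ⟩
      mul u t i + - mul u s i                                   ≡⟨ cong₂ (λ x y → x + - y) (times e i) (times 1 i) ⟩
      δ [ D ℕ.+ e ] i + mul t r i + - (δ [ D ℕ.+ 1 ] i + mul s r i) ≡⟨ +-assoc _ _ _ ⟩
      δ [ D ℕ.+ e ] i + (mul t r i + - (δ [ D ℕ.+ 1 ] i + mul s r i)) ≡⟨ cong (λ x → δ [ D ℕ.+ e ] i + (mul t r i + x)) tail ⟩
      δ [ D ℕ.+ e ] i + r′ i                                    ∎
      where
      open ≡-Reasoning
      tail : - (δ [ D ℕ.+ 1 ] i + mul s r i) ≡ - 1# * (1# * δ [ suc D ] i + mul s r i)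
      tail = begin
        - (δ [ D ℕ.+ 1 ] i + mul s r i)              ≡⟨ cong (λ l → - (δ [ l ] i + mul s r i)) (ℕ.+-comm D 1) ⟩
        - (δ [ suc D ] i + mul s r i)                ≡⟨ cong (λ x → - (x + mul s r i)) (*-identityˡ _) ⟨
        - (1# * δ [ suc D ] i + mul s r i)           ≡⟨ RingProperties.-1*x≈-x ring _ ⟨
        - 1# * (1# * δ [ suc D ] i + mul s r i)      ∎

-- Extension fields of every degree

-- What linearized polynomials call for: no zero divisors, to count roots; F-linear coordinates; a
-- Frobenius map compatible with sums and scalars. Equality is that of `fieldᴷ`, because the field
-- arises as a quotient.
record ExtensionField {q : ℕ} (F : FiniteField q) (N : ℕ) : Set₁ where
  open LinearAlgebra F using (𝔽; _≋_)
  infixr 8 _·_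
  field
    fieldᴷ : CommutativeRing 0ℓ 0ℓ
  open CommutativeRing fieldᴷ
  open Exp commutativeSemiring using (_^_)
  field
    1≉0               : ¬ (1# ≈ 0#)
    domain            : ∀ x y → x * y ≈ 0# → x ≈ 0# ⊎ y ≈ 0#
    _·_               : 𝔽 → Carrier → Carrier
    coords            : Carrier → Fin N → 𝔽
    fromCoords        : (Fin N → 𝔽) → Carrier
    coords-cong       : ∀ {x y} → x ≈ y → coords x ≋ coords y
    coords-injective  : ∀ {x y} → coords x ≋ coords y → x ≈ y
    coords-+          : ∀ x y → coords (x + y) ≋ _⊕_ F (coords x) (coords y)
    coords-·          : ∀ a x → coords (a · x) ≋ _⊙_ F a (coords x)
    coords-fromCoords : ∀ c → coords (fromCoords c) ≋ c
    ·-*               : ∀ a x y → (a · x) * y ≈ a · (x * y)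
    frobenius-+       : ∀ x y → (x + y) ^ q ≈ x ^ q + y ^ q
    frobenius-·       : ∀ a x → (a · x) ^ q ≈ a · (x ^ q)

reduced : (R : CommutativeRing 0ℓ 0ℓ) → let open CommutativeRing R; open Exp commutativeSemiring in
  ∀ n h v → h ^ suc (suc n) ≈ h → h * (h * v) ≈ 0# → h * v ≈ 0#
reduced R n h v h^n≈h hhv≈0 = begin
  h * v                  ≈⟨ *-congʳ h^n≈h ⟨
  h * (h * h ^ n) * v    ≈⟨ solve 3 (λ h z v → (h :* (h :* z)) :* v := z :* (h :* (h :* v))) ≈-refl h (h ^ n) v ⟩
  h ^ n * (h * (h * v))  ≈⟨ *-congˡ hhv≈0 ⟩
  h ^ n * 0#             ≈⟨ zeroʳ (h ^ n) ⟩
  0#                     ∎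
  where
  open CommutativeRing R renaming (refl to ≈-refl)
  open Exp commutativeSemiring
  open SetoidReasoning setoid
  open Solver commutativeSemiring using (solve; _:*_; _:=_)

-- In E = F[x]/(x^(q^N−1) − 1) every u satisfies u^(q^N) = u, so E is reduced and E/Ann(w) is a field as soon as the
-- ideal wE is minimal.  Taking w among the multiples of h = ∏_{0<d<N} (x^(q^d) − x), which is nonzero by its degree,
-- rules out that the class of x lies in a field with q^d elements for 0 < d < N.
module ExtensionConstruction {q : ℕ} (F : FiniteField q) (N′ p : ℕ) (q^N≡ : q ℕ.^ suc N′ ≡ suc (suc p)) where
  open LinearAlgebra F
  open CyclicGroupAlgebra F p

  N : ℕ
  N = suc N′

  ideal : Vec → Subspace F (Fin m)
  ideal w = span (λ j → mul w (δ j))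

  mul∈ideal : ∀ w u → mem (ideal w) (mul w u)
  mul∈ideal w u = u , linear-on-δ (mul-linearʳ w) u

  ideal⇒mul : ∀ w {v} → mem (ideal w) v → ∃ λ u → v ≋ mul w u
  ideal⇒mul w (u , eq) = u , λ i → ≡.trans (eq i) (≡.sym (linear-on-δ (mul-linearʳ w) u i))

  w∈ideal : ∀ w → mem (ideal w) w
  w∈ideal w = resp (ideal w) (E.*-identityʳ w) (mul∈ideal w (δ [ 0 ]))

  -- The ideal wE is minimal. Modulo Ann(w) the equation w u v = w says that `v` inverts `u`, which
  -- is how the quotient becomes a field.
  Minimal : Vec → Set
  Minimal w = ∀ u → ¬ (mul w u ≋ 𝟘 F) → ∃ λ v → mul (mul w u) v ≋ w

  -- Descent on the dimension of the ideal: if `w` is not minimal, some nonzero multiple of it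
  -- generates an ideal that misses `w`. Divisibility by `h` is carried along for `factors-survive`.
  minimal-multiple : ∀ fuel h w {r} → ¬ (w ≋ 𝟘 F) → HasDim F (mem (ideal w)) r → r ℕ.≤ fuel → (∃ λ h′ → w ≋ mul h h′) →
    ∃ λ w → ¬ (w ≋ 𝟘 F) × Minimal w × ∃ λ h′ → w ≋ mul h h′
  minimal-multiple fuel h w {r} w≉0 dim r≤fuel (h′ , w≋) with search {P = λ u → ¬ (mul w u ≋ 𝟘 F) × ¬ mem (ideal (mul w u)) w}
    (λ {u} {v} u≋v (wu≉0 , w∉) →
      (λ wv≋0 → wu≉0 (E.trans (E.*-congˡ {w} u≋v) wv≋0)) ,
      (λ w∈ → w∉ (resp-ideal (E.*-congˡ {w} u≋v) w∈)))
    (λ u → ¬? (≋? (mul w u) (𝟘 F)) ×-dec ¬? (InSpan? (λ j → mul (mul w u) (δ j)) w))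
    where
    resp-ideal : ∀ {u v z} → u ≋ v → mem (ideal v) z → mem (ideal u) z
    resp-ideal {u} {v} u≋v z∈ with ideal⇒mul v z∈
    ... | y , z≋ = resp (ideal u) (E.trans (E.*-congʳ {y} u≋v) (E.sym z≋)) (mul∈ideal u y)
  ... | no none = w , w≉0 , minimal , h′ , w≋
    where
    minimal : Minimal w
    minimal u wu≉0 with InSpan? (λ j → mul (mul w u) (δ j)) w
    ... | no  w∉ = contradiction (u , wu≉0 , w∉) none
    ... | yes w∈ with ideal⇒mul (mul w u) w∈
    ...   | v , w≋ = v , E.sym w≋
  ... | yes (u , wu≉0 , w∉) = smaller fuel r≤fuel
    where
    r′<r : ∀ {r′} → HasDim F (mem (ideal (mul w u))) r′ → r′ ℕ.< r
    -- A basis of the smaller ideal stays independent when `w` is added, and all of it lies in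
    -- `ideal w`.
    r′<r {r′} dim′@(b , ind , spans) = steinitz {b = cons w b} {proj₁ dim} (cons-indep ind (w∉ ∘ proj₂ (spans w)))
      λ { zero → proj₁ (proj₂ (proj₂ dim) w) (w∈ideal w)
        ; (suc j) → proj₁ (proj₂ (proj₂ dim) (b j)) (sub (basis∈ {P = mem (ideal (mul w u))} dim′ j)) }
      where
      sub : ∀ {z} → mem (ideal (mul w u)) z → mem (ideal w) z
      sub z∈ with ideal⇒mul (mul w u) z∈
      ... | y , z≋ = resp (ideal w) (E.sym (E.trans z≋ (E.*-assoc w u y))) (mul∈ideal w (mul u y))
    smaller : ∀ fuel → r ℕ.≤ fuel → ∃ λ w → ¬ (w ≋ 𝟘 F) × Minimal w × ∃ λ h′ → w ≋ mul h h′
    smaller fuel r≤fuel with rank-exists (λ j → mul (mul w u) (δ j))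
    smaller zero       r≤0    | r′ , dim′ = contradiction (ℕ.<-≤-trans (r′<r dim′) r≤0) ℕ.n≮0
    smaller (suc fuel) r≤fuel | r′ , dim′ = minimal-multiple fuel h (mul w u) wu≉0 dim′
      (ℕ.≤-pred (ℕ.≤-trans (r′<r dim′) r≤fuel)) (mul h′ u , E.trans (E.*-congʳ {u} w≋) (E.*-assoc h h′ u))

  factor : ℕ → Vec
  factor d = _⊖_ F (δ [ q ℕ.^ d ]) (δ [ 1 ])

  factors : ℕ → Vec
  factors zero    = δ [ 0 ]
  factors (suc d) = mul (factors d) (factor (suc d))

  degree : ℕ → ℕ
  degree zero    = 0
  degree (suc d) = degree d ℕ.+ q ℕ.^ suc d

  factors-monic : ∀ d → Monic (degree d) (factors d)
  factors-monic zero    = 𝟘 F , nil (λ _ → refl) , λ i → ≡.sym (+-identityʳ _)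
  factors-monic (suc d) = monic-mul (q ℕ.^ suc d) (2≤q^[1+d] d) (factors-monic d)

  -- The degree is q + ⋯ + q^d. The slack of 2 gives degree < m = q^N - 1 at `d = N′`, so the
  -- product of the factors does not wrap around modulo x^m - 1.
  degree-bound : ∀ d → degree d ℕ.+ 2 ℕ.≤ q ℕ.^ suc d
  degree-bound zero    = 2≤q^[1+d] 0
  degree-bound (suc d) = begin
    degree d ℕ.+ q ℕ.^ suc d ℕ.+ 2    ≡⟨ ≡.trans (ℕ.+-assoc (degree d) _ 2) (≡.trans (cong (degree d ℕ.+_) (ℕ.+-comm _ 2)) (≡.sym (ℕ.+-assoc (degree d) 2 _))) ⟩
    degree d ℕ.+ 2 ℕ.+ q ℕ.^ suc d    ≤⟨ ℕ.+-monoˡ-≤ _ (degree-bound d) ⟩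
    q ℕ.^ suc d ℕ.+ q ℕ.^ suc d       ≡⟨ cong (q ℕ.^ suc d ℕ.+_) (ℕ.+-identityʳ _) ⟨
    2 ℕ.* q ℕ.^ suc d                 ≤⟨ ℕ.*-monoˡ-≤ (q ℕ.^ suc d) 2≤q ⟩
    q ℕ.^ suc (suc d)                 ∎
    where open ℕ.≤-Reasoning

  factors≉0 : ¬ (factors N′ ≋ 𝟘 F)
  factors≉0 = monic≉0 (ℕ.≤-pred (ℕ.≤-trans (ℕ.≤-reflexive (ℕ.+-comm 2 (degree N′))) (ℕ.≤-trans (degree-bound N′) (ℕ.≤-reflexive q^N≡))))
                      (factors-monic N′)

  module Field (w : Vec) (w≉0 : ¬ (w ≋ 𝟘 F)) (minimal : Minimal w) (h′ : Vec) (w≋ : w ≋ mul (factors N′) h′)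
               {D : ℕ} (dim : HasDim F (mem (ideal w)) D) where
    open AnnihilatorQuotient algebra w
    module K = CommutativeRing quotientRing
    open Exp K.commutativeSemiring using () renaming (_^_ to infixr 8 _^ᴷ_)

    b : Fin D → Vec
    b = proj₁ dim

    coordinates : ∀ u → InSpan F b (mul w u)
    coordinates u = proj₁ (proj₂ (proj₂ dim) (mul w u)) (mul∈ideal w u)

    coords : Vec → Fin D → 𝔽
    coords u = proj₁ (coordinates u)

    coords-eq : ∀ u → mul w u ≋ lc (coords u) b
    coords-eq u = proj₂ (coordinates u)

    coords-unique : ∀ u c → mul w u ≋ lc c b → coords u ≋ c
    coords-unique u c eq = indep-injective (proj₁ (proj₂ dim)) (≋-trans (≋-sym (coords-eq u)) eq)

    coords-cong : ∀ {u v} → u ∼ v → coords u ≋ coords v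
    coords-cong {u} {v} u∼v = coords-unique u (coords v) (E.trans u∼v (coords-eq v))

    coords-injective : ∀ {u v} → coords u ≋ coords v → u ∼ v
    coords-injective {u} {v} eq = E.trans (coords-eq u) (E.trans (lc-congˡ b eq) (E.sym (coords-eq v)))

    coords-linear : IsLinear coords
    coords-linear = record
      { T-cong = λ {u} {v} u≋v → coords-cong {u} {v} (≈⇒∼ u≋v)
      ; T-⊕ = λ u v → coords-unique (_⊕_ F u v) _ (λ i → ≡.trans (T-⊕ (mul-linearʳ w) u v i)
                (≡.trans (cong₂ _+_ (coords-eq u i) (coords-eq v i)) (≡.sym (lc-⊕ (coords u) (coords v) b i))))
      ; T-⊙ = λ a u → coords-unique (_⊙_ F a u) _ (λ i → ≡.trans (T-⊙ (mul-linearʳ w) a u i)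
                (≡.trans (cong (a *_) (coords-eq u i)) (≡.sym (lc-⊙ a (coords u) b i)))) }

    preimage : ∀ j → ∃ λ u → b j ≋ mul w u
    preimage j = ideal⇒mul w (basis∈ {P = mem (ideal w)} dim j)

    fromCoords : (Fin D → 𝔽) → Vec
    fromCoords c = lc c (λ j → proj₁ (preimage j))

    coords-fromCoords : ∀ c → coords (fromCoords c) ≋ c
    coords-fromCoords c = coords-unique (fromCoords c) c
      (E.trans (T-lc (mul-linearʳ w) c (λ j → proj₁ (preimage j))) (lc-congʳ c (λ j → E.sym (proj₂ (preimage j)))))

    1≉0 : ¬ (K.1# K.≈ K.0#)
    1≉0 eq = w≉0 (E.trans (E.sym (E.*-identityʳ w)) (E.trans eq (E.zeroʳ w)))

    -- Coordinates with respect to a basis of wE number the classes, so u^(q^D) = u holds in the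
    -- quotient by `fermat`.
    isFiniteFieldᴷ : IsFiniteField quotientRing (q ℕ.^ D)
    isFiniteFieldᴷ = record
      { _≈?_ = λ u v → ≋? (mul w u) (mul w v)
      ; 1≉0 = 1≉0
      ; inv = invert
      ; element = λ t → fromCoords (vec t)
      ; index = λ u → vecIndex (coords u)
      ; index-cong = λ {u} {v} u∼v → vecIndex-cong (coords-cong {u} {v} u∼v)
      ; element-index = λ u → coords-injective {fromCoords (vec (vecIndex (coords u)))} {u}
          (≋-trans (coords-fromCoords _) (vec-vecIndex (coords u)))
      ; index-element = λ t → ≡.trans (vecIndex-cong (coords-fromCoords (vec t))) (vecIndex-vec {D} t)
      }
      where
      invert : ∀ u → ¬ (u ∼ 𝟘 F) → ∃ λ v → mul u v ∼ δ [ 0 ]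
      invert u u≁0 with minimal u (λ wu≋0 → u≁0 (E.trans wu≋0 (E.sym (E.zeroʳ w))))
      ... | v , wuv≋w = v , E.trans (E.sym (E.*-assoc w u v)) (E.trans wuv≋w (E.sym (E.*-identityʳ w)))

    open FiniteFieldProperties quotientRing isFiniteFieldᴷ using (domain; fermat)

    ^N∼ : ∀ u → u ^ᴷ (q ℕ.^ N) ∼ u
    ^N∼ u = ≈⇒∼ (E.trans (E.reflexive (^-same u (q ℕ.^ N))) (^q^N≋ N q^N≡ u))

    factors-vanish : ∀ {d} e → d ℕ.< e → w E.* factor (suc d) ≋ 𝟘 F → w E.* factors e ≋ 𝟘 F
    factors-vanish {d} (suc e) (s≤s d≤e) eq with ℕ.m≤n⇒m<n∨m≡n d≤e
    ... | inj₁ d<e = E.trans (E.sym (E.*-assoc w (factors e) (factor (suc e))))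
                             (E.trans (E.*-congʳ {factor (suc e)} (factors-vanish e d<e eq)) (E.zeroˡ (factor (suc e))))
    ... | inj₂ refl = E.trans (E.*-congˡ {w} (E.*-comm (factors e) (factor (suc e))))
                              (E.trans (E.sym (E.*-assoc w (factor (suc e)) (factors e)))
                              (E.trans (E.*-congʳ {factors e} eq) (E.zeroˡ (factors e))))

    -- With w = h h′, the equation w h = 0 reads h h h′ = 0, and reducedness gives h h′ = 0, that
    -- is, w = 0.
    factors-survive : ¬ (w E.* factors N′ ≋ 𝟘 F)
    factors-survive wh≋0 = w≉0 (E.trans w≋ (reduced algebra p (factors N′) h′
      (E.trans (E.reflexive (cong (factors N′ ^ᴱ_) (≡.sym q^N≡))) (^q^N≋ N q^N≡ (factors N′)))
      (E.trans (E.*-congˡ {factors N′} (E.sym w≋)) (E.trans (E.*-comm (factors N′) w) wh≋0))))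

    D≢0 : D ≢ 0
    D≢0 refl = w≉0 (E.trans (E.sym (E.*-identityʳ w)) (E.trans (coords-eq (δ [ 0 ])) (λ _ → refl)))

    -- If D < N, `fermat` for the class of x makes `w` annihilate x^(q^D) - x, one of the factors of
    -- h, and thereby h itself.
    N≤D : N ℕ.≤ D
    N≤D with N ℕ.≤? D
    ... | yes N≤D = N≤D
    ... | no  N≰D = contradiction (small D refl (ℕ.≰⇒> N≰D)) factors-survive
      where
      small : ∀ d → d ≡ D → d ℕ.< N → w E.* factors N′ ≋ 𝟘 F
      small zero    d≡D d<N = contradiction (≡.sym d≡D) D≢0
      small (suc d) refl (s≤s d<N′) = factors-vanish N′ d<N′ (λ i → ≡.trans (T-⊖ (mul-linearʳ w) _ _ i)
        (≋⇒⊖≋𝟘 (E.trans (E.*-congˡ {w} (E.sym power)) (fermat (δ [ 1 ]))) i))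
        where
        power : δ [ 1 ] ^ᴷ (q ℕ.^ suc d) ≋ δ [ q ℕ.^ suc d ]
        power = E.trans (E.reflexive (^-same (δ [ 1 ]) (q ℕ.^ suc d)))
          (E.trans (δ-^ 1 (q ℕ.^ suc d)) (λ i → cong (λ l → δ [ l ] i) (ℕ.*-identityʳ (q ℕ.^ suc d))))

    -- All q^D elements of the quotient are roots of Y^(q^N) - Y.
    D≤N : D ℕ.≤ N
    D≤N = q^-cancel-≤ (roots-bound {f = λ y → K.- K.1# K.* y ^ᴷ 1} {a = K.1#} (monomial-below (K.- K.1#) (ℕ.≤-trans (ℕ.≤-reflexive refl) (2≤q^[1+d] N′)))
      1≉0 element element-injective vanish)
      where
      open PolynomialRoots quotientRing domain
      open IsFiniteField isFiniteFieldᴷ using (element; index; index-cong; index-element)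
      element-injective : ∀ {i j} → element i ∼ element j → i ≡ j
      element-injective {i} {j} eq = ≡.trans (≡.sym (index-element i)) (≡.trans (index-cong eq) (index-element j))
      vanish : ∀ i → K.1# K.* element i ^ᴷ (q ℕ.^ N) K.+ K.- K.1# K.* element i ^ᴷ 1 K.≈ K.0#
      vanish i = K.trans (K.+-cong (K.trans (K.*-identityˡ _) (^N∼ y))
                                   (K.trans (RingProperties.-1*x≈-x K.ring _) (K.-‿cong (K.*-identityʳ y))))
                         (K.-‿inverseʳ y)
        where y = element i

    extension : ExtensionField F D
    extension = record
      { fieldᴷ = quotientRing
      ; 1≉0 = 1≉0
      ; domain = domain
      ; _·_ = _⊙_ F
      ; coords = coords
      ; fromCoords = fromCoords
      ; coords-cong = λ {u} {v} → coords-cong {u} {v}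
      ; coords-injective = λ {u} {v} → coords-injective {u} {v}
      ; coords-+ = T-⊕ coords-linear
      ; coords-· = T-⊙ coords-linear
      ; coords-fromCoords = coords-fromCoords
      ; ·-* = λ a u v → ≈⇒∼ (T-⊙ (mul-linearˡ v) a u)
      ; frobenius-+ = λ u v → ≈⇒∼ (E.trans (same (u E.+ v)) (E.trans (freshman u v) (E.sym (E.+-cong (same u) (same v)))))
      ; frobenius-· = λ a u → ≈⇒∼ (E.trans (same (_⊙_ F a u)) (E.trans (frobenius-⊙ a u) (λ i → cong (a *_) (≡.sym (same u i)))))
      }
      where
      same : ∀ u → u ^ᴷ q ≋ u ^ᴱ q
      same u = E.reflexive (^-same u q)
      frobenius-⊙ : ∀ a u → (_⊙_ F a u) ^ᴱ q ≋ _⊙_ F a (u ^ᴱ q)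
      frobenius-⊙ a u = subst (λ n → (_⊙_ F a u) ^ᴱ n ≋ _⊙_ F a (u ^ᴱ n)) (ℕ.^-identityʳ q) (T-⊙ (frobenius-linear 1) a u)

  extension : ExtensionField F N
  extension with rank-exists (λ j → mul (factors N′) (δ j))
  ... | r , dim with minimal-multiple r (factors N′) (factors N′) factors≉0 dim ℕ.≤-refl (δ [ 0 ] , E.sym (E.*-identityʳ (factors N′)))
  ...   | w , w≉0 , minimal , h′ , w≋ with rank-exists (λ j → mul w (δ j))
  ...     | D , dimᴷ = subst (ExtensionField F) (ℕ.≤-antisym D≤N N≤D) Ext.extension
    where
    module Ext = Field w w≉0 minimal h′ w≋ dimᴷ
    open Ext using (D≤N; N≤D)

opaque
  extensionField : ∀ {q} (F : FiniteField q) N → 0 ℕ.< N → ExtensionField F N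
  extensionField {q} F (suc N′) _ =
    -- With p = q^N - 2 the group has order `suc p`, which is q^N - 1.
    ExtensionConstruction.extension F N′ (q ℕ.^ suc N′ ℕ.∸ 2) (≡.sym (ℕ.m+[n∸m]≡n (LinearAlgebra.2≤q^[1+d] F N′)))

-- Gabidulin codes

module Gabidulin {q : ℕ} (F : FiniteField q) {N : ℕ} (ext : ExtensionField F N) where
  open LinearAlgebra F
  open ExtensionField ext
  module K = CommutativeRing fieldᴷ
  open Exp K.commutativeSemiring
  open PolynomialRoots fieldᴷ domain using (PolyBelow; zero-poly; add-poly; weaken-poly; monomial-below; roots-bound)
  open SetoidReasoning K.setoid

  ≈0? : ∀ x → Dec (x K.≈ K.0#)
  ≈0? x with ≋? (coords x) (coords K.0#)
  ... | yes eq  = yes (coords-injective eq)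
  ... | no  neq = no (neq ∘ coords-cong)

  ·-cong : ∀ a {x y} → x K.≈ y → a · x K.≈ a · y
  ·-cong a {x} {y} x≈y = coords-injective (≋-trans (coords-· a x)
    (≋-trans (λ i → cong (a *_) (coords-cong x≈y i)) (≋-sym (coords-· a y))))

  ·-distribˡ : ∀ a x y → a · (x K.+ y) K.≈ a · x K.+ a · y
  ·-distribˡ a x y = coords-injective λ i → ≡.trans (coords-· a (x K.+ y) i)
    (≡.trans (cong (a *_) (coords-+ x y i)) (≡.trans (distribˡ a _ _)
    (≡.sym (≡.trans (coords-+ (a · x) (a · y) i) (cong₂ _+_ (coords-· a x i) (coords-· a y i))))))

  ·-zeroʳ : ∀ a → a · K.0# K.≈ K.0#
  ·-zeroʳ a = K.trans (·-cong a (K.sym (K.zeroˡ K.0#))) (K.trans (K.sym (·-* a K.0# K.0#)) (K.zeroʳ _))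

  coords-0 : coords K.0# ≋ 𝟘 F
  coords-0 l = ≡.trans (coords-cong (K.sym (·-zeroʳ 0#)) l) (≡.trans (coords-· 0# K.0# l) (zeroˡ _))

  *-· : ∀ a x y → x K.* (a · y) K.≈ a · (x K.* y)
  *-· a x y = K.trans (K.*-comm x (a · y)) (K.trans (·-* a y x) (·-cong a (K.*-comm y x)))

  fromCoords-cong : ∀ {u v} → u ≋ v → fromCoords u K.≈ fromCoords v
  fromCoords-cong {u} {v} u≋v = coords-injective (≋-trans (coords-fromCoords u) (≋-trans u≋v (≋-sym (coords-fromCoords v))))

  fromCoords-⊕ : ∀ u v → fromCoords (_⊕_ F u v) K.≈ fromCoords u K.+ fromCoords v
  fromCoords-⊕ u v = coords-injective (≋-trans (coords-fromCoords (_⊕_ F u v))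
    (≋-sym (≋-trans (coords-+ _ _) (λ i → cong₂ _+_ (coords-fromCoords u i) (coords-fromCoords v i)))))

  fromCoords-⊙ : ∀ a u → fromCoords (_⊙_ F a u) K.≈ a · fromCoords u
  fromCoords-⊙ a u = coords-injective (≋-trans (coords-fromCoords (_⊙_ F a u))
    (≋-sym (≋-trans (coords-· a _) (λ i → cong (a *_) (coords-fromCoords u i)))))

  fromCoords-injective : ∀ {u v} → fromCoords u K.≈ fromCoords v → u ≋ v
  fromCoords-injective {u} {v} eq = ≋-trans (≋-sym (coords-fromCoords u)) (≋-trans (coords-cong eq) (coords-fromCoords v))

  frobenius^-+ : ∀ d x y → (x K.+ y) ^ (q ℕ.^ d) K.≈ x ^ (q ℕ.^ d) K.+ y ^ (q ℕ.^ d)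
  frobenius^-+ = Freshman.freshman-iterated fieldᴷ q frobenius-+

  frobenius^-· : ∀ d a x → (a · x) ^ (q ℕ.^ d) K.≈ a · (x ^ (q ℕ.^ d))
  frobenius^-· zero    a x = K.trans (K.*-identityʳ _) (·-cong a (K.sym (K.*-identityʳ x)))
  frobenius^-· (suc d) a x = begin
    (a · x) ^ (q ℕ.* q ℕ.^ d)      ≈⟨ ^-assocʳ (a · x) q (q ℕ.^ d) ⟨
    ((a · x) ^ q) ^ (q ℕ.^ d)      ≈⟨ ^-congˡ (q ℕ.^ d) (frobenius-· a x) ⟩
    (a · (x ^ q)) ^ (q ℕ.^ d)      ≈⟨ frobenius^-· d a (x ^ q) ⟩
    a · ((x ^ q) ^ (q ℕ.^ d))      ≈⟨ ·-cong a (^-assocʳ x q (q ℕ.^ d)) ⟩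
    a · (x ^ (q ℕ.* q ℕ.^ d))      ∎

  -- The q-polynomial Σ a_j y^(q^(s-1-j)), with the highest power first so that recursion peels off
  -- the leading coefficient.
  linearized : ∀ s → (Fin s → K.Carrier) → K.Carrier → K.Carrier
  linearized zero    a y = K.0#
  linearized (suc s) a y = a zero K.* y ^ (q ℕ.^ s) K.+ linearized s (a ∘ suc) y

  linearized-cong : ∀ s {a b x y} → (∀ j → a j K.≈ b j) → x K.≈ y → linearized s a x K.≈ linearized s b y
  linearized-cong zero    a≈b x≈y = K.refl
  linearized-cong (suc s) a≈b x≈y =
    K.+-cong (K.*-cong (a≈b zero) (^-congˡ (q ℕ.^ s) x≈y)) (linearized-cong s (a≈b ∘ suc) x≈y)

  +-interchange : ∀ x y z w → (x K.+ y) K.+ (z K.+ w) K.≈ (x K.+ z) K.+ (y K.+ w)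
  +-interchange = solve 4 (λ x y z w → (x :+ y) :+ (z :+ w) := (x :+ z) :+ (y :+ w)) K.refl
    where open Solver K.commutativeSemiring using (solve; _:+_; _:=_)

  linearized-+ : ∀ s a x y → linearized s a (x K.+ y) K.≈ linearized s a x K.+ linearized s a y
  linearized-+ zero    a x y = K.sym (K.+-identityˡ K.0#)
  linearized-+ (suc s) a x y = K.trans
    (K.+-cong (K.trans (K.*-congˡ (frobenius^-+ s x y)) (K.distribˡ _ _ _)) (linearized-+ s (a ∘ suc) x y))
    (+-interchange _ _ _ _)

  linearized-· : ∀ s a c x → linearized s a (c · x) K.≈ c · linearized s a x
  linearized-· zero    a c x = K.sym (·-zeroʳ c)
  linearized-· (suc s) a c x = K.trans
    (K.+-cong (K.trans (K.*-congˡ (frobenius^-· s c x)) (*-· c _ _)) (linearized-· s (a ∘ suc) c x))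
    (K.sym (·-distribˡ c _ _))

  linearized-+ˡ : ∀ s a b x → linearized s (λ j → a j K.+ b j) x K.≈ linearized s a x K.+ linearized s b x
  linearized-+ˡ zero    a b x = K.sym (K.+-identityˡ K.0#)
  linearized-+ˡ (suc s) a b x = K.trans
    (K.+-cong (K.distribʳ _ _ _) (linearized-+ˡ s (a ∘ suc) (b ∘ suc) x)) (+-interchange _ _ _ _)

  linearized-·ˡ : ∀ s c a x → linearized s (λ j → c · a j) x K.≈ c · linearized s a x
  linearized-·ˡ zero    c a x = K.sym (·-zeroʳ c)
  linearized-·ˡ (suc s) c a x = K.trans
    (K.+-cong (·-* c _ _) (linearized-·ˡ s c (a ∘ suc) x)) (K.sym (·-distribˡ c _ _))

  linearized-below : ∀ s a → PolyBelow (q ℕ.^ s) (linearized s a)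
  linearized-below zero    a = zero-poly 1
  linearized-below (suc s) a = add-poly (monomial-below (a zero) (ℕ.^-monoʳ-< q 2≤q (ℕ.n<1+n s)))
    (weaken-poly (ℕ.^-monoʳ-≤ q {{ℕ.>-nonZero (ℕ.≤-trans (s≤s z≤n) 2≤q)}} (ℕ.n≤1+n s)) (linearized-below s (a ∘ suc)))

  -- Once leading zero coefficients are stripped, the degree is a power q^e with e < s, and it
  -- bounds the number q^t of roots.
  linearized-roots : ∀ s a → ¬ (∀ j → a j K.≈ K.0#) → ∀ {t} (r : Fin (q ℕ.^ t) → K.Carrier) →
    (∀ {i j} → r i K.≈ r j → i ≡ j) → (∀ i → linearized s a (r i) K.≈ K.0#) → t ℕ.< s
  linearized-roots zero    a a≉0 r r-inj vanish = contradiction (λ ()) a≉0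
  linearized-roots (suc s) a a≉0 {t} r r-inj vanish with ≈0? (a zero)
  ... | no  a₀≉0 = s≤s (q^-cancel-≤ (roots-bound (linearized-below s (a ∘ suc)) a₀≉0 r r-inj vanish))
  ... | yes a₀≈0 = ℕ.m<n⇒m<1+n (linearized-roots s (a ∘ suc)
        (λ a≈0 → a≉0 λ { zero → a₀≈0 ; (suc j) → a≈0 j }) {t} r r-inj
        (λ i → K.trans (K.sym (K.trans (K.+-congʳ (K.trans (K.*-congʳ a₀≈0) (K.zeroˡ _))) (K.+-identityˡ _))) (vanish i)))

  module Code {k : ℕ} (k≤N : k ℕ.≤ N) (s : ℕ) where

    -- As `k ≤ N`, this makes `point` send the unit vectors to k elements of K independent over F:
    -- the evaluation points of the code.
    pad : (Fin k → 𝔽) → Fin N → 𝔽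
    pad v = lc v (λ r → δ (Fin.inject≤ r k≤N))

    pad-injective : ∀ {u v} → pad u ≋ pad v → u ≋ v
    pad-injective {u} {v} eq r = ≡.trans (≡.sym (pad-inject u)) (≡.trans (eq _) (pad-inject v))
      where
      pad-inject : ∀ v → pad v (Fin.inject≤ r k≤N) ≡ v r
      pad-inject v = ≡.trans
        (∑-single _ r (λ j j≢r → ≡.trans (cong (v j *_) (δ-off (j≢r ∘ Fin.inject≤-injective k≤N k≤N j r))) (zeroʳ (v j))))
        (≡.trans (cong (v r *_) (δ-diag (Fin.inject≤ r k≤N))) (*-identityʳ (v r)))

    point : (Fin k → 𝔽) → K.Carrier
    point v = fromCoords (pad v)

    coefficients : (Fin (N ℕ.* s) → 𝔽) → Fin s → K.Carrier
    coefficients c j = fromCoords (λ i → c (Fin.combine i j))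

    value : (Fin (N ℕ.* s) → 𝔽) → (Fin k → 𝔽) → Fin N → 𝔽
    value c v = coords (linearized s (coefficients c) (point v))

    value-linear : ∀ c → IsLinear (value c)
    value-linear c = record
      { T-cong = λ {u} {v} u≋v → coords-cong (linearized-cong s (λ _ → K.refl) (fromCoords-cong (T-cong pad-linear {u} {v} u≋v)))
      ; T-⊕ = λ u v → ≋-trans (coords-cong (K.trans
          (linearized-cong s (λ _ → K.refl) (K.trans (fromCoords-cong (T-⊕ pad-linear u v)) (fromCoords-⊕ (pad u) (pad v))))
          (linearized-+ s (coefficients c) (point u) (point v)))) (coords-+ _ _)
      ; T-⊙ = λ a u → ≋-trans (coords-cong (K.trans
          (linearized-cong s (λ _ → K.refl) (K.trans (fromCoords-cong (T-⊙ pad-linear a u)) (fromCoords-⊙ a (pad u))))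
          (linearized-· s (coefficients c) a (point u)))) (coords-· a _) }
      where
      pad-linear : IsLinear pad
      pad-linear = lc-linear (λ r → δ (Fin.inject≤ r k≤N))

    encode : (Fin (N ℕ.* s) → 𝔽) → Mat F k N
    encode c (r , l) = value c (δ r) l

    encode-linear : IsLinear encode
    encode-linear = record
      { T-cong = λ c≋c′ (r , l) → coords-cong (linearized-cong s (λ j → fromCoords-cong (λ i → c≋c′ (Fin.combine i j))) K.refl) l
      ; T-⊕ = λ c c′ (r , l) → ≡.trans (coords-cong (K.trans
          (linearized-cong s (λ j → fromCoords-⊕ _ _) K.refl) (linearized-+ˡ s (coefficients c) (coefficients c′) (point (δ r)))) l)
          (coords-+ _ _ l)
      ; T-⊙ = λ a c (r , l) → ≡.trans (coords-cong (K.trans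
          (linearized-cong s (λ j → fromCoords-⊙ a _) K.refl) (linearized-·ˡ s a (coefficients c) (point (δ r)))) l)
          (coords-· a _ l) }

    -- A row vector times `encode c` is the value of the q-polynomial at the corresponding point, so
    -- `t` independent left kernel vectors yield q^t roots. For s = k - d + 1 this means rank at
    -- least d.
    encode-kernel : ∀ c → ¬ (c ≋ 𝟘 F) → ∀ {t} (z : Fin t → Fin k → 𝔽) → LinIndep F z →
                    (∀ j → lc (z j) (row F (encode c)) ≋ 𝟘 F) → t ℕ.< s
    encode-kernel c c≉0 {t} z z-ind z∈ker = linearized-roots s (coefficients c) coefficients≉0 {t} root root-injective root-vanish
      where
      root : Fin (q ℕ.^ t) → K.Carrier
      root τ = point (lc (vec τ) z)
      root-injective : ∀ {i j} → root i K.≈ root j → i ≡ j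
      root-injective {i} {j} eq = vec-injective {t} (indep-injective z-ind (pad-injective (fromCoords-injective eq)))
      coefficients≉0 : ¬ (∀ j → coefficients c j K.≈ K.0#)
      coefficients≉0 a≈0 = c≉0 λ x → vanish x (Fin.combine-surjective {N} {s} x)
        where
        vanish : ∀ x → (∃ λ i → ∃ λ j → Fin.combine i j ≡ x) → c x ≡ 0#
        vanish x (i , j , refl) = ≡.trans (≡.sym (coords-fromCoords (λ i → c (Fin.combine i j)) i))
          (≡.trans (coords-cong (K.trans (a≈0 j) (K.sym fromCoords-0)) i) (coords-fromCoords (𝟘 F) i))
          where
          fromCoords-0 : fromCoords (𝟘 F) K.≈ K.0#
          fromCoords-0 = coords-injective (≋-trans (coords-fromCoords (𝟘 F)) (≋-sym coords-0))
      root-vanish : ∀ i → linearized s (coefficients c) (root i) K.≈ K.0#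
      root-vanish i = coords-injective λ l → ≡.trans (value-0 l) (≡.sym (coords-0 l))
        where
        value-0 : value c (lc (vec i) z) ≋ 𝟘 F
        value-0 = ≋-trans (T-lc (value-linear c) (vec i) z)
          (lc-𝟘ʳ (vec i) (λ j → ≋-trans (linear-on-δ (value-linear c) (z j)) (z∈ker j)))

-- Row spaces and their intersections

module Codewords {q : ℕ} (F : FiniteField q) {n k d : ℕ} (d≤k : d ℕ.≤ k) where
  open LinearAlgebra F
  open import Data.Nat using () renaming (_+_ to _+ℕ_; _∸_ to _∸ℕ_; _≤_ to _≤ℕ_; _<_ to _<ℕ_)

  N : ℕ
  N = n ∸ℕ k

  -- Which columns of a k × n generator matrix carry the identity block (in order), and which the k × (n − k) matrix.
  record Layout : Set where
    field
      classify : Fin n → Fin k ⊎ Fin N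
      pivot    : Fin k → Fin n
      free     : Fin N → Fin n
      classify-pivot : ∀ r → classify (pivot r) ≡ inj₁ r
      classify-free  : ∀ s → classify (free s) ≡ inj₂ s

    generator : Mat F k N → Fin k → Fin n → 𝔽
    generator A r c = [ δ r , (λ s → A (r , s)) ]′ (classify c)

    codeword : Mat F k N → Subspace F (Fin n)
    codeword A = span (generator A)

    read-pivot : ∀ A y r → lc y (generator A) (pivot r) ≡ y r
    read-pivot A y r = ≡.trans (∑-cong k (λ j → cong (λ x → y j * [ δ j , (λ s → A (j , s)) ]′ x) (classify-pivot r)))
                               (lc-δʳ y r)

    read-free : ∀ A y s → lc y (generator A) (free s) ≡ lc y (row F A) s
    read-free A y s = ∑-cong k (λ j → cong (λ x → y j * [ δ j , (λ s → A (j , s)) ]′ x) (classify-free s))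

    generator-indep : ∀ A → LinIndep F (generator A)
    generator-indep A y eq r = ≡.trans (≡.sym (read-pivot A y r)) (eq (pivot r))

    codeword-dim : ∀ A → HasDim F (mem (codeword A)) k
    codeword-dim A = indep⇒dim (generator-indep A)

    vanish-on-pivots : ∀ A {v} → mem (codeword A) v → (∀ r → v (pivot r) ≡ 0#) → v ≋ 𝟘 F
    vanish-on-pivots A {v} (y , eq) v≡0 = ≋-trans eq (lc-𝟘 (generator A)
      (λ r → ≡.trans (≡.sym (read-pivot A y r)) (≡.trans (≡.sym (eq (pivot r))) (v≡0 r))))

  open Layout

  -- The bound dim(U ∩ W) ≤ k - d, tested on independent families so that it can be proved without
  -- choosing a basis; `Far` adds the actual dimension, which the subspace distance requires.
  Bounded : Subspace F (Fin n) → Subspace F (Fin n) → Set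
  Bounded U W = ∀ c (z : Fin c → Fin n → 𝔽) → LinIndep F z → (∀ j → mem U (z j)) → (∀ j → mem W (z j)) → c +ℕ d ≤ℕ k

  Far : Subspace F (Fin n) → Subspace F (Fin n) → Set
  Far U W = ∃ λ c → HasDim F (_∩_ F U W) c × c +ℕ d ≤ℕ k

  meet : Subspace F (Fin n) → Subspace F (Fin n) → Subspace F (Fin n)
  meet U W = record
    { mem   = _∩_ F U W
    ; resp  = λ eq (u , w) → resp U eq u , resp W eq w
    ; zero∈ = zero∈ U , zero∈ W
    ; +∈    = λ (u , w) (u′ , w′) → +∈ U u u′ , +∈ W w w′
    ; ·∈    = λ a (u , w) → ·∈ U a u , ·∈ W a w
    }

  bounded⇒far : ∀ L A L′ A′ → Bounded (codeword L A) (codeword L′ A′) → Far (codeword L A) (codeword L′ A′)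
  bounded⇒far L A L′ A′ bounded with dim-exists (meet (codeword L A) (codeword L′ A′))
    (λ v → InSpan? (generator L A) v ×-dec InSpan? (generator L′ A′) v)
  ... | c , dim@(z , ind , _) = c , dim , bounded c z ind (proj₁ ∘ z∈) (proj₂ ∘ z∈)
    where z∈ = basis∈ {P = _∩_ F (codeword L A) (codeword L′ A′)} dim

  far-sym : ∀ {U W} → Far U W → Far W U
  far-sym {U} {W} (c , dim , bound) = c , HasDim-resp (λ _ (u , w) → w , u) (λ _ (w , u) → u , w) dim , bound

  -- rank A ≥ d, phrased through the left kernel so that no basis has to be chosen.
  KernelBound : Mat F k N → Set
  KernelBound A = ∀ c (z : Fin c → Fin k → 𝔽) → LinIndep F z → (∀ j → lc (z j) (row F A) ≋ 𝟘 F) → c +ℕ d ≤ℕ k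

  rank⇒kernelBound : ∀ {A r} → RankIs F A r → d ≤ℕ r → KernelBound A
  rank⇒kernelBound {A} {r} rank d≤r c z ind z∈ker =
    ℕ.≤-trans (ℕ.+-monoʳ-≤ c d≤r) (rank+nullity-≤ (row F A) ind z∈ker rank)

  kernelBound⇒rank : ∀ {A} → KernelBound A → ∃ λ r → RankIs F A r × d ≤ℕ r
  kernelBound⇒rank {A} bound with rank-exists (row F A)
    | dim-exists (kernel (lc-linear (row F A))) (λ y → ≋? (lc y (row F A)) (𝟘 F))
  ... | r , rank | c , null@(z , ind , _) = r , rank , ℕ.+-cancelˡ-≤ c _ _ (ℕ.≤-trans
        (bound c z ind (basis∈ {P = λ y → lc y (row F A) ≋ 𝟘 F} null)) (rank+nullity-≥ (row F A) null rank))

  row-⊖ : ∀ (A A′ : Mat F k N) y → lc y (row F (_⊖_ F A A′)) ≋ _⊖_ F (lc y (row F A)) (lc y (row F A′))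
  row-⊖ A A′ y s = begin
    ∑ k (λ r → y r * (A (r , s) + - A′ (r , s)))               ≡⟨ ∑-cong k (λ r → distribˡ (y r) _ _) ⟩
    ∑ k (λ r → y r * A (r , s) + y r * - A′ (r , s))           ≡⟨ ∑-+ k _ (λ r → y r * - A′ (r , s)) ⟩
    lc y (row F A) s + ∑ k (λ r → y r * - A′ (r , s))          ≡⟨ cong (lc y (row F A) s +_) negate ⟩
    lc y (row F A) s + - lc y (row F A′) s                     ∎
    where
    open ≡-Reasoning
    negate : ∑ k (λ r → y r * - A′ (r , s)) ≡ - ∑ k (λ r → y r * A′ (r , s))
    negate = begin
      ∑ k (λ r → y r * - A′ (r , s))            ≡⟨ ∑-cong k (λ r → ≡.trans (≡.sym (-‿distribʳ-* (y r) _)) (≡.sym (-1*x≈-x _))) ⟩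
      ∑ k (λ r → - 1# * (y r * A′ (r , s)))     ≡⟨ ∑-*ˡ k (- 1#) (λ r → y r * A′ (r , s)) ⟩
      - 1# * ∑ k (λ r → y r * A′ (r , s))       ≡⟨ -1*x≈-x _ ⟩
      - ∑ k (λ r → y r * A′ (r , s))            ∎
      where open RingProperties ring using (-1*x≈-x)

  -- The common pivots show that a common vector has the same coefficients `y` over both generators;
  -- comparing the free columns puts `y` into the left kernel of the difference.
  same-layout-bounded : ∀ L A A′ → KernelBound (_⊖_ F A A′) → Bounded (codeword L A) (codeword L A′)
  same-layout-bounded L A A′ bound c z ind z∈ z∈′ = bound c y y-ind y∈ker
    where
    y = λ j → proj₁ (z∈ j)
    y≋y′ : ∀ j → y j ≋ proj₁ (z∈′ j)
    y≋y′ j r = begin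
      y j r                                        ≡⟨ read-pivot L A (y j) r ⟨
      lc (y j) (generator L A) (pivot L r)         ≡⟨ proj₂ (z∈ j) (pivot L r) ⟨
      z j (pivot L r)                              ≡⟨ proj₂ (z∈′ j) (pivot L r) ⟩
      lc _ (generator L A′) (pivot L r)            ≡⟨ read-pivot L A′ _ r ⟩
      proj₁ (z∈′ j) r                              ∎
      where open ≡-Reasoning
    y-ind : LinIndep F y
    y-ind u eq = ind u (≋-trans (lc-congʳ u (λ j → proj₂ (z∈ j)))
      (≋-trans (lc-lc u y (generator L A)) (lc-𝟘 (generator L A) eq)))
    y∈ker : ∀ j → lc (y j) (row F (_⊖_ F A A′)) ≋ 𝟘 F
    y∈ker j = ≋-trans (row-⊖ A A′ (y j)) (≋⇒⊖≋𝟘 {u = lc (y j) (row F A)} λ s → begin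
      lc (y j) (row F A) s                         ≡⟨ read-free L A (y j) s ⟨
      lc (y j) (generator L A) (free L s)          ≡⟨ proj₂ (z∈ j) (free L s) ⟨
      z j (free L s)                               ≡⟨ proj₂ (z∈′ j) (free L s) ⟩
      lc _ (generator L A′) (free L s)             ≡⟨ read-free L A′ _ s ⟩
      lc _ (row F A′) s                            ≡⟨ lc-congˡ (row F A′) (y≋y′ j) s ⟨
      lc (y j) (row F A′) s                        ∎)
      where open ≡-Reasoning

  -- Bounding dim(U ∩ W) thus becomes a search for columns that determine a common vector and whose
  -- restrictions lie in a small space.
  restriction-indep : ∀ {U W : Subspace F (Fin n)} {J : Set} (f : J → Fin n) →
    (∀ v → mem U v → mem W v → (v ∘ f) ≋ 𝟘 F → v ≋ 𝟘 F) →
    ∀ {c} {z : Fin c → Fin n → 𝔽} → LinIndep F z → (∀ j → mem U (z j)) → (∀ j → mem W (z j)) →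
    LinIndep F (λ j → z j ∘ f)
  restriction-indep {U} {W} f inj {z = z} ind z∈U z∈W u eq =
    ind u (inj (lc u z) (lc∈ U u z z∈U) (lc∈ W u z z∈W) eq)

  -- For 0 ≤ e ≤ k, the pivots are the first k + d columns except columns k − e, …, k − e + d − 1,
  -- which carry the first d columns of the matrix.
  module Shifted (2k+d≤n : k +ℕ k +ℕ d ≤ℕ n) where

    k+d≤N : k +ℕ d ≤ℕ N
    k+d≤N = ℕ.≤-trans (ℕ.≤-reflexive (≡.sym (≡.trans (cong (_∸ℕ k) (ℕ.+-assoc k k d)) (ℕ.m+n∸m≡n k (k +ℕ d))))) (ℕ.∸-monoˡ-≤ k 2k+d≤n)

    k≤n : k ≤ℕ n
    k≤n = ℕ.≤-trans (ℕ.≤-trans (ℕ.m≤m+n k k) (ℕ.m≤m+n (k +ℕ k) d)) 2k+d≤n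

    k+N≡n : k +ℕ N ≡ n
    k+N≡n = ℕ.m+[n∸m]≡n k≤n

    k≤N : k ≤ℕ N
    k≤N = ℕ.≤-trans (ℕ.m≤m+n k d) k+d≤N

    d≤N : d ≤ℕ N
    d≤N = ℕ.≤-trans (ℕ.m≤n+m d k) k+d≤N

    k+d≤n : k +ℕ d ≤ℕ n
    k+d≤n = ℕ.≤-trans k+d≤N (ℕ.m∸n≤m n k)

    ∸-<ʳ : ∀ {a b c} → b ≤ℕ a → a <ℕ b +ℕ c → a ∸ℕ b <ℕ c
    ∸-<ʳ {a} {b} {c} b≤a a<b+c = ℕ.+-cancelˡ-< b _ _ (ℕ.≤-trans (ℕ.≤-reflexive (cong suc (ℕ.m+[n∸m]≡n b≤a))) a<b+c)

    module _ (e : ℕ) where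

      gap : ℕ
      gap = k ∸ℕ e

      gap≤k : gap ≤ℕ k
      gap≤k = ℕ.m∸n≤m k e

      classifyₑ : Fin n → Fin k ⊎ Fin N
      classifyₑ c with toℕ c ℕ.<? gap | toℕ c ℕ.<? gap +ℕ d | toℕ c ℕ.<? k +ℕ d
      ... | yes c<  | _      | _     = inj₁ (fromℕ< (ℕ.<-≤-trans c< gap≤k))
      ... | no  c≮  | yes c< | _     = inj₂ (fromℕ< {toℕ c ∸ℕ gap} (ℕ.<-≤-trans (∸-<ʳ (ℕ.≮⇒≥ c≮) c<) d≤N))
      ... | no  _   | no c≮  | yes c< = inj₁ (fromℕ< {toℕ c ∸ℕ d}
                                          (∸-<ʳ (ℕ.≤-trans (ℕ.m≤n+m d gap) (ℕ.≮⇒≥ c≮)) (subst (toℕ c <ℕ_) (ℕ.+-comm k d) c<)))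
      ... | no  _   | no _   | no c≮  = inj₂ (fromℕ< {toℕ c ∸ℕ k}
                                          (∸-<ʳ (ℕ.≤-trans (ℕ.m≤m+n k d) (ℕ.≮⇒≥ c≮)) (subst (toℕ c <ℕ_) (≡.sym k+N≡n) (Fin.toℕ<n c))))

      classify-top : ∀ c r → toℕ c <ℕ gap → toℕ c ≡ toℕ r → classifyₑ c ≡ inj₁ r
      classify-top c r c< eq with toℕ c ℕ.<? gap | toℕ c ℕ.<? gap +ℕ d | toℕ c ℕ.<? k +ℕ d
      ... | yes _  | _ | _ = cong inj₁ (Fin.toℕ-injective (≡.trans (Fin.toℕ-fromℕ< _) eq))
      ... | no  c≮ | _ | _ = contradiction c< c≮

      classify-gap : ∀ c s → toℕ s <ℕ d → toℕ c ≡ gap +ℕ toℕ s → classifyₑ c ≡ inj₂ s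
      classify-gap c s s<d eq with toℕ c ℕ.<? gap | toℕ c ℕ.<? gap +ℕ d | toℕ c ℕ.<? k +ℕ d
      ... | yes c< | _      | _ = contradiction c< (ℕ.≤⇒≯ (ℕ.≤-trans (ℕ.m≤m+n gap (toℕ s)) (ℕ.≤-reflexive (≡.sym eq))))
      ... | no  _  | yes _  | _ = cong inj₂ (Fin.toℕ-injective (≡.trans (Fin.toℕ-fromℕ< _)
                                    (≡.trans (cong (_∸ℕ gap) eq) (ℕ.m+n∸m≡n gap (toℕ s)))))
      ... | no  _  | no  c≮ | _ = contradiction (ℕ.≤-<-trans (ℕ.≤-reflexive eq) (ℕ.+-monoʳ-< gap s<d)) c≮

      classify-bottom : ∀ c r → gap ≤ℕ toℕ r → toℕ c ≡ toℕ r +ℕ d → classifyₑ c ≡ inj₁ r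
      classify-bottom c r gap≤r eq with toℕ c ℕ.<? gap | toℕ c ℕ.<? gap +ℕ d | toℕ c ℕ.<? k +ℕ d
      ... | yes c< | _      | _ = contradiction c< (ℕ.≤⇒≯ (ℕ.≤-trans (ℕ.≤-trans gap≤r (ℕ.m≤m+n _ d)) (ℕ.≤-reflexive (≡.sym eq))))
      ... | no  _  | yes c< | _ = contradiction c< (ℕ.≤⇒≯ (ℕ.≤-trans (ℕ.+-monoˡ-≤ d gap≤r) (ℕ.≤-reflexive (≡.sym eq))))
      ... | no  _  | no  _  | yes _ = cong inj₁ (Fin.toℕ-injective (≡.trans (Fin.toℕ-fromℕ< _)
                                        (≡.trans (cong (_∸ℕ d) eq) (ℕ.m+n∸n≡m (toℕ r) d))))
      ... | no  _  | no  _  | no c≮ = contradiction (ℕ.≤-<-trans (ℕ.≤-reflexive eq) (ℕ.+-monoˡ-< d (Fin.toℕ<n r))) c≮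

      classify-rest : ∀ c s → d ≤ℕ toℕ s → toℕ c ≡ k +ℕ toℕ s → classifyₑ c ≡ inj₂ s
      classify-rest c s d≤s eq with toℕ c ℕ.<? gap | toℕ c ℕ.<? gap +ℕ d | toℕ c ℕ.<? k +ℕ d
      ... | no  _  | no  _  | no _ = cong inj₂ (Fin.toℕ-injective (≡.trans (Fin.toℕ-fromℕ< _)
                                       (≡.trans (cong (_∸ℕ k) eq) (ℕ.m+n∸m≡n k (toℕ s)))))
      ... | yes c< | _      | _ = contradiction (ℕ.<-≤-trans c< (ℕ.≤-trans gap≤k (ℕ.≤-trans (ℕ.m≤m+n k _) (ℕ.≤-reflexive (≡.sym eq))))) (ℕ.<-irrefl refl)
      ... | no  _  | yes c< | _ = contradiction c< (ℕ.≤⇒≯ (ℕ.≤-trans (ℕ.+-mono-≤ gap≤k d≤s) (ℕ.≤-reflexive (≡.sym eq))))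
      ... | no  _  | no  _  | yes c< = contradiction c< (ℕ.≤⇒≯ (ℕ.≤-trans (ℕ.+-monoʳ-≤ k d≤s) (ℕ.≤-reflexive (≡.sym eq))))

      pivotₑ : Fin k → Fin n
      pivotₑ r with toℕ r ℕ.<? gap
      ... | yes _ = fromℕ< (ℕ.<-≤-trans (Fin.toℕ<n r) k≤n)
      ... | no  _ = fromℕ< (ℕ.<-≤-trans (ℕ.+-monoˡ-< d (Fin.toℕ<n r)) k+d≤n)

      freeₑ : Fin N → Fin n
      freeₑ s with toℕ s ℕ.<? d
      ... | yes s< = fromℕ< (ℕ.<-≤-trans (ℕ.+-mono-≤-< gap≤k s<) k+d≤n)
      ... | no  _  = fromℕ< (ℕ.<-≤-trans (ℕ.+-monoʳ-< k (Fin.toℕ<n s)) (ℕ.≤-reflexive k+N≡n))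

      pivot-top : ∀ r → toℕ r <ℕ gap → toℕ (pivotₑ r) ≡ toℕ r
      pivot-top r r< with toℕ r ℕ.<? gap
      ... | yes _  = Fin.toℕ-fromℕ< _
      ... | no  r≮ = contradiction r< r≮

      pivot<k+d : ∀ r → toℕ (pivotₑ r) <ℕ k +ℕ d
      pivot<k+d r with toℕ r ℕ.<? gap
      ... | yes _ = ℕ.≤-trans (ℕ.≤-reflexive (cong suc (Fin.toℕ-fromℕ< _))) (ℕ.≤-trans (Fin.toℕ<n r) (ℕ.m≤m+n k d))
      ... | no  _ = ℕ.≤-trans (ℕ.≤-reflexive (cong suc (Fin.toℕ-fromℕ< _))) (ℕ.+-monoˡ-< d (Fin.toℕ<n r))

      free-gap : ∀ s → toℕ s <ℕ d → toℕ (freeₑ s) ≡ gap +ℕ toℕ s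
      free-gap s s< with toℕ s ℕ.<? d
      ... | yes _  = Fin.toℕ-fromℕ< _
      ... | no  s≮ = contradiction s< s≮

      layout : Layout
      layout = record
        { classify = classifyₑ ; pivot = pivotₑ ; free = freeₑ
        ; classify-pivot = classify-pivotₑ ; classify-free = classify-freeₑ }
        where
        classify-pivotₑ : ∀ r → classifyₑ (pivotₑ r) ≡ inj₁ r
        classify-pivotₑ r with toℕ r ℕ.<? gap
        ... | yes r< = classify-top _ r (subst (_<ℕ gap) (≡.sym (Fin.toℕ-fromℕ< _)) r<) (Fin.toℕ-fromℕ< _)
        ... | no  r≮ = classify-bottom _ r (ℕ.≮⇒≥ r≮) (Fin.toℕ-fromℕ< _)
        classify-freeₑ : ∀ s → classifyₑ (freeₑ s) ≡ inj₂ s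
        classify-freeₑ s with toℕ s ℕ.<? d
        ... | yes s< = classify-gap _ s s< (Fin.toℕ-fromℕ< _)
        ... | no  s≮ = classify-rest _ s (ℕ.≮⇒≥ s≮) (Fin.toℕ-fromℕ< _)

    FreeOfGap : ℕ → Mat F k N → Set
    FreeOfGap e A = ∀ r s → gap e ≤ℕ toℕ r → toℕ s <ℕ d → A (r , s) ≡ 0#

    -- On an intersection, the pivots of the first word that lie in the gap columns of the second one are determined by
    -- the remaining k − d pivots: there the second word is a combination of its top rows only.
    shifted-bounded : ∀ e e′ A B → e +ℕ d ≤ℕ e′ → e′ ≤ℕ k → FreeOfGap e′ B →
                      Bounded (codeword (layout e) A) (codeword (layout e′) B)
    shifted-bounded e e′ A B e+d≤e′ e′≤k B-free c z ind z∈U z∈W =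
      ℕ.≤-trans (ℕ.+-monoˡ-≤ d (indep⇒≤ {b = λ j → z j ∘ pivotₑ e ∘ skip}
        (restriction-indep {codeword (layout e) A} {codeword (layout e′) B} (pivotₑ e ∘ skip) vanish ind z∈U z∈W)))
        (ℕ.≤-reflexive (ℕ.m∸n+n≡m d≤k))
      where
      d≤e′ : d ≤ℕ e′
      d≤e′ = ℕ.≤-trans (ℕ.m≤n+m d e) e+d≤e′
      -- The gap of `e′` lies to the left of that of `e`, so in layout `e` its columns are the
      -- pivots of the equally numbered rows.
      gap′+d≤gap : gap e′ +ℕ d ≤ℕ gap e
      gap′+d≤gap = ℕ.m+n≤o⇒m≤o∸n (gap e′ +ℕ d) (begin
        gap e′ +ℕ d +ℕ e     ≡⟨ ≡.trans (ℕ.+-assoc (gap e′) d e) (cong (gap e′ +ℕ_) (ℕ.+-comm d e)) ⟩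
        gap e′ +ℕ (e +ℕ d)   ≤⟨ ℕ.+-monoʳ-≤ (gap e′) e+d≤e′ ⟩
        gap e′ +ℕ e′         ≡⟨ ℕ.m∸n+n≡m e′≤k ⟩
        k                    ∎)
        where open ℕ.≤-Reasoning
      gap′≤k∸d : gap e′ ≤ℕ k ∸ℕ d
      gap′≤k∸d = ℕ.∸-monoʳ-≤ k d≤e′

      -- Enumerates the rows whose pivots in layout `e` avoid the gap columns of layout `e′`.
      skip : Fin (k ∸ℕ d) → Fin k
      skip r with toℕ r ℕ.<? gap e′
      ... | yes _ = fromℕ< (ℕ.<-≤-trans (Fin.toℕ<n r) (ℕ.m∸n≤m k d))
      ... | no  _ = fromℕ< {toℕ r +ℕ d} (ℕ.<-≤-trans (ℕ.+-monoˡ-< d (Fin.toℕ<n r)) (ℕ.≤-reflexive (ℕ.m∸n+n≡m d≤k)))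

      skip-top : ∀ r → toℕ r <ℕ gap e′ → ∃ λ r′ → skip r′ ≡ r
      skip-top r r< = r′ , Fin.toℕ-injective skipped
        where
        r′ = fromℕ< (ℕ.<-≤-trans r< gap′≤k∸d)
        toℕ-r′ : toℕ r′ ≡ toℕ r
        toℕ-r′ = Fin.toℕ-fromℕ< (ℕ.<-≤-trans r< gap′≤k∸d)
        skipped : toℕ (skip r′) ≡ toℕ r
        skipped with toℕ r′ ℕ.<? gap e′
        ... | yes _   = ≡.trans (Fin.toℕ-fromℕ< _) toℕ-r′
        ... | no  r′≮ = contradiction (subst (_<ℕ gap e′) (≡.sym toℕ-r′) r<) r′≮

      skip-bottom : ∀ r → gap e′ +ℕ d ≤ℕ toℕ r → ∃ λ r′ → skip r′ ≡ r
      skip-bottom r ≤r = r′ , Fin.toℕ-injective skipped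
        where
        d≤r : d ≤ℕ toℕ r
        d≤r = ℕ.≤-trans (ℕ.m≤n+m d (gap e′)) ≤r
        r∸d< : toℕ r ∸ℕ d <ℕ k ∸ℕ d
        r∸d< = ℕ.∸-monoˡ-< (Fin.toℕ<n r) d≤r
        r′ = fromℕ< r∸d<
        skipped : toℕ (skip r′) ≡ toℕ r
        skipped with toℕ r′ ℕ.<? gap e′
        ... | yes r′< = contradiction (subst (_<ℕ gap e′) (Fin.toℕ-fromℕ< r∸d<) r′<)
                          (ℕ.≤⇒≯ (ℕ.m+n≤o⇒m≤o∸n (gap e′) ≤r))
        ... | no  _   = ≡.trans (Fin.toℕ-fromℕ< _) (≡.trans (cong (_+ℕ d) (Fin.toℕ-fromℕ< r∸d<)) (ℕ.m∸n+n≡m d≤r))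

      vanish : ∀ v → mem (codeword (layout e) A) v → mem (codeword (layout e′) B) v →
               (v ∘ pivotₑ e ∘ skip) ≋ 𝟘 F → v ≋ 𝟘 F
      vanish v v∈U (y , v≋) restricted≋0 = vanish-on-pivots (layout e) A v∈U pivots≡0
        where
        skipped : ∀ {r} → (∃ λ r′ → skip r′ ≡ r) → v (pivotₑ e r) ≡ 0#
        skipped (r′ , refl) = restricted≋0 r′
        -- To the left of both gaps row `r` has its pivot in column `r` in either layout.
        top : ∀ r → toℕ r <ℕ gap e′ → y r ≡ 0#
        top r r< = begin
          y r                                                ≡⟨ read-pivot (layout e′) B y r ⟨
          lc y (generator (layout e′) B) (pivotₑ e′ r)       ≡⟨ v≋ (pivotₑ e′ r) ⟨
          v (pivotₑ e′ r)                                    ≡⟨ cong v (Fin.toℕ-injective (≡.trans (pivot-top e′ r r<)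
                                                                  (≡.sym (pivot-top e r (ℕ.<-≤-trans r< (ℕ.m+n≤o⇒m≤o _ gap′+d≤gap)))))) ⟩
          v (pivotₑ e r)                                     ≡⟨ skipped (skip-top r r<) ⟩
          0#                                                 ∎
          where open ≡-Reasoning
        in-gap : ∀ s → toℕ s <ℕ d → v (freeₑ e′ s) ≡ 0#
        in-gap s s< = begin
          v (freeₑ e′ s)                                     ≡⟨ v≋ (freeₑ e′ s) ⟩
          lc y (generator (layout e′) B) (freeₑ e′ s)        ≡⟨ read-free (layout e′) B y s ⟩
          ∑ k (λ r → y r * B (r , s))                        ≡⟨ ∑-0 k term ⟩
          0#                                                 ∎
          where
          open ≡-Reasoning
          term : ∀ r → y r * B (r , s) ≡ 0#
          term r with toℕ r ℕ.<? gap e′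
          ... | yes r< = ≡.trans (cong (_* B (r , s)) (top r r<)) (zeroˡ _)
          ... | no  r≮ = ≡.trans (cong (y r *_) (B-free r s (ℕ.≮⇒≥ r≮) s<)) (zeroʳ _)
        pivots≡0 : ∀ r → v (pivotₑ e r) ≡ 0#
        pivots≡0 r with toℕ r ℕ.<? gap e′ | toℕ r ℕ.<? gap e′ +ℕ d
        ... | yes r< | _      = skipped (skip-top r r<)
        ... | no  _  | no  r≮ = skipped (skip-bottom r (ℕ.≮⇒≥ r≮))
        ... | no  r≮ | yes r< = ≡.trans (cong v (Fin.toℕ-injective position)) (in-gap s s<d)
          where
          r∸gap<d : toℕ r ∸ℕ gap e′ <ℕ d
          r∸gap<d = ∸-<ʳ (ℕ.≮⇒≥ r≮) r<
          s : Fin N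
          s = fromℕ< (ℕ.<-≤-trans r∸gap<d d≤N)
          toℕ-s : toℕ s ≡ toℕ r ∸ℕ gap e′
          toℕ-s = Fin.toℕ-fromℕ< (ℕ.<-≤-trans r∸gap<d d≤N)
          s<d : toℕ s <ℕ d
          s<d = subst (_<ℕ d) (≡.sym toℕ-s) r∸gap<d
          position : toℕ (pivotₑ e r) ≡ toℕ (freeₑ e′ s)
          position = begin
            toℕ (pivotₑ e r)                     ≡⟨ pivot-top e r (ℕ.<-≤-trans r< gap′+d≤gap) ⟩
            toℕ r                                ≡⟨ ℕ.m+[n∸m]≡n (ℕ.≮⇒≥ r≮) ⟨
            gap e′ +ℕ (toℕ r ∸ℕ gap e′)          ≡⟨ cong (gap e′ +ℕ_) toℕ-s ⟨
            gap e′ +ℕ toℕ s                      ≡⟨ free-gap e′ s s<d ⟨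
            toℕ (freeₑ e′ s)                     ∎
            where open ≡-Reasoning

    -- The layout of (B | I).
    lastLayout : Layout
    lastLayout = record
      { classify = classify′ ; pivot = pivot′ ; free = free′ ; classify-pivot = classify-pivot′ ; classify-free = classify-free′ }
      where
      N+k≡n : N +ℕ k ≡ n
      N+k≡n = ≡.trans (ℕ.+-comm N k) k+N≡n
      classify′ : Fin n → Fin k ⊎ Fin N
      classify′ c with toℕ c ℕ.<? N
      ... | yes c< = inj₂ (fromℕ< c<)
      ... | no  c≮ = inj₁ (fromℕ< {toℕ c ∸ℕ N} (∸-<ʳ (ℕ.≮⇒≥ c≮) (subst (toℕ c <ℕ_) (≡.sym N+k≡n) (Fin.toℕ<n c))))
      pivot′ : Fin k → Fin n
      pivot′ r = fromℕ< (ℕ.<-≤-trans (ℕ.+-monoʳ-< N (Fin.toℕ<n r)) (ℕ.≤-reflexive N+k≡n))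
      free′ : Fin N → Fin n
      free′ s = fromℕ< (ℕ.<-≤-trans (Fin.toℕ<n s) (ℕ.m∸n≤m n k))
      classify-pivot′ : ∀ r → classify′ (pivot′ r) ≡ inj₁ r
      classify-pivot′ r with toℕ (pivot′ r) ℕ.<? N
      ... | yes <N = contradiction <N (ℕ.≤⇒≯ (ℕ.≤-trans (ℕ.m≤m+n N (toℕ r)) (ℕ.≤-reflexive (≡.sym (Fin.toℕ-fromℕ< _)))))
      ... | no  _  = cong inj₁ (Fin.toℕ-injective (≡.trans (Fin.toℕ-fromℕ< _)
                       (≡.trans (cong (_∸ℕ N) (Fin.toℕ-fromℕ< _)) (ℕ.m+n∸m≡n N (toℕ r)))))
      classify-free′ : ∀ s → classify′ (free′ s) ≡ inj₂ s
      classify-free′ s with toℕ (free′ s) ℕ.<? N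
      ... | yes _  = cong inj₂ (Fin.toℕ-injective (≡.trans (Fin.toℕ-fromℕ< _) (Fin.toℕ-fromℕ< _)))
      ... | no  ≮N = contradiction (subst (_<ℕ N) (≡.sym (Fin.toℕ-fromℕ< _)) (Fin.toℕ<n s)) ≮N

    -- `k + d ≤ N` places every pivot of the first word among the columns of `B`. Restriction to
    -- these columns is therefore injective, and a common vector restricts to an element of the row
    -- space of `B`.
    last-bounded : ∀ e A B {r} → RankIs F B r → r ≤ℕ k ∸ℕ d → Bounded (codeword (layout e) A) (codeword lastLayout B)
    last-bounded e A B {r} (w , _ , spans) r≤ c z ind z∈U z∈W =
      ℕ.≤-trans (ℕ.+-monoˡ-≤ d (ℕ.≤-trans (steinitz {b = λ j → z j ∘ free lastLayout} {w} restricted-indep restricted∈) r≤))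
                (ℕ.≤-reflexive (ℕ.m∸n+n≡m d≤k))
      where
      pivot-early : ∀ r → ∃ λ s → free lastLayout s ≡ pivotₑ e r
      pivot-early r = fromℕ< <N , Fin.toℕ-injective (≡.trans (Fin.toℕ-fromℕ< _) (Fin.toℕ-fromℕ< <N))
        where
        <N : toℕ (pivotₑ e r) <ℕ N
        <N = ℕ.<-≤-trans (pivot<k+d e r) k+d≤N
      restricted-indep : LinIndep F (λ j → z j ∘ free lastLayout)
      restricted-indep = restriction-indep {codeword (layout e) A} {codeword lastLayout B} (free lastLayout)
        (λ v v∈U _ eq → vanish-on-pivots (layout e) A v∈U (λ r → ≡.trans (cong v (≡.sym (proj₂ (pivot-early r)))) (eq _)))
        ind z∈U z∈W
      restricted∈ : ∀ j → InSpan F w (z j ∘ free lastLayout)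
      restricted∈ j = proj₁ (spans _) (proj₁ (z∈W j) , λ s →
        ≡.trans (proj₂ (z∈W j) (free lastLayout s)) (read-free lastLayout B (proj₁ (z∈W j)) s))

    liftRow-identity : ∀ A r c r′ → toℕ c ≡ toℕ r′ → liftRow F {n} {k} A r c ≡ δ r r′
    liftRow-identity A r c r′ c≡r′ with toℕ c ℕ.<? k
    ... | no  c≮k = contradiction (subst (_<ℕ k) (≡.sym c≡r′) (Fin.toℕ<n r′)) c≮k
    ... | yes _ with toℕ r ℕ.≟ toℕ c
    ...   | yes r≡c = ≡.sym (≡.trans (cong (δ r) (Fin.toℕ-injective (≡.sym (≡.trans r≡c c≡r′)))) (δ-diag r))
    ...   | no  r≢c = ≡.sym (δ-off λ r≡r′ → r≢c (≡.trans (cong toℕ r≡r′) (≡.sym c≡r′)))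

    liftRow-matrix : ∀ A r c s → toℕ c ≡ k +ℕ toℕ s → liftRow F {n} {k} A r c ≡ A (r , s)
    liftRow-matrix A r c s c≡ with toℕ c ℕ.<? k
    ... | yes c<k = contradiction c<k (ℕ.≤⇒≯ (ℕ.≤-trans (ℕ.m≤m+n k (toℕ s)) (ℕ.≤-reflexive (≡.sym c≡))))
    ... | no  _   = cong (λ s → A (r , s)) (Fin.toℕ-injective (≡.trans (Fin.toℕ-fromℕ< _)
                      (≡.trans (cong (_∸ℕ k) c≡) (ℕ.m+n∸m≡n k (toℕ s)))))

    -- For `e = 0` the gap starts at column k, right behind the pivots, so this layout is (I | A).
    liftRow-layout : ∀ A r c → liftRow F {n} {k} A r c ≡ generator (layout 0) A r c
    liftRow-layout A r c = by-cases (toℕ c ℕ.<? k)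
      where
      by-cases : Dec (toℕ c <ℕ k) → liftRow F {n} {k} A r c ≡ generator (layout 0) A r c
      by-cases (yes c<k) = ≡.trans (liftRow-identity A r c r′ (≡.sym toℕ-r′))
        (cong [ δ r , (λ s → A (r , s)) ]′ (≡.sym (classify-top 0 c r′ c<k (≡.sym toℕ-r′))))
        where
        r′ : Fin k
        r′ = fromℕ< c<k
        toℕ-r′ : toℕ r′ ≡ toℕ c
        toℕ-r′ = Fin.toℕ-fromℕ< c<k
      by-cases (no c≮k) = ≡.trans (liftRow-matrix A r c s toℕ-c) (cong [ δ r , (λ s → A (r , s)) ]′ (≡.sym classified))
        where
        s : Fin N
        s = fromℕ< (ℕ.∸-monoˡ-< (Fin.toℕ<n c) (ℕ.≮⇒≥ c≮k))
        toℕ-c : toℕ c ≡ k +ℕ toℕ s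
        toℕ-c = ≡.sym (≡.trans (cong (k +ℕ_) (Fin.toℕ-fromℕ< _)) (ℕ.m+[n∸m]≡n (ℕ.≮⇒≥ c≮k)))
        classified : classifyₑ 0 c ≡ inj₂ s
        classified with toℕ s ℕ.<? d
        ... | yes s<d = classify-gap 0 c s s<d toℕ-c
        ... | no  s≮d = classify-rest 0 c s (ℕ.≮⇒≥ s≮d) toℕ-c

all-pairs-lookup : ∀ {a ℓ} {A : Set a} {R : A → A → Set ℓ} {xs : List A} → (∀ {x y} → R x y → R y x) →
                   AllPairs R xs → ∀ i j → i ≢ j → R (lookup xs i) (lookup xs j)
all-pairs-lookup R-sym (Rx ∷ Rxs) zero    zero    i≢j = contradiction refl i≢j
all-pairs-lookup R-sym (Rx ∷ Rxs) zero    (suc j) i≢j = All.lookup Rx (∈-lookup j)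
all-pairs-lookup R-sym (Rx ∷ Rxs) (suc i) zero    i≢j = R-sym (All.lookup Rx (∈-lookup i))
all-pairs-lookup R-sym (Rx ∷ Rxs) (suc i) (suc j) i≢j = all-pairs-lookup R-sym Rxs i j (i≢j ∘ cong suc)

-- The rank-metric codes of the levels

module RankMetricCodes {q : ℕ} (F : FiniteField q) {n k d : ℕ} (0<k : 0 ℕ.< k) (0<d : 0 ℕ.< d) (d≤k : d ℕ.≤ k)
  (2k+d≤n : k ℕ.+ k ℕ.+ d ℕ.≤ n)
  (ext : ExtensionField F (n ℕ.∸ k)) (narrowExt : ExtensionField F (n ℕ.∸ k ℕ.∸ d)) where
  open LinearAlgebra F
  open Codewords F {n} {k} {d} d≤k
  open Shifted 2k+d≤n
  open import Data.Nat using () renaming (_+_ to _+ℕ_; _*_ to _*ℕ_; _∸_ to _∸ℕ_; _≤_ to _≤ℕ_; _<_ to _<ℕ_; _^_ to _^ℕ_)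

  -- The number of coefficients of the q-polynomials. Since k ≤ N, the MRD dimension is N * s.
  s : ℕ
  s = (k ∸ℕ d) +ℕ 1

  <s⇒ : ∀ {t} → t <ℕ s → t +ℕ d ≤ℕ k
  <s⇒ {t} t<s = ℕ.≤-trans (ℕ.+-monoˡ-≤ d (ℕ.≤-pred (ℕ.≤-trans t<s (ℕ.≤-reflexive (ℕ.+-comm (k ∸ℕ d) 1)))))
                          (ℕ.≤-reflexive (ℕ.m∸n+n≡m d≤k))

  kernelBound-resp : ∀ {A B} → A ≋ B → KernelBound A → KernelBound B
  kernelBound-resp A≋B bound t z ind z∈ker =
    bound t z ind (λ j → ≋-trans (lc-congʳ (z j) (λ r s → A≋B (r , s))) (z∈ker j))

  Distant : Mat F k N → Mat F k N → Set
  Distant A B = KernelBound (_⊖_ F A B)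

  words : ∀ {c} → ((Fin c → 𝔽) → Mat F k N) → List (Mat F k N)
  words {c} T = tabulate {n = q ^ℕ c} (T ∘ vec)

  words-distant : ∀ {c} {T : (Fin c → 𝔽) → Mat F k N} → IsLinear T → (∀ u → ¬ (u ≋ 𝟘 F) → KernelBound (T u)) →
                  AllPairs Distant (words T)
  words-distant {c} {T} lin bound = AllPairs.tabulate⁺ λ {i} {j} i≢j →
    kernelBound-resp (T-⊖ lin (vec i) (vec j)) (bound (_⊖_ F (vec i) (vec j)) (λ eq → i≢j (vec-injective {c} (⊖≋𝟘⇒≋ eq))))

  open Gabidulin.Code F ext k≤N s

  encode-bound : ∀ c → ¬ (c ≋ 𝟘 F) → KernelBound (encode c)
  encode-bound c c≉0 t z ind z∈ker = <s⇒ (encode-kernel c c≉0 z ind z∈ker)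

  encode-injective : ∀ c → encode c ≋ 𝟘 F → c ≋ 𝟘 F
  encode-injective c eq with ≋? c (𝟘 F)
  ... | yes c≋0 = c≋0
  ... | no  c≉0 = contradiction (encode-bound c c≉0 k δ δ-indep (λ j → lc-𝟘ʳ (δ j) (λ r s → eq (r , s))))
                                (ℕ.<⇒≱ (ℕ.m<m+n k 0<d))

  mrd : Subspace F (Fin k × Fin N)
  mrd = span (encode ∘ δ)

  mrd⇒encode : ∀ {A} → mem mrd A → ∃ λ c → A ≋ encode c
  mrd⇒encode (c , eq) = c , ≋-trans eq (≋-sym (linear-on-δ encode-linear c))

  mrd-isMRD : IsMRD F k N d mrd
  mrd-isMRD = dimension , λ A A∈ A≉0 → rank A A≉0 (mrd⇒encode A∈)
    where
    rank : ∀ A → ¬ (A ≋ 𝟘 F) → (∃ λ c → A ≋ encode c) → ∃ λ r → RankIs F A r × d ≤ℕ r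
    rank A A≉0 (c , A≋) = kernelBound⇒rank (kernelBound-resp (≋-sym A≋)
      (encode-bound c (λ c≋0 → A≉0 (≋-trans A≋ (T-𝟘 encode-linear c≋0)))))
    dimension : HasDim F (mem mrd) ((k ℕ.⊔ N) *ℕ (((k ℕ.⊓ N) ∸ℕ d) +ℕ 1))
    dimension = subst₂ (λ a b → HasDim F (mem mrd) (a *ℕ ((b ∸ℕ d) +ℕ 1))) (≡.sym (ℕ.m≤n⇒m⊔n≡n k≤N)) (≡.sym (ℕ.m≤n⇒m⊓n≡m k≤N))
      (indep⇒dim (λ c eq → encode-injective c (≋-trans (linear-on-δ encode-linear c) eq)))

  module AtLevel (e : ℕ) (e≤k : e ≤ℕ k) where

    bottomRow : Fin e → Fin k
    bottomRow i = fromℕ< {gap e +ℕ toℕ i} (ℕ.<-≤-trans (ℕ.+-monoʳ-< (gap e) (Fin.toℕ<n i)) (ℕ.≤-reflexive (ℕ.m∸n+n≡m e≤k)))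

    gapPosition : Fin (e *ℕ d) → Fin k × Fin N
    gapPosition x = bottomRow (proj₁ (Fin.remQuot {e} d x)) , Fin.inject≤ (proj₂ (Fin.remQuot {e} d x)) d≤N

    gapEntries : (Fin (N *ℕ s) → 𝔽) → Fin (e *ℕ d) → 𝔽
    gapEntries c = encode c ∘ gapPosition

    gapEntries-linear : IsLinear gapEntries
    gapEntries-linear = reindex-linear gapPosition encode-linear

    gap-free : ∀ c → gapEntries c ≋ 𝟘 F → FreeOfGap e (encode c)
    gap-free c eq r t gap≤r t<d = ≡.trans (cong (encode c) (cong₂ _,_ row≡ column≡)) (eq (Fin.combine i j))
      where
      i<e : toℕ r ∸ℕ gap e <ℕ e
      i<e = ∸-<ʳ gap≤r (ℕ.<-≤-trans (Fin.toℕ<n r) (ℕ.≤-reflexive (≡.sym (ℕ.m∸n+n≡m e≤k))))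
      i : Fin e
      i = fromℕ< i<e
      j : Fin d
      j = fromℕ< t<d
      row≡ : r ≡ bottomRow (proj₁ (Fin.remQuot {e} d (Fin.combine i j)))
      row≡ = ≡.trans (Fin.toℕ-injective (≡.sym (≡.trans (Fin.toℕ-fromℕ< _)
               (≡.trans (cong (gap e +ℕ_) (Fin.toℕ-fromℕ< i<e)) (ℕ.m+[n∸m]≡n gap≤r)))))
               (cong (bottomRow ∘ proj₁) (≡.sym (Fin.remQuot-combine {e} {d} i j)))
      column≡ : t ≡ Fin.inject≤ (proj₂ (Fin.remQuot {e} d (Fin.combine i j))) d≤N
      column≡ = ≡.trans (Fin.toℕ-injective (≡.sym (≡.trans (Fin.toℕ-inject≤ j d≤N) (Fin.toℕ-fromℕ< t<d))))
                  (cong (λ p → Fin.inject≤ (proj₂ p) d≤N) (≡.sym (Fin.remQuot-combine {e} {d} i j)))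

    solutions : ∃ λ c → HasDim F (λ u → gapEntries u ≋ 𝟘 F) c
    solutions = dim-exists (kernel gapEntries-linear) (λ u → ≋? (gapEntries u) (𝟘 F))

    dimension : ℕ
    dimension = proj₁ solutions

    basis : Fin dimension → Fin (N *ℕ s) → 𝔽
    basis = proj₁ (proj₂ solutions)

    -- The conditions form a linear map into F^(e d), of rank at most e d. They may be dependent,
    -- hence only a lower bound.
    dimension-≥ : N *ℕ s ∸ℕ e *ℕ d ≤ℕ dimension
    dimension-≥ with rank-exists (gapEntries ∘ δ)
    ... | r , rank@(w , w-ind , _) = ℕ.m≤n+o⇒m∸n≤o (N *ℕ s) (e *ℕ d) (begin
      N *ℕ s                  ≤⟨ rank+nullity-≥ (gapEntries ∘ δ) (HasDim-resp
                                   (λ u → ≋-trans (≋-sym (linear-on-δ gapEntries-linear u)))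
                                   (λ u → ≋-trans (linear-on-δ gapEntries-linear u)) (proj₂ solutions)) rank ⟩
      dimension +ℕ r          ≤⟨ ℕ.+-monoʳ-≤ dimension (indep⇒≤ {b = w} w-ind) ⟩
      dimension +ℕ e *ℕ d     ≡⟨ ℕ.+-comm dimension (e *ℕ d) ⟩
      e *ℕ d +ℕ dimension     ∎)
      where open ℕ.≤-Reasoning

    combination : (Fin dimension → 𝔽) → Mat F k N
    combination u = encode (lc u basis)

    combination-linear : IsLinear combination
    combination-linear = ∘-linear encode-linear (lc-linear basis)

    matrices : List (Mat F k N)
    matrices = words combination

    matrices-length : length matrices ≡ q ^ℕ dimension
    matrices-length = length-tabulate {n = q ^ℕ dimension} (combination ∘ vec)

    matrices-distant : AllPairs Distant matrices
    matrices-distant = words-distant combination-linear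
      (λ u u≉0 → encode-bound (lc u basis) (u≉0 ∘ proj₁ (proj₂ (proj₂ solutions)) u))

    matrices-free : All (FreeOfGap e) matrices
    matrices-free = All.tabulate⁺ (λ t → gap-free (lc (vec t) basis)
      (proj₂ (proj₂ (proj₂ (proj₂ solutions)) (lc (vec t) basis)) (vec t , λ _ → refl)))

    matrices-complete : ∀ c → gapEntries c ≋ 𝟘 F → Any (λ A → encode c ≋ A) matrices
    matrices-complete c c∈ with proj₁ (proj₂ (proj₂ (proj₂ solutions)) c) c∈
    ... | u , c≋ = Any.tabulate⁺ (vecIndex u) (T-cong encode-linear
          (≋-trans c≋ (lc-congˡ basis (≋-sym (vec-vecIndex u)))))

  -- At the last level fewer than d top rows are left, and giving up d whole columns costs less than the conditions on
  -- the entries in the gap.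
  k≤N∸d : k ≤ℕ N ∸ℕ d
  k≤N∸d = ℕ.m+n≤o⇒m≤o∸n k k+d≤N

  module Narrow = Gabidulin.Code F narrowExt k≤N∸d s

  widen : Mat F k (N ∸ℕ d) → Mat F k N
  widen A (r , t) with toℕ t ℕ.<? d
  ... | yes _  = 0#
  ... | no t≮d = A (r , fromℕ< (ℕ.∸-monoˡ-< (Fin.toℕ<n t) (ℕ.≮⇒≥ t≮d)))

  widen-linear : IsLinear widen
  widen-linear = record { T-cong = w-cong ; T-⊕ = w-⊕ ; T-⊙ = w-⊙ }
    where
    w-cong : ∀ {A B} → A ≋ B → widen A ≋ widen B
    w-cong eq (r , t) with toℕ t ℕ.<? d
    ... | yes _ = refl
    ... | no  _ = eq _
    w-⊕ : ∀ A B → widen (_⊕_ F A B) ≋ _⊕_ F (widen A) (widen B)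
    w-⊕ A B (r , t) with toℕ t ℕ.<? d
    ... | yes _ = ≡.sym (+-identityˡ 0#)
    ... | no  _ = refl
    w-⊙ : ∀ a A → widen (_⊙_ F a A) ≋ _⊙_ F a (widen A)
    w-⊙ a A (r , t) with toℕ t ℕ.<? d
    ... | yes _ = ≡.sym (zeroʳ a)
    ... | no  _ = refl

  widen-free : ∀ e A → FreeOfGap e (widen A)
  widen-free e A r t _ t<d with toℕ t ℕ.<? d
  ... | yes _  = refl
  ... | no t≮d = contradiction t<d t≮d

  -- Since all columns reappear, the left kernel does not grow under widening and the rank bound
  -- carries over.
  widen-column : ∀ A (t : Fin (N ∸ℕ d)) → ∃ λ t′ → ∀ r → widen A (r , t′) ≡ A (r , t)
  widen-column A t = t′ , same
    where
    t′ : Fin N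
    t′ = fromℕ< {d +ℕ toℕ t} (ℕ.<-≤-trans (ℕ.+-monoʳ-< d (Fin.toℕ<n t)) (ℕ.≤-reflexive (ℕ.m+[n∸m]≡n d≤N)))
    toℕ-t′ : toℕ t′ ≡ d +ℕ toℕ t
    toℕ-t′ = Fin.toℕ-fromℕ< _
    same : ∀ r → widen A (r , t′) ≡ A (r , t)
    same r with toℕ t′ ℕ.<? d
    ... | yes t′<d = contradiction t′<d (ℕ.≤⇒≯ (ℕ.≤-trans (ℕ.m≤m+n d (toℕ t)) (ℕ.≤-reflexive (≡.sym toℕ-t′))))
    ... | no  _    = cong (λ t → A (r , t)) (Fin.toℕ-injective (≡.trans (Fin.toℕ-fromℕ< _)
                       (≡.trans (cong (_∸ℕ d) toℕ-t′) (ℕ.m+n∸m≡n d (toℕ t)))))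

  narrowWord : (Fin ((N ∸ℕ d) *ℕ s) → 𝔽) → Mat F k N
  narrowWord c = widen (Narrow.encode c)

  narrowWord-linear : IsLinear narrowWord
  narrowWord-linear = ∘-linear widen-linear Narrow.encode-linear

  narrowWord-bound : ∀ c → ¬ (c ≋ 𝟘 F) → KernelBound (narrowWord c)
  narrowWord-bound c c≉0 t z ind z∈ker = <s⇒ (Narrow.encode-kernel c c≉0 z ind narrow-kernel)
    where
    narrow-kernel : ∀ j → lc (z j) (row F (Narrow.encode c)) ≋ 𝟘 F
    narrow-kernel j t = ≡.trans (∑-cong k (λ r → cong (z j r *_) (≡.sym (proj₂ column r)))) (z∈ker j (proj₁ column))
      where column = widen-column (Narrow.encode c) t

  narrowMatrices : List (Mat F k N)
  narrowMatrices = words narrowWord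

  narrowMatrices-length : length narrowMatrices ≡ q ^ℕ ((N ∸ℕ d) *ℕ s)
  narrowMatrices-length = length-tabulate {n = q ^ℕ ((N ∸ℕ d) *ℕ s)} (narrowWord ∘ vec)

-- The multilevel construction

-- With Q = 1 + R, the recursion behind B(1 + Q⁻¹ + ⋯ + Q⁻ⁱ⁺¹) = B(Qⁱ − 1)Q / (Qⁱ(Q − 1)), cleared of denominators.
module GeometricSum (B R : ℕ) where
  open import Data.Nat using (_+_; _*_; _^_; _∸_; _≤_)
  open import Data.Nat.Solver using (module +-*-Solver)
  open +-*-Solver
  open ℕ.≤-Reasoning

  Q : ℕ
  Q = suc R

  Q^i : ∀ i → suc (Q ^ i ∸ 1) ≡ Q ^ i
  Q^i i = ℕ.m+[n∸m]≡n (ℕ.m^n>0 Q i)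

  geometric-step : ∀ i S a → B * (Q ^ i ∸ 1) * Q ≤ S * (Q ^ i * R) → B ≤ a * Q ^ i →
                   B * (Q ^ suc i ∸ 1) * Q ≤ (S + a) * (Q ^ suc i * R)
  geometric-step i S a bound B≤ = begin
    B * (Q ^ suc i ∸ 1) * Q             ≡⟨ cong (λ y → B * (Q * y ∸ 1) * Q) (Q^i i) ⟨
    -- With `Q ^ i` written as `suc x`, the truncated subtraction in `Q * suc x ∸ 1` computes away.
    B * (x + R * suc x) * Q             ≡⟨ solve 3 (λ b x r → b :* (x :+ r :* (con 1 :+ x)) :* (con 1 :+ r)
                                             := (con 1 :+ r) :* (b :* x :* (con 1 :+ r)) :+ b :* (r :* (con 1 :+ r))) refl B x R ⟩
    Q * (B * x * Q) + B * (R * Q)       ≤⟨ ℕ.+-mono-≤ (ℕ.*-monoʳ-≤ Q bound) (ℕ.*-monoˡ-≤ (R * Q) B≤) ⟩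
    Q * (S * (Q ^ i * R)) + a * Q ^ i * (R * Q)
                                        ≡⟨ solve 4 (λ s a p r → (con 1 :+ r) :* (s :* (p :* r)) :+ a :* p :* (r :* (con 1 :+ r))
                                             := (s :+ a) :* ((con 1 :+ r) :* p :* r)) refl S a (Q ^ i) R ⟩
    (S + a) * (Q ^ suc i * R)           ∎
    where x = Q ^ i ∸ 1

  -- A factor Q cancels, because Q^(i+1) R = (Q^(i+1) - Q^i) Q.
  geometric-conclusion : ∀ i S → B * (Q ^ suc i ∸ 1) * Q ≤ S * (Q ^ suc i * R) →
                         B * (Q ^ suc i ∸ 1) ≤ S * (Q ^ suc i ∸ Q ^ i)
  geometric-conclusion i S bound = ℕ.*-cancelʳ-≤ _ _ Q (begin
    B * (Q ^ suc i ∸ 1) * Q        ≤⟨ bound ⟩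
    S * (Q ^ suc i * R)            ≡⟨ solve 3 (λ s p r → s :* ((con 1 :+ r) :* p :* r) := s :* (r :* p) :* (con 1 :+ r)) refl S (Q ^ i) R ⟩
    S * (R * Q ^ i) * Q            ≡⟨ cong (λ y → S * y * Q) (ℕ.m+n∸m≡n (Q ^ i) (R * Q ^ i)) ⟨
    S * (Q ^ suc i ∸ Q ^ i) * Q    ∎)

module Multilevel {q : ℕ} (F : FiniteField q) {n k d : ℕ} (0<k : 0 ℕ.< k) (0<d : 0 ℕ.< d) (d≤k : d ℕ.≤ k)
  (2k+d≤n : k ℕ.+ k ℕ.+ d ℕ.≤ n)
  (ext : ExtensionField F (n ℕ.∸ k)) (narrowExt : ExtensionField F (n ℕ.∸ k ℕ.∸ d)) where
  open LinearAlgebra F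
  open Codewords F {n} {k} {d} d≤k
  open Layout
  open Shifted 2k+d≤n
  open RankMetricCodes F 0<k 0<d d≤k 2k+d≤n ext narrowExt
  open Gabidulin.Code F ext k≤N s using (encode)
  open import Data.Nat using () renaming (_+_ to _+ℕ_; _*_ to _*ℕ_; _∸_ to _∸ℕ_; _≤_ to _≤ℕ_; _<_ to _<ℕ_; _^_ to _^ℕ_)

  far-same : ∀ L {As} → AllPairs Distant As → AllPairs Far (map (codeword L) As)
  far-same L distant = AllPairs.map⁺ (AllPairs.map (λ {A} {B} bound →
    bounded⇒far L A L B (same-layout-bounded L A B bound)) distant)

  -- One inequality covers all levels before `i`, and it is the hypothesis of `shifted-bounded` for
  -- the gap of level `i`.
  Before : ℕ → Subspace F (Fin n) → Set₁
  Before i U = ∃ λ e → ∃ λ A → e +ℕ d ≤ℕ i *ℕ d × U ≡ codeword (layout e) A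

  far-level : ∀ i {As} → i *ℕ d ≤ℕ k → All (FreeOfGap (i *ℕ d)) As → ∀ {U} → Before i U →
              All (Far U) (map (codeword (layout (i *ℕ d))) As)
  far-level i {As} i*d≤k free (e , A , e+d≤ , refl) = All.map⁺ (All.map (λ {B} B-free →
    bounded⇒far (layout e) A (layout (i *ℕ d)) B (shifted-bounded e (i *ℕ d) A B e+d≤ i*d≤k B-free)) free)

  in-level : ∀ i (As : List (Mat F k N)) → All (Before (suc i)) (map (codeword (layout (i *ℕ d))) As)
  in-level i As = All.map⁺ (All.tabulate (λ {A} _ → i *ℕ d , A , ℕ.≤-reflexive (ℕ.+-comm (i *ℕ d) d) , refl))

  before-suc : ∀ {i U} → Before i U → Before (suc i) U
  before-suc {i} (e , A , e+d≤ , eq) = e , A , ℕ.≤-trans e+d≤ (ℕ.m≤n+m (i *ℕ d) d) , eq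

  B R : ℕ
  B = q ^ℕ (N *ℕ s)
  R = q ^ℕ (d *ℕ d) ∸ℕ 1

  Q≡ : suc R ≡ q ^ℕ (d *ℕ d)
  Q≡ = ℕ.m+[n∸m]≡n (ℕ.m^n>0 q {{q≢0}} (d *ℕ d))
    where
    q≢0 : NonZero q
    q≢0 = ℕ.>-nonZero (ℕ.≤-trans (s≤s z≤n) 2≤q)

  -- `size` is the invariant of `geometric-step` with Q = `suc R` = q^(d²). `lifted` is conditional
  -- because the lifted code only enters with level 0, in the step to `Levels 1`.
  record Levels (i : ℕ) : Set₁ where
    field
      code    : List (Subspace F (Fin n))
      before  : All (Before i) code
      far     : AllPairs Far code
      size    : B *ℕ (suc R ^ℕ i ∸ℕ 1) *ℕ suc R ≤ℕ length code *ℕ (suc R ^ℕ i *ℕ R)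
      lifted  : 0 <ℕ i → ∀ c → Any (λ U → ∃ λ A → encode c ≋ A × U ≡ codeword (layout 0) A) code

  -- The gap conditions cost at most i d² dimensions, and the factor q^(i d²) makes up for them.
  level-size : ∀ i (i*d≤k : i *ℕ d ≤ℕ k) → B ≤ℕ length (AtLevel.matrices (i *ℕ d) i*d≤k) *ℕ suc R ^ℕ i
  level-size i i*d≤k = begin
    q ^ℕ (N *ℕ s)                                             ≤⟨ ℕ.^-monoʳ-≤ q {{q≢0}} exponent ⟩
    q ^ℕ (dimension +ℕ d *ℕ d *ℕ i)                           ≡⟨ ℕ.^-distribˡ-+-* q dimension (d *ℕ d *ℕ i) ⟩
    q ^ℕ dimension *ℕ q ^ℕ (d *ℕ d *ℕ i)                      ≡⟨ cong₂ _*ℕ_ matrices-length (ℕ.^-*-assoc q (d *ℕ d) i) ⟨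
    length matrices *ℕ (q ^ℕ (d *ℕ d)) ^ℕ i                   ≡⟨ cong (λ Q → length matrices *ℕ Q ^ℕ i) Q≡ ⟨
    length matrices *ℕ suc R ^ℕ i                             ∎
    where
    open ℕ.≤-Reasoning
    open AtLevel (i *ℕ d) i*d≤k
    q≢0 : NonZero q
    q≢0 = ℕ.>-nonZero (ℕ.≤-trans (s≤s z≤n) 2≤q)
    exponent : N *ℕ s ≤ℕ dimension +ℕ d *ℕ d *ℕ i
    exponent = begin
      N *ℕ s                                            ≤⟨ ℕ.m≤n+m∸n (N *ℕ s) (i *ℕ d *ℕ d) ⟩
      i *ℕ d *ℕ d +ℕ (N *ℕ s ∸ℕ i *ℕ d *ℕ d)            ≤⟨ ℕ.+-monoʳ-≤ (i *ℕ d *ℕ d) dimension-≥ ⟩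
      i *ℕ d *ℕ d +ℕ dimension                          ≡⟨ ℕ.+-comm (i *ℕ d *ℕ d) dimension ⟩
      dimension +ℕ i *ℕ d *ℕ d                          ≡⟨ cong (dimension +ℕ_) (≡.trans (ℕ.*-assoc i d d) (ℕ.*-comm i (d *ℕ d))) ⟩
      dimension +ℕ d *ℕ d *ℕ i                          ∎

  module NextLevel (i : ℕ) (i*d≤k : i *ℕ d ≤ℕ k) (previous : Levels i) where
    open Levels previous
    open AtLevel (i *ℕ d) i*d≤k
    open GeometricSum B R

    block : List (Subspace F (Fin n))
    block = map (codeword (layout (i *ℕ d))) matrices

    total : length (code ++ block) ≡ length code +ℕ length matrices
    total = ≡.trans (length-++ code) (cong (length code +ℕ_) (length-map (codeword (layout (i *ℕ d))) matrices))

    next-size : B *ℕ (suc R ^ℕ suc i ∸ℕ 1) *ℕ suc R ≤ℕ length (code ++ block) *ℕ (suc R ^ℕ suc i *ℕ R)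
    next-size = ℕ.≤-trans (geometric-step i (length code) (length matrices) size (level-size i i*d≤k))
                          (ℕ.≤-reflexive (cong (_*ℕ (suc R ^ℕ suc i *ℕ R)) (≡.sym total)))

    next-far : AllPairs Far (code ++ block)
    next-far = AllPairs.++⁺ far (far-same (layout (i *ℕ d)) matrices-distant) (All.map (far-level i i*d≤k matrices-free) before)

  next-lifted : ∀ i (i*d≤k : i *ℕ d ≤ℕ k) (previous : Levels i) → ∀ c →
    Any (λ U → ∃ λ A → encode c ≋ A × U ≡ codeword (layout 0) A) (Levels.code previous ++ NextLevel.block i i*d≤k previous)
  -- Level 0 has no gap entries, so its block is the whole MRD code.
  next-lifted zero    i*d≤k previous c = Any.++⁺ʳ (Levels.code previous)
    (Any.map⁺ (Any.map (λ {A} eq → A , eq , refl) (AtLevel.matrices-complete 0 i*d≤k c λ ())))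
  next-lifted (suc i) i*d≤k previous c = Any.++⁺ˡ (Levels.lifted previous (s≤s z≤n) c)

  next : ∀ i → i *ℕ d ≤ℕ k → Levels i → Levels (suc i)
  next i i*d≤k previous = record
    { code   = code ++ block
    ; before = All.++⁺ (All.map (before-suc {i}) before) (in-level i (AtLevel.matrices (i *ℕ d) i*d≤k))
    ; far    = next-far
    ; size   = next-size
    ; lifted = λ _ → next-lifted i i*d≤k previous
    }
    where
    open Levels previous
    open NextLevel i i*d≤k previous

  levels : ∀ i → i *ℕ d ≤ℕ k → Levels i
  levels zero    _ = record
    { code = [] ; before = [] ; far = []
    ; size = ℕ.≤-reflexive (cong (_*ℕ suc R) (ℕ.*-zeroʳ B)) ; lifted = λ () }
  levels (suc i) [1+i]d≤k = next i i*d≤k (levels i i*d≤k)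
    where
    i*d≤k : i *ℕ d ≤ℕ k
    i*d≤k = ℕ.≤-trans (ℕ.m≤n+m (i *ℕ d) d) [1+i]d≤k

  -- The distance is 2k - 2c, where c + d ≤ k.
  far⇒CDC : ∀ 𝒞 → All (λ U → HasDim F (mem U) k) 𝒞 → AllPairs Far 𝒞 → IsCDC F n (d +ℕ d) k 𝒞
  far⇒CDC 𝒞 dims far = (λ i → All.lookup dims (∈-lookup i)) , distance
    where
    distance : ∀ i j → i ≢ j → ∃ λ e → SubDistIs F (lookup 𝒞 i) (lookup 𝒞 j) e × d +ℕ d ≤ℕ e
    distance i j i≢j with all-pairs-lookup (λ {U} {W} → far-sym {U} {W}) far i j i≢j
    ... | c , dim , c+d≤k = (k +ℕ k) ∸ℕ (c +ℕ c) ,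
      (k , k , c , All.lookup dims (∈-lookup i) , All.lookup dims (∈-lookup j) , dim , refl) ,
      ℕ.m+n≤o⇒m≤o∸n (d +ℕ d) (ℕ.≤-trans (ℕ.≤-reflexive (solve 2 (λ c d → (d :+ d) :+ (c :+ c) := (c :+ d) :+ (c :+ d)) refl c d))
                                       (ℕ.+-mono-≤ c+d≤k c+d≤k))
      where
      open import Data.Nat.Solver using (module +-*-Solver)
      open +-*-Solver

  contains-lifted : ∀ 𝒞 → (∀ c → Any (λ U → ∃ λ A → encode c ≋ A × U ≡ codeword (layout 0) A) 𝒞) → LiftedIn F n k mrd 𝒞
  contains-lifted 𝒞 lifted A A∈ with mrd⇒encode A∈
  ... | c , A≋ = Any.index found , Any.lookup-index found
    where
    Spans : Subspace F (Fin n) → Set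
    Spans U = ∀ v → (mem U v → InSpan F (liftRow F {n} {k} A) v) × (InSpan F (liftRow F {n} {k} A) v → mem U v)
    spans : ∀ {U} → (∃ λ A′ → encode c ≋ A′ × U ≡ codeword (layout 0) A′) → Spans U
    spans (A′ , eq , refl) v =
      (λ (y , v≋) → y , ≋-trans v≋ (lc-congʳ y (λ r → ≋-sym (rows r)))) , (λ (y , v≋) → y , ≋-trans v≋ (lc-congʳ y rows))
      where
      rows : ∀ r → liftRow F {n} {k} A r ≋ generator (layout 0) A′ r
      rows r x = ≡.trans (liftRow-layout A r x) (generator-cong (classify (layout 0) x))
        where
        generator-cong : ∀ x → [ δ r , (λ t → A (r , t)) ]′ x ≡ [ δ r , (λ t → A′ (r , t)) ]′ x
        generator-cong (inj₁ _) = refl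
        generator-cong (inj₂ t) = ≡.trans (A≋ (r , t)) (eq (r , t))
    found : Any Spans 𝒞
    found = Any.map spans (lifted c)

  module Assembly (m : ℕ) (0<m : 0 <ℕ m) (m*d≤k : m *ℕ d ≤ℕ k) (lower : Levels m) (M : List (Mat F k N)) (rankCode : IsRankCode F k N d (k ∸ℕ d) M) where
    open Levels lower

    -- The narrow block takes the layout of level `m`: its first d columns vanish in every row, so
    -- it is free of that gap and `far-level` applies.
    narrowBlock lastBlock fullCode : List (Subspace F (Fin n))
    narrowBlock = map (codeword (layout (m *ℕ d))) narrowMatrices
    lastBlock   = tabulate (λ i → codeword lastLayout (lookup M i))
    fullCode    = (code ++ narrowBlock) ++ lastBlock

    before′ : All (Before (suc m)) (code ++ narrowBlock)
    before′ = All.++⁺ (All.map (before-suc {m}) before) (in-level m narrowMatrices)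

    far′ : AllPairs Far fullCode
    far′ = AllPairs.++⁺
      (AllPairs.++⁺ far (far-same (layout (m *ℕ d)) (words-distant narrowWord-linear narrowWord-bound))
        (All.map (far-level m m*d≤k (All.tabulate⁺ (λ t → widen-free (m *ℕ d) _))) before))
      (AllPairs.tabulate⁺ λ {i} {j} i≢j → far-last i j (proj₂ rankCode i j i≢j))
      (All.map far-before before′)
      where
      far-last : ∀ i j → (∃ λ r → RankIs F (_⊖_ F (lookup M i) (lookup M j)) r × d ≤ℕ r) →
                 Far (codeword lastLayout (lookup M i)) (codeword lastLayout (lookup M j))
      far-last i j (r , rank , d≤r) = bounded⇒far lastLayout (lookup M i) lastLayout (lookup M j)
        (same-layout-bounded lastLayout (lookup M i) (lookup M j) (rank⇒kernelBound rank d≤r))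
      far-before : ∀ {U} → Before (suc m) U → All (Far U) lastBlock
      far-before (e , A , _ , refl) = All.tabulate⁺ λ i → bounded⇒far (layout e) A lastLayout (lookup M i)
        (last-bounded e A (lookup M i) (proj₁ (proj₂ (proj₁ rankCode i))) (proj₂ (proj₂ (proj₁ rankCode i))))

    dims : All (λ U → HasDim F (mem U) k) fullCode
    dims = All.++⁺ (All.map (λ { (e , A , _ , refl) → codeword-dim (layout e) A }) before′)
                   (All.tabulate⁺ (λ i → codeword-dim lastLayout (lookup M i)))

    isCDC : IsCDC F n (d +ℕ d) k fullCode
    isCDC = far⇒CDC fullCode dims far′

    liftedIn : LiftedIn F n k mrd fullCode
    liftedIn = contains-lifted fullCode (λ c → Any.++⁺ˡ (Any.++⁺ˡ (lifted 0<m c)))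

    length-fullCode : length fullCode ≡ length code +ℕ (q ^ℕ ((N ∸ℕ d) *ℕ s) +ℕ length M)
    length-fullCode = begin
      length fullCode                                            ≡⟨ length-++ (code ++ narrowBlock) ⟩
      length (code ++ narrowBlock) +ℕ length lastBlock           ≡⟨ cong₂ _+ℕ_ (length-++ code) (length-tabulate (λ i → codeword lastLayout (lookup M i))) ⟩
      length code +ℕ length narrowBlock +ℕ length M              ≡⟨ ℕ.+-assoc (length code) _ _ ⟩
      length code +ℕ (length narrowBlock +ℕ length M)            ≡⟨ cong (λ l → length code +ℕ (l +ℕ length M))
                                                                      (≡.trans (length-map (codeword (layout (m *ℕ d))) narrowMatrices) narrowMatrices-length) ⟩
      length code +ℕ (q ^ℕ ((N ∸ℕ d) *ℕ s) +ℕ length M)          ∎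
      where open ≡-Reasoning

    size-fullCode : B *ℕ (q ^ℕ (m *ℕ (d *ℕ d)) ∸ℕ 1)
        +ℕ (q ^ℕ ((N ∸ℕ d) *ℕ s) +ℕ length M) *ℕ (q ^ℕ (m *ℕ (d *ℕ d)) ∸ℕ q ^ℕ ((m ∸ℕ 1) *ℕ (d *ℕ d)))
      ≤ℕ length fullCode *ℕ (q ^ℕ (m *ℕ (d *ℕ d)) ∸ℕ q ^ℕ ((m ∸ℕ 1) *ℕ (d *ℕ d)))
    size-fullCode = begin
      B *ℕ (q ^ℕ (m *ℕ (d *ℕ d)) ∸ℕ 1) +ℕ X *ℕ W    ≤⟨ ℕ.+-monoˡ-≤ (X *ℕ W) (main m 0<m size) ⟩
      length code *ℕ W +ℕ X *ℕ W                    ≡⟨ ℕ.*-distribʳ-+ W (length code) X ⟨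
      (length code +ℕ X) *ℕ W                       ≡⟨ cong (_*ℕ W) length-fullCode ⟨
      length fullCode *ℕ W                          ∎
      where
      open ℕ.≤-Reasoning
      open GeometricSum B R using (geometric-conclusion)
      X W : ℕ
      X = q ^ℕ ((N ∸ℕ d) *ℕ s) +ℕ length M
      W = q ^ℕ (m *ℕ (d *ℕ d)) ∸ℕ q ^ℕ ((m ∸ℕ 1) *ℕ (d *ℕ d))
      power : ∀ i → suc R ^ℕ i ≡ q ^ℕ (i *ℕ (d *ℕ d))
      power i = ≡.trans (cong (_^ℕ i) Q≡) (≡.trans (ℕ.^-*-assoc q (d *ℕ d) i) (cong (q ^ℕ_) (ℕ.*-comm (d *ℕ d) i)))
      -- Generalised over `m` so that on `suc i` the exponent `m ∸ 1` computes to `i`.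
      main : ∀ m → 0 <ℕ m → B *ℕ (suc R ^ℕ m ∸ℕ 1) *ℕ suc R ≤ℕ length code *ℕ (suc R ^ℕ m *ℕ R) →
             B *ℕ (q ^ℕ (m *ℕ (d *ℕ d)) ∸ℕ 1) ≤ℕ length code *ℕ (q ^ℕ (m *ℕ (d *ℕ d)) ∸ℕ q ^ℕ ((m ∸ℕ 1) *ℕ (d *ℕ d)))
      main (suc i) _ bound = subst₂ (λ x y → B *ℕ (x ∸ℕ 1) ≤ℕ length code *ℕ (x ∸ℕ y)) (power (suc i)) (power i)
        (geometric-conclusion i (length code) bound)

open import Data.Nat using (ℕ; _+_; _*_; _∸_; _^_; _≤_; _<_; _/_; NonZero)

-- With m = ⌊k/δ⌋ the fraction of the bound is (q^(mδ²) - 1)/(q^(mδ²) - q^((m-1)δ²)). Its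
-- denominator, positive as q ≥ 2 and m, δ ≥ 1, has been multiplied across; a largest rank code as
-- `M` gives the term with A^R.
theorem3p12 : (q : ℕ) (F : FiniteField q) (n k δ : ℕ) .{{_ : NonZero δ}} →
    0 < n → 0 < k → (k + k) + δ ≤ n → δ + δ ≤ k →
    (M : List (Mat F k (n ∸ k))) → IsRankCode F k (n ∸ k) δ (k ∸ δ) M →
    Σ (List (Subspace F (Fin n))) λ C → Σ (Subspace F (Fin k × Fin (n ∸ k))) λ D →
    IsCDC F n (δ + δ) k C × IsMRD F k (n ∸ k) δ D × LiftedIn F n k D C ×
    (q ^ ((n ∸ k) * ((k ∸ δ) + 1))) * (q ^ ((k / δ) * (δ * δ)) ∸ 1)
    + (q ^ ((n ∸ k ∸ δ) * ((k ∸ δ) + 1)) + length M)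
    * (q ^ ((k / δ) * (δ * δ)) ∸ q ^ (((k / δ) ∸ 1) * (δ * δ)))
    ≤ length C * (q ^ ((k / δ) * (δ * δ)) ∸ q ^ (((k / δ) ∸ 1) * (δ * δ)))
theorem3p12 q F n k δ 0<n 0<k 2k+δ≤n 2δ≤k M rankCode =
  fullCode , mrd , isCDC , mrd-isMRD , liftedIn , size-fullCode
  where
  δ≤k : δ ≤ k
  δ≤k = ℕ.≤-trans (ℕ.m≤m+n δ δ) 2δ≤k
  0<δ : 0 < δ
  0<δ = ℕ.>-nonZero⁻¹ δ
  k+δ≤N : k + δ ≤ n ∸ k
  k+δ≤N = Codewords.Shifted.k+d≤N F δ≤k 2k+δ≤n
  ext : ExtensionField F (n ∸ k)
  ext = extensionField F (n ∸ k) (ℕ.<-≤-trans 0<k (ℕ.≤-trans (ℕ.m≤m+n k δ) k+δ≤N))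
  narrowExt : ExtensionField F (n ∸ k ∸ δ)
  narrowExt = extensionField F (n ∸ k ∸ δ) (ℕ.<-≤-trans 0<k (ℕ.m+n≤o⇒m≤o∸n k k+δ≤N))
  open RankMetricCodes F 0<k 0<δ δ≤k 2k+δ≤n ext narrowExt using (mrd; mrd-isMRD)
  open Multilevel.Assembly F 0<k 0<δ δ≤k 2k+δ≤n ext narrowExt (k / δ) (m≥n⇒m/n>0 δ≤k) (m/n*n≤m k δ)
    (Multilevel.levels F 0<k 0<δ δ≤k 2k+δ≤n ext narrowExt (k / δ) (m/n*n≤m k δ)) M rankCode
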